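{- Let $G$ be a reductive group as in the context, let $\mathbf{R}$ be a finite multiset based in $I\dot{\times}\mathbb{Z}$, and let $w_\circ$ be the longest element of the Weyl group $W$. Then $$\operatorname{ch}\mathcal{M}(\mathbf{R})=\pi_{w_\circ}\operatorname{ch}\mathcal{M}(\mathbf{R},J)$$ for any upward-closed set $J\subseteq I\dot{\times}\mathbb{Z}$ containing $\operatorname{Supp}\mathbf{R}$.
   Context: Setting. $G$ is a reductive algebraic group over $\mathbb{C}$ with a fixed maximal torus and Borel subgroup, weight lattice $P$, simple roots $\alpha_i\in P$ and simple coroots $\alpha_i^\vee$ ($i\in I$), pairing $\langle\cdot,\cdot\rangle$, dominant weights $P^+$, finite Weyl group $W$ generated by the simple reflections $s_i$. $G$ is simply-laced (Cartan matrix symmetric with off-diagonal entries $0$ or $-1$), and the Dynkin diagram (vertex set $I$, $i\sim j$ iff $\langle\alpha_i^\vee,\alpha_j\rangle=-1$) is connected. Fix a two-colouring of the Dynkin diagram into even and odd vertices, and let $I\dot{\times}\mathbb{Z}=\{(i,c)\in I\times\mathbb{Z}: i,c\text{ have the same parity}\}$. Fix fundamental weights $\varpi_i\in P\otimes\mathbb{Q}$ with $\langle\alpha_i^\vee,\varpi_j\rangle=\delta_{ij}$. Multisets. A finite multiset based in $I\dot{\times}\mathbb{Z}$ is a finitely supported function $\mathbf{R}:I\dot{\times}\mathbb{Z}\to\mathbb{N}$, with values $\mathbf{R}[i,c]$. It is assumed that $\mathbf{R}[i,c]\varpi_i\in P$ for all $(i,c)$. Put $\operatorname{wt}(\mathbf{R})=\sum\mathbf{R}[i,c]\varpi_i$.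 Monomial crystal. Let $\mathcal{M}$ be the multiplicative abelian group of formal monomials $p=e^{\operatorname{wt}(p)}\prod_{(i,c)}y_{i,c}^{p[i,c]}$, with $\operatorname{wt}(p)\in P$ and $p[i,c]\in\mathbb{Z}$ for $(i,c)\in I\dot{\times}\mathbb{Z}$, finitely many nonzero, such that $\langle\alpha_i^\vee,\operatorname{wt}(p)\rangle=\sum_c p[i,c]$ for all $i$. For $(i,k)\in I\dot{\times}\mathbb{Z}$ let $z_{i,k}=e^{\alpha_i}y_{i,k}y_{i,k+2}\prod_{j\sim i}y_{j,k+1}^{ -1}$. Put $\varphi_i^k(p)=\sum_{l\ge k}p[i,l]$, $\varphi_i(p)=\max_k\varphi_i^k(p)$, $\varepsilon_i^k(p)=-\sum_{l\le k}p[i,l]$, $\varepsilon_i(p)=\max_k\varepsilon_i^k(p)$. If $\varphi_i(p)=0$ then $f_i(p)=0$; otherwise $f_i(p)=p\,z_{i,F-2}^{ -1}$ with $F$ the largest $k$ such that $\varphi_i^k(p)=\varphi_i(p)$. If $\varepsilon_i(p)=0$ then $e_i(p)=0$; otherwise $e_i(p)=p\,z_{i,E}$ with $E$ the smallest $k$ such that $\varepsilon_i^k(p)=\varepsilon_i(p)$. This makes $\mathcal{M}$ a $G$-crystal, i.e. isomorphic to a disjoint union of crystals $\mathcal{B}(\lambda)$ of irreducible modules $V(\lambda)$, $\lambda\in P^+$ (known). Product monomial crystal. For $n\ge0$ with $n\varpi_i\in P$, $\mathcal{M}(i,c)^n$ is the subcrystal of $\mathcal{M}$ generated by $e^{n\varpi_i}y_{i,c}^n$.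 Set $\mathcal{M}(\mathbf{R})=\prod_{(i,c)}\mathcal{M}(i,c)^{\mathbf{R}[i,c]}$, the set of all products of monomials taken one from each factor; $\mathcal{M}(\varnothing)=\{1\}$. It is known that $\mathcal{M}(\mathbf{R})$ is a subcrystal of $\mathcal{M}$; it is finite. With $y_{\mathbf{R}}=e^{\operatorname{wt}(\mathbf{R})}\prod y_{i,c}^{\mathbf{R}[i,c]}$ and $z_{\mathbf{S}}=\prod z_{i,k}^{\mathbf{S}[i,k]}$, each $p\in\mathcal{M}(\mathbf{R})$ is $p=y_{\mathbf{R}}z_{\mathbf{S}}^{ -1}$ for a unique finite multiset $\mathbf{S}$ based in $I\dot{\times}\mathbb{Z}$; put $\operatorname{Supp}_{\mathbf{R}}(p)=\operatorname{Supp}\mathbf{R}\cup\operatorname{Supp}\mathbf{S}$. Truncations. Let $\le$ be the partial order on $I\dot{\times}\mathbb{Z}$ generated by $(i,c)\le(i,c+2)$ and $(i,c)\le(j,c+1)$ for $j\sim i$; upward-closed is with respect to $\le$. For an upward-closed $J\supseteq\operatorname{Supp}\mathbf{R}$, the truncation is $\mathcal{M}(\mathbf{R},J)=\{p\in\mathcal{M}(\mathbf{R}):\operatorname{Supp}_{\mathbf{R}}(p)\subseteq J\}$. Characters. For a finite subset $X$ of a crystal, $\operatorname{ch}X=\sum_{x\in X}e^{\operatorname{wt}(x)}\in\mathbb{Z}[P]$. The Demazure operator $\pi_i:\mathbb{Z}[P]\to\mathbb{Z}[P]$ is the $\mathbb{Z}$-linear map $\pi_i(e^\lambda)=\dfrac{e^\lambda-e^{s_i\lambda-\alpha_i}}{1-e^{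 -\alpha_i}}$. The $\pi_i$ are idempotent and satisfy the braid relations; for $w=s_{i_1}\cdots s_{i_r}$ reduced, $\pi_w=\pi_{i_1}\cdots\pi_{i_r}$. -}

module Defs where

open import Data.Bool.Base using (true; false; if_then_else_)
open import Data.Fin.Base using (Fin; zero; suc)
import Data.Fin.Properties as Fin
open import Data.Integer.Base as ℤ using (ℤ; +_; -[1+_]; 0ℤ; 1ℤ; -1ℤ; ∣_∣; -_)
import Data.Integer.Properties as ℤ
open import Data.Integer.Tactic.RingSolver using (solve-∀)
open import Data.List.Base using (List; []; _∷_; _++_; map; concatMap; foldr; length; allFin; tabulate)
open import Data.List.Membership.Propositional using (_∈_)
open import Data.List.Relation.Unary.All using (All)
open import Data.List.Relation.Unary.Any using (Any)
open import Data.List.Relation.Unary.AllPairs using (AllPairs)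
open import Data.List.Relation.Unary.Unique.Propositional using (Unique)
open import Data.Nat.Base as ℕ using (ℕ; zero; suc; parity)
import Data.Nat.Properties as ℕ
open import Data.Parity.Base using (Parity; 0ℙ; 1ℙ) renaming (_⁻¹ to opposite)
open import Data.Product.Base using (Σ; Σ-syntax; ∃; _×_; _,_; proj₁; proj₂)
open import Data.Product.Properties using () renaming (≡-dec to Σ-≡-dec)
open import Data.Rational.Base as ℚ using (ℚ; 0ℚ; 1ℚ)
import Data.Rational.Properties as ℚ
import Data.Rational.Unnormalised.Base as ℚᵘ
import Data.Rational.Unnormalised.Properties as ℚᵘ
open import Data.Sum.Base using (_⊎_; inj₁; inj₂)
open import Data.Vec.Base as Vec using (Vec; []; _∷_)
import Data.Vec.Properties as Vec
open import Function.Base using (_∘_; id; case_of_)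
open import Level using (0ℓ)
open import Relation.Binary.Construct.Closure.ReflexiveTransitive using (Star)
open import Relation.Binary.Definitions using (DecidableEquality)
open import Relation.Binary.PropositionalEquality.Core using (_≡_; _≢_; refl; sym; trans; cong; cong₂; subst)
open import Relation.Binary.PropositionalEquality.Properties using (module ≡-Reasoning)
open import Relation.Nullary.Decidable.Core using (Dec; yes; no; does; _×-dec_)
open import Relation.Nullary.Decidable using (dec-true; dec-false)
open import Relation.Nullary.Negation.Core using (¬_; contradiction)
open import Relation.Unary using (Pred; Decidable; _⊆_; _∪_)

infixl 6 _⊕_ _⊝_
infixr 7 _•_

_⊕_ : ∀ {n} → Vec ℤ n → Vec ℤ n → Vec ℤ n
_⊕_ = Vec.zipWith ℤ._+_

⊖_ : ∀ {n} → Vec ℤ n → Vec ℤ n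
⊖_ = Vec.map (-_)

_⊝_ : ∀ {n} → Vec ℤ n → Vec ℤ n → Vec ℤ n
x ⊝ y = x ⊕ (⊖ y)

_•_ : ∀ {n} → ℤ → Vec ℤ n → Vec ℤ n
k • x = Vec.map (λ a → k ℤ.* a) x

𝟎 : ∀ {n} → Vec ℤ n
𝟎 = Vec.replicate _ 0ℤ

⟨_,_⟩ : ∀ {n} → Vec ℤ n → Vec ℤ n → ℤ
⟨ x , y ⟩ = Vec.foldr′ ℤ._+_ 0ℤ (Vec.zipWith ℤ._*_ x y)

combination : ∀ {m n} → (Fin m → ℤ) → (Fin m → Vec ℤ n) → Vec ℤ n
combination c v = Vec.foldr′ _⊕_ 𝟎 (Vec.tabulate λ i → c i • v i)

fromℤ : ℤ → ℚ
fromℤ z = z ℚ./ 1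

⟨_,_⟩ℚ : ∀ {n} → Vec ℤ n → Vec ℚ n → ℚ
⟨ x , y ⟩ℚ = Vec.foldr′ ℚ._+_ 0ℚ (Vec.zipWith (λ a b → fromℤ a ℚ.* b) x y)

-- A finitely supported function A → ℤ, as a formal ℤ-linear combination: an
-- element of A may occur repeatedly, its value being the sum of its entries.
-- `sumWhere Q?` is the sum of the values over Q.
FormalSum : Set → Set
FormalSum A = List (ℤ × A)

module _ {A : Set} where

  sumWhere : ∀ {ℓ} {Q : Pred A ℓ} → Decidable Q → FormalSum A → ℤ
  sumWhere Q? []            = 0ℤ
  sumWhere Q? ((a , x) ∷ f) = (if does (Q? x) then a else 0ℤ) ℤ.+ sumWhere Q? f

  scale : ℤ → FormalSum A → FormalSum A
  scale k = map λ (a , x) → k ℤ.* a , x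

-- Reductive groups over ℂ with a maximal torus and a Borel subgroup,
-- given by their reduced root datum with a base.  The weight lattice and
-- its dual are both identified with ℤ^rank, so that the perfect pairing
-- between them is the dot product.
record RootDatum : Set where
  field
    rank #roots #simple : ℕ

  P : Set
  P = Vec ℤ rank

  P∨ : Set
  P∨ = Vec ℤ rank

  I : Set
  I = Fin #simple

  field
    root             : Fin #roots → P
    coroot           : Fin #roots → P∨
    root-injective   : ∀ {a b} → root a ≡ root b → a ≡ b
    coroot-injective : ∀ {a b} → coroot a ≡ coroot b → a ≡ b
    pairing-two      : ∀ a → ⟨ coroot a , root a ⟩ ≡ + 2
    reflect-root     : ∀ a b → ∃ λ c → root c ≡ root b ⊝ ⟨ coroot a , root b ⟩ • root a
    reflect-coroot   : ∀ a b → ∃ λ c → coroot c ≡ coroot b ⊝ ⟨ coroot b , root a ⟩ • coroot a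
    reduced          : ∀ a b k m → k ≢ 0ℤ → k • root b ≡ m • root a →
                       root b ≡ root a ⊎ root b ≡ ⊖ root a

    simple      : I → Fin #roots
    independent : ∀ c → combination c (root ∘ simple) ≡ 𝟎 → ∀ i → c i ≡ 0ℤ
    base        : ∀ a → Σ[ c ∈ (I → ℕ) ]
                  (root a ≡ combination (+_ ∘ c) (root ∘ simple) ⊎
                   root a ≡ ⊖ combination (+_ ∘ c) (root ∘ simple))

  α : I → P
  α = root ∘ simple

  α∨ : I → P∨
  α∨ = coroot ∘ simple

  infix 4 _∼_ _∼?_

  _∼_ : I → I → Set
  i ∼ j = ⟨ α∨ i , α j ⟩ ≡ -1ℤ

  _∼?_ : ∀ i j → Dec (i ∼ j)
  i ∼? j = ⟨ α∨ i , α j ⟩ ℤ.≟ -1ℤ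

record Setting : Set where
  field
    datum : RootDatum

  open RootDatum datum public

  field
    cartan-symmetric : ∀ i j → ⟨ α∨ i , α j ⟩ ≡ ⟨ α∨ j , α i ⟩
    simply-laced     : ∀ i j → i ≢ j → ⟨ α∨ i , α j ⟩ ≡ 0ℤ ⊎ ⟨ α∨ i , α j ⟩ ≡ -1ℤ
    connected        : ∀ i j → Star _∼_ i j

    colour : I → Parity
    proper : ∀ {i j} → i ∼ j → colour i ≢ colour j

    ϖ      : I → Vec ℚ rank
    ϖ-dual : ∀ i j → ⟨ α∨ i , ϖ j ⟩ℚ ≡ (if does (i Fin.≟ j) then 1ℚ else 0ℚ)

parityℤ : ℤ → Parity
parityℤ c = parity ∣ c ∣

private

  opposite² : ∀ p → opposite (opposite p) ≡ p
  opposite² 0ℙ = refl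
  opposite² 1ℙ = refl

  parity-suc : ∀ n → parity (suc n) ≡ opposite (parity n)
  parity-suc zero          = refl
  parity-suc (suc zero)    = refl
  parity-suc (suc (suc n)) = parity-suc n

  parityℤ-1+ : ∀ c → parityℤ (1ℤ ℤ.+ c) ≡ opposite (parityℤ c)
  parityℤ-1+ (+ n)           = parity-suc n
  parityℤ-1+ -[1+ zero ]     = refl
  parityℤ-1+ -[1+ suc n ]    =
    trans (sym (opposite² _)) (cong opposite (sym (parity-suc (suc n))))

  parityℤ+1 : ∀ c → parityℤ (c ℤ.+ 1ℤ) ≡ opposite (parityℤ c)
  parityℤ+1 c = trans (cong parityℤ (ℤ.+-comm c 1ℤ)) (parityℤ-1+ c)

  parityℤ+2 : ∀ c → parityℤ (c ℤ.+ + 2) ≡ parityℤ c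
  parityℤ+2 c = begin
    parityℤ (c ℤ.+ + 2)           ≡⟨ cong parityℤ (sym (ℤ.+-assoc c 1ℤ 1ℤ)) ⟩
    parityℤ (c ℤ.+ 1ℤ ℤ.+ 1ℤ)     ≡⟨ parityℤ+1 (c ℤ.+ 1ℤ) ⟩
    opposite (parityℤ (c ℤ.+ 1ℤ)) ≡⟨ cong opposite (parityℤ+1 c) ⟩
    opposite (opposite (parityℤ c)) ≡⟨ opposite² _ ⟩
    parityℤ c ∎
    where open ≡-Reasoning

  parityℤ-2 : ∀ c → parityℤ (c ℤ.- + 2) ≡ parityℤ c
  parityℤ-2 c = trans (sym (parityℤ+2 (c ℤ.- + 2))) (cong parityℤ (cancel c))
    where
    cancel : ∀ c → c ℤ.- + 2 ℤ.+ + 2 ≡ c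
    cancel = solve-∀

  ≢⇒opposite : ∀ {p q} → p ≢ q → opposite q ≡ p
  ≢⇒opposite {0ℙ} {0ℙ} p≢q = contradiction refl p≢q
  ≢⇒opposite {0ℙ} {1ℙ} p≢q = refl
  ≢⇒opposite {1ℙ} {0ℙ} p≢q = refl
  ≢⇒opposite {1ℙ} {1ℙ} p≢q = contradiction refl p≢q

  ⟨,𝟎⟩ : ∀ {n} (x : Vec ℤ n) → ⟨ x , 𝟎 ⟩ ≡ 0ℤ
  ⟨,𝟎⟩ []      = refl
  ⟨,𝟎⟩ (a ∷ x) = cong₂ ℤ._+_ (ℤ.*-zeroʳ a) (⟨,𝟎⟩ x)

  ⟨,⊕⟩ : ∀ {n} (x y z : Vec ℤ n) → ⟨ x , y ⊕ z ⟩ ≡ ⟨ x , y ⟩ ℤ.+ ⟨ x , z ⟩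
  ⟨,⊕⟩ []      []      []      = refl
  ⟨,⊕⟩ (a ∷ x) (b ∷ y) (c ∷ z) =
    trans (cong (λ n → a ℤ.* (b ℤ.+ c) ℤ.+ n) (⟨,⊕⟩ x y z)) (shuffle a b c _ _)
    where
    shuffle : ∀ a b c s t → a ℤ.* (b ℤ.+ c) ℤ.+ (s ℤ.+ t) ≡ a ℤ.* b ℤ.+ s ℤ.+ (a ℤ.* c ℤ.+ t)
    shuffle = solve-∀

  ⟨,⊖⟩ : ∀ {n} (x y : Vec ℤ n) → ⟨ x , ⊖ y ⟩ ≡ - ⟨ x , y ⟩
  ⟨,⊖⟩ []      []      = refl
  ⟨,⊖⟩ (a ∷ x) (b ∷ y) = trans (cong (λ n → a ℤ.* (- b) ℤ.+ n) (⟨,⊖⟩ x y)) (shuffle a b _)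
    where
    shuffle : ∀ a b s → a ℤ.* (- b) ℤ.+ - s ≡ - (a ℤ.* b ℤ.+ s)
    shuffle = solve-∀

  ⊕-⊖-cancel : ∀ {n} (x y : Vec ℤ n) → (x ⊕ y) ⊝ x ≡ y
  ⊕-⊖-cancel []      []      = refl
  ⊕-⊖-cancel (a ∷ x) (b ∷ y) = cong₂ _∷_ (arith a b) (⊕-⊖-cancel x y)
    where
    arith : ∀ a b → a ℤ.+ b ℤ.+ - a ≡ b
    arith = solve-∀

  ⊕-⊝-cancel : ∀ {n} (x y : Vec ℤ n) → x ⊕ (y ⊝ x) ≡ y
  ⊕-⊝-cancel []      []      = refl
  ⊕-⊝-cancel (a ∷ x) (b ∷ y) = cong₂ _∷_ (arith a b) (⊕-⊝-cancel x y)
    where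
    arith : ∀ a b → a ℤ.+ (b ℤ.+ - a) ≡ b
    arith = solve-∀

  ⊝-⊕-cancel : ∀ {n} (x y : Vec ℤ n) → (y ⊝ x) ⊕ x ≡ y
  ⊝-⊕-cancel []      []      = refl
  ⊝-⊕-cancel (a ∷ x) (b ∷ y) = cong₂ _∷_ (arith a b) (⊝-⊕-cancel x y)
    where
    arith : ∀ a b → b ℤ.+ - a ℤ.+ a ≡ b
    arith = solve-∀

  ⊕-⊝-cancelʳ : ∀ {n} (x y : Vec ℤ n) → (y ⊕ x) ⊝ x ≡ y
  ⊕-⊝-cancelʳ []      []      = refl
  ⊕-⊝-cancelʳ (a ∷ x) (b ∷ y) = cong₂ _∷_ (arith a b) (⊕-⊝-cancelʳ x y)
    where
    arith : ∀ a b → b ℤ.+ a ℤ.+ - a ≡ b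
    arith = solve-∀

  ⊝-𝟎 : ∀ {n} (x : Vec ℤ n) → x ⊝ 𝟎 ≡ x
  ⊝-𝟎 []      = refl
  ⊝-𝟎 (a ∷ x) = cong₂ _∷_ (ℤ.+-identityʳ a) (⊝-𝟎 x)

  ⊝-⊖ : ∀ {n} (x y : Vec ℤ n) → x ⊝ (⊖ y) ≡ x ⊕ y
  ⊝-⊖ []      []      = refl
  ⊝-⊖ (a ∷ x) (b ∷ y) = cong₂ _∷_ (cong (λ c → a ℤ.+ c) (ℤ.neg-involutive b)) (⊝-⊖ x y)

  ⊝-0• : ∀ {n} (x y : Vec ℤ n) → x ⊝ 0ℤ • y ≡ x
  ⊝-0• []      []      = refl
  ⊝-0• (a ∷ x) (b ∷ y) = cong₂ _∷_ (arith a b) (⊝-0• x y)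
    where
    arith : ∀ a b → a ℤ.+ - (0ℤ ℤ.* b) ≡ a
    arith = solve-∀

  ⊝-⊝-• : ∀ {n} k (x y : Vec ℤ n) → (x ⊝ y) ⊝ k • y ≡ x ⊝ (1ℤ ℤ.+ k) • y
  ⊝-⊝-• k []      []      = refl
  ⊝-⊝-• k (a ∷ x) (b ∷ y) = cong₂ _∷_ (arith k a b) (⊝-⊝-• k x y)
    where
    arith : ∀ k a b → a ℤ.+ - b ℤ.+ - (k ℤ.* b) ≡ a ℤ.+ - ((1ℤ ℤ.+ k) ℤ.* b)
    arith = solve-∀

  ⊕-⊝-• : ∀ {n} k (x y : Vec ℤ n) → (x ⊕ y) ⊝ k • y ≡ x ⊝ (-1ℤ ℤ.+ k) • y
  ⊕-⊝-• k []      []      = refl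
  ⊕-⊝-• k (a ∷ x) (b ∷ y) = cong₂ _∷_ (arith k a b) (⊕-⊝-• k x y)
    where
    arith : ∀ k a b → a ℤ.+ b ℤ.+ - (k ℤ.* b) ≡ a ℤ.+ - ((-1ℤ ℤ.+ k) ℤ.* b)
    arith = solve-∀

  ⊝-•-⊝ : ∀ {n} k (x y : Vec ℤ n) → (x ⊝ k • y) ⊝ y ≡ x ⊝ (k ℤ.+ 1ℤ) • y
  ⊝-•-⊝ k []      []      = refl
  ⊝-•-⊝ k (a ∷ x) (b ∷ y) = cong₂ _∷_ (arith k a b) (⊝-•-⊝ k x y)
    where
    arith : ∀ k a b → a ℤ.+ - (k ℤ.* b) ℤ.+ - b ≡ a ℤ.+ - ((k ℤ.+ 1ℤ) ℤ.* b)
    arith = solve-∀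

  module _ {A : Set} {ℓ} {Q : Pred A ℓ} (Q? : Decidable Q) where

    sumWhere-scale : ∀ k (f : FormalSum A) → sumWhere Q? (scale k f) ≡ k ℤ.* sumWhere Q? f
    sumWhere-scale k []            = sym (ℤ.*-zeroʳ k)
    sumWhere-scale k ((a , x) ∷ f) with does (Q? x)
    ... | true  = trans (cong (λ n → k ℤ.* a ℤ.+ n) (sumWhere-scale k f)) (sym (ℤ.*-distribˡ-+ k a _))
    ... | false = trans (cong (λ n → 0ℤ ℤ.+ n) (sumWhere-scale k f))
                    (trans (ℤ.+-identityˡ _) (cong (λ n → k ℤ.* n) (sym (ℤ.+-identityˡ _))))

    sumWhere-++ : ∀ (f g : FormalSum A) → sumWhere Q? (f ++ g) ≡ sumWhere Q? f ℤ.+ sumWhere Q? g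
    sumWhere-++ []            g = sym (ℤ.+-identityˡ _)
    sumWhere-++ ((a , x) ∷ f) g =
      trans (cong (λ n → h ℤ.+ n) (sumWhere-++ f g)) (sym (ℤ.+-assoc h _ _))
      where h = if does (Q? x) then a else 0ℤ

    sumWhere-neg : ∀ (f : FormalSum A) → sumWhere Q? (scale -1ℤ f) ≡ - sumWhere Q? f
    sumWhere-neg []            = refl
    sumWhere-neg ((a , x) ∷ f) with does (Q? x)
    ... | true  = trans (cong₂ ℤ._+_ (ℤ.-1*i≡-i a) (sumWhere-neg f)) (sym (ℤ.neg-distrib-+ a _))
    ... | false = trans (cong (λ n → 0ℤ ℤ.+ n) (sumWhere-neg f)) (sym (ℤ.neg-distrib-+ 0ℤ (sumWhere Q? f)))

  fromℤ-≃ : ∀ z → ℚ.toℚᵘ (fromℤ z) ℚᵘ.≃ ℚᵘ.mkℚᵘ z 0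
  fromℤ-≃ z = ℚ.toℚᵘ-fromℚᵘ (ℚᵘ.mkℚᵘ z 0)

  fromℤ-injective : ∀ {a b} → fromℤ a ≡ fromℤ b → a ≡ b
  fromℤ-injective {a} {b} eq =
    ℤ.*-cancelʳ-≡ a b 1ℤ
      (ℚᵘ.drop-*≡* (ℚ.fromℚᵘ-injective {ℚᵘ.mkℚᵘ a 0} {ℚᵘ.mkℚᵘ b 0} eq))

  fromℤ-+ : ∀ a b → fromℤ (a ℤ.+ b) ≡ fromℤ a ℚ.+ fromℤ b
  fromℤ-+ a b = ℚ.toℚᵘ-injective (ℚᵘ.≃-trans (fromℤ-≃ (a ℤ.+ b))
    (ℚᵘ.≃-sym (ℚᵘ.≃-trans (ℚ.toℚᵘ-homo-+ (fromℤ a) (fromℤ b))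
      (ℚᵘ.≃-trans (ℚᵘ.+-cong (fromℤ-≃ a) (fromℤ-≃ b)) (ℚᵘ.*≡* (arith a b))))))
    where
    arith : ∀ a b → (a ℤ.* 1ℤ ℤ.+ b ℤ.* 1ℤ) ℤ.* 1ℤ ≡ (a ℤ.+ b) ℤ.* 1ℤ
    arith = solve-∀

  fromℤ-* : ∀ a b → fromℤ (a ℤ.* b) ≡ fromℤ a ℚ.* fromℤ b
  fromℤ-* a b = ℚ.toℚᵘ-injective (ℚᵘ.≃-trans (fromℤ-≃ (a ℤ.* b))
    (ℚᵘ.≃-sym (ℚᵘ.≃-trans (ℚ.toℚᵘ-homo-* (fromℤ a) (fromℤ b))
      (ℚᵘ.≃-trans (ℚᵘ.*-cong (fromℤ-≃ a) (fromℤ-≃ b)) (ℚᵘ.*≡* refl)))))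

  ⟨,fromℤ⟩ : ∀ {n} (x y : Vec ℤ n) → ⟨ x , Vec.map fromℤ y ⟩ℚ ≡ fromℤ ⟨ x , y ⟩
  ⟨,fromℤ⟩ []      []      = refl
  ⟨,fromℤ⟩ (a ∷ x) (b ∷ y) =
    trans (cong₂ ℚ._+_ (sym (fromℤ-* a b)) (⟨,fromℤ⟩ x y)) (sym (fromℤ-+ (a ℤ.* b) _))

  ⟨,•⟩ℚ : ∀ {n} (x : Vec ℤ n) q (y : Vec ℚ n) →
          ⟨ x , Vec.map (q ℚ.*_) y ⟩ℚ ≡ q ℚ.* ⟨ x , y ⟩ℚ
  ⟨,•⟩ℚ []      q []      = sym (ℚ.*-zeroʳ q)
  ⟨,•⟩ℚ (a ∷ x) q (b ∷ y) = begin
    fromℤ a ℚ.* (q ℚ.* b) ℚ.+ ⟨ x , Vec.map (q ℚ.*_) y ⟩ℚ ≡⟨ cong₂ ℚ._+_ swap (⟨,•⟩ℚ x q y) ⟩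
    q ℚ.* (fromℤ a ℚ.* b) ℚ.+ q ℚ.* ⟨ x , y ⟩ℚ            ≡⟨ ℚ.*-distribˡ-+ q _ _ ⟨
    q ℚ.* (fromℤ a ℚ.* b ℚ.+ ⟨ x , y ⟩ℚ)                  ∎
    where
    open ≡-Reasoning
    swap : fromℤ a ℚ.* (q ℚ.* b) ≡ q ℚ.* (fromℤ a ℚ.* b)
    swap = trans (sym (ℚ.*-assoc (fromℤ a) q b))
             (trans (cong (ℚ._* b) (ℚ.*-comm (fromℤ a) q)) (ℚ.*-assoc q (fromℤ a) b))

module Weights (𝒮 : Setting) where

  open Setting 𝒮

  _≟ᴾ_ : DecidableEquality P
  _≟ᴾ_ = Vec.≡-dec ℤ._≟_

  s : I → P → P
  s i λ′ = λ′ ⊝ ⟨ α∨ i , λ′ ⟩ • α i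

  -- W acts faithfully on P, so an element of W is a word in the simple
  -- reflections, two words being identified when they act alike.
  Word : Set
  Word = List I

  act : Word → P → P
  act w λ′ = foldr s λ′ w

  _≈ᵂ_ : Word → Word → Set
  u ≈ᵂ v = ∀ λ′ → act u λ′ ≡ act v λ′

  Reduced : Word → Set
  Reduced w = ∀ v → v ≈ᵂ w → length w ℕ.≤ length v

  IsLongest : Word → Set
  IsLongest w = Reduced w × (∀ v → Reduced v → length v ℕ.≤ length w)

  ℤ[P] : Set
  ℤ[P] = FormalSum P

  coeff : ℤ[P] → P → ℤ
  coeff f λ′ = sumWhere (_≟ᴾ λ′) f

  infix 4 _≈ᴾ_
  _≈ᴾ_ : ℤ[P] → ℤ[P] → Set
  f ≈ᴾ g = ∀ λ′ → coeff f λ′ ≡ coeff g λ′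

  e^_ : P → ℤ[P]
  e^ λ′ = (1ℤ , λ′) ∷ []

  infixl 6 _−_
  _−_ : ℤ[P] → ℤ[P] → ℤ[P]
  f − g = f ++ scale -1ℤ g

  infixl 7 _⊛_
  _⊛_ : ℤ[P] → ℤ[P] → ℤ[P]
  f ⊛ g = concatMap (λ (a , λ′) → map (λ (b , μ) → a ℤ.* b , λ′ ⊕ μ) g) f

  -- (e^λ − e^(λ−Nβ)) / (1 − e^(−β)), expanded as a geometric sum.
  geometric : P → P → ℤ → ℤ[P]
  geometric β λ′ (+ zero)     = []
  geometric β λ′ (+ suc n)    = (1ℤ , λ′) ∷ geometric β (λ′ ⊝ β) (+ n)
  geometric β λ′ -[1+ zero ]  = (-1ℤ , λ′ ⊕ β) ∷ []
  geometric β λ′ -[1+ suc n ] = (-1ℤ , λ′ ⊕ β) ∷ geometric β (λ′ ⊕ β) -[1+ n ]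

  -- s i λ − α i = λ − Nα i with N = ⟨α∨ i, λ⟩ + 1, so on e^λ this is
  -- (e^λ − e^(s i λ − α i)) / (1 − e^(−α i)), which DemazureQuotient verifies.
  π : I → ℤ[P] → ℤ[P]
  π i = concatMap λ (a , λ′) → scale a (geometric (α i) λ′ (⟨ α∨ i , λ′ ⟩ ℤ.+ 1ℤ))

  π-word : Word → ℤ[P] → ℤ[P]
  π-word w f = foldr π f w

module Crystal (𝒮 : Setting) where

  open Setting 𝒮
  open Weights 𝒮 public

  record Height (i : I) : Set where
    constructor mkHeight
    field
      height       : ℤ
      .same-parity : parityℤ height ≡ colour i

  open Height public

  I×̇ℤ : Set
  I×̇ℤ = Σ I Height

  _≟ᴴ_ : ∀ {i} → DecidableEquality (Height i)
  mkHeight c _ ≟ᴴ mkHeight d _ with c ℤ.≟ d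
  ... | yes refl = yes refl
  ... | no  c≢d  = no (c≢d ∘ cong height)

  _≟ⱽ_ : DecidableEquality I×̇ℤ
  _≟ⱽ_ = Σ-≡-dec Fin._≟_ _≟ᴴ_

  _≤ᴴ_ : ∀ {i} → Height i → Height i → Set
  k ≤ᴴ l = height k ℤ.≤ height l

  _↑² _↓² : ∀ {i} → Height i → Height i
  mkHeight c p ↑² = mkHeight (c ℤ.+ + 2) (trans (parityℤ+2 c) p)
  mkHeight c p ↓² = mkHeight (c ℤ.- + 2) (trans (parityℤ-2 c) p)

  cross : ∀ {i j} → j ∼ i → Height i → Height j
  cross j∼i (mkHeight c p) = mkHeight (c ℤ.+ 1ℤ)
    (trans (parityℤ+1 c) (trans (cong opposite p) (≢⇒opposite (proper j∼i))))

  infix 4 _⋖_ _≼_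

  data _⋖_ : I×̇ℤ → I×̇ℤ → Set where
    vertical : ∀ {i} {c : Height i} → (i , c) ⋖ (i , c ↑²)
    diagonal : ∀ {i j} {c : Height i} (j∼i : j ∼ i) → (i , c) ⋖ (j , cross j∼i c)

  _≼_ : I×̇ℤ → I×̇ℤ → Set
  _≼_ = Star _⋖_

  UpwardClosed : ∀ {ℓ} → Pred I×̇ℤ ℓ → Set ℓ
  UpwardClosed J = ∀ {v w} → v ≼ w → J v → J w

  _atNode_ : I×̇ℤ → I → Set
  (j , _) atNode i = j ≡ i

  atNode? : ∀ i → Decidable (_atNode i)
  atNode? i (j , _) = j Fin.≟ i

  -- The element e^wt ∏ y_{i,c}^{p[i,c]} of ℳ; `factors` is the function p.
  record Monomial : Set where
    field
      wt       : P
      factors  : FormalSum I×̇ℤ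
      balanced : ∀ i → ⟨ α∨ i , wt ⟩ ≡ sumWhere (atNode? i) factors

  open Monomial public

  _⟦_⟧ : Monomial → I×̇ℤ → ℤ
  p ⟦ v ⟧ = sumWhere (_≟ⱽ v) (factors p)

  infix 4 _≈_
  _≈_ : Monomial → Monomial → Set
  p ≈ q = wt p ≡ wt q × (∀ v → p ⟦ v ⟧ ≡ q ⟦ v ⟧)

  infixl 7 _·_
  infix  8 _⁻¹
  infixr 8 _^_

  𝟙 : Monomial
  𝟙 = record { wt = 𝟎 ; factors = [] ; balanced = λ i → ⟨,𝟎⟩ (α∨ i) }

  _·_ : Monomial → Monomial → Monomial
  p · q = record
    { wt       = wt p ⊕ wt q
    ; factors  = factors p ++ factors q
    ; balanced = λ i → trans (⟨,⊕⟩ (α∨ i) (wt p) (wt q))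
                   (trans (cong₂ ℤ._+_ (balanced p i) (balanced q i))
                     (sym (sumWhere-++ (atNode? i) (factors p) (factors q))))
    }

  _⁻¹ : Monomial → Monomial
  p ⁻¹ = record
    { wt       = ⊖ wt p
    ; factors  = scale -1ℤ (factors p)
    ; balanced = λ i → trans (⟨,⊖⟩ (α∨ i) (wt p))
                   (trans (cong (-_) (balanced p i)) (sym (sumWhere-neg (atNode? i) (factors p))))
    }

  _^_ : Monomial → ℕ → Monomial
  p ^ zero  = 𝟙
  p ^ suc n = p · p ^ n

  ∏ : List I×̇ℤ → (I×̇ℤ → Monomial) → Monomial
  ∏ vs p = foldr (λ v q → p v · q) 𝟙 vs

  neighbour : ∀ {i} → Height i → I → FormalSum I×̇ℤ
  neighbour {i} k j = case j ∼? i of λ where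
    (yes j∼i) → (-1ℤ , (j , cross j∼i k)) ∷ []
    (no  _)   → []

  z-factors : I×̇ℤ → FormalSum I×̇ℤ
  z-factors (i , k) = (1ℤ , (i , k)) ∷ (1ℤ , (i , k ↑²)) ∷ concatMap (neighbour k) (allFin #simple)

  private

    neighbour-here : ∀ {i} (k : Height i) j → i ≢ j →
                     sumWhere (atNode? j) (neighbour k j) ≡ ⟨ α∨ j , α i ⟩
    neighbour-here {i} k j i≢j with j ∼? i
    ... | yes j∼i rewrite dec-true (j Fin.≟ j) refl = sym j∼i
    ... | no  j≁i with simply-laced j i (i≢j ∘ sym)
    ...   | inj₁ zero-pairing = sym zero-pairing
    ...   | inj₂ j∼i          = contradiction j∼i j≁i

    neighbour-elsewhere : ∀ {i} (k : Height i) j j′ → j′ ≢ j →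
                          sumWhere (atNode? j) (neighbour k j′) ≡ 0ℤ
    neighbour-elsewhere {i} k j j′ j′≢j with j′ ∼? i
    ... | yes _ rewrite dec-false (j′ Fin.≟ j) j′≢j = refl
    ... | no  _ = refl

    neighbour-self : ∀ {i} (k : Height i) → neighbour k i ≡ []
    neighbour-self {i} k with i ∼? i
    ... | yes i∼i = contradiction (trans (sym i∼i) (pairing-two (simple i))) λ ()
    ... | no  _   = refl

    module _ (g : I → FormalSum I×̇ℤ) (j : I) where

      sum-none : ∀ {m} (t : Fin m → I) →
                 (∀ x → sumWhere (atNode? j) (g (t x)) ≡ 0ℤ) →
                 sumWhere (atNode? j) (concatMap g (tabulate t)) ≡ 0ℤ
      sum-none {zero}  t none = refl
      sum-none {suc m} t none =
        trans (sumWhere-++ (atNode? j) (g (t zero)) _)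
          (cong₂ ℤ._+_ (none zero) (sum-none (t ∘ suc) (none ∘ suc)))

      sum-single : ∀ {m} (t : Fin m → I) (x : Fin m) →
                   (∀ y → y ≢ x → sumWhere (atNode? j) (g (t y)) ≡ 0ℤ) →
                   sumWhere (atNode? j) (concatMap g (tabulate t)) ≡ sumWhere (atNode? j) (g (t x))
      sum-single t zero    rest =
        trans (sumWhere-++ (atNode? j) (g (t zero)) _)
          (trans (cong (λ n → sumWhere (atNode? j) (g (t zero)) ℤ.+ n)
                   (sum-none (t ∘ suc) λ y → rest (suc y) λ ()))
            (ℤ.+-identityʳ _))
      sum-single t (suc x) rest =
        trans (sumWhere-++ (atNode? j) (g (t zero)) _)
          (trans (cong₂ ℤ._+_ (rest zero λ ())
                   (sum-single (t ∘ suc) x λ y y≢x → rest (suc y) (y≢x ∘ Fin.suc-injective)))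
            (ℤ.+-identityˡ _))

    sum-neighbours : ∀ {i} (k : Height i) j →
                     sumWhere (atNode? j) (concatMap (neighbour k) (allFin #simple))
                       ≡ sumWhere (atNode? j) (neighbour k j)
    sum-neighbours k j = sum-single (neighbour k) j id j (neighbour-elsewhere k j)

    z-balanced : ∀ v j → ⟨ α∨ j , α (proj₁ v) ⟩ ≡ sumWhere (atNode? j) (z-factors v)
    z-balanced (i , k) j with i Fin.≟ j
    ... | yes refl = trans (pairing-two (simple i))
            (cong (λ n → 1ℤ ℤ.+ (1ℤ ℤ.+ n))
              (sym (trans (sum-neighbours k i) (cong (sumWhere (atNode? i)) (neighbour-self k)))))
    ... | no  i≢j  = sym (trans (ℤ.+-identityˡ _) (trans (ℤ.+-identityˡ _)
            (trans (sum-neighbours k j) (neighbour-here k j i≢j))))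

  z : I×̇ℤ → Monomial
  z v = record { wt = α (proj₁ v) ; factors = z-factors v ; balanced = z-balanced v }

  φ : ∀ i → Monomial → Height i → ℤ
  φ i p k = sumWhere (λ (j , l) → j Fin.≟ i ×-dec height k ℤ.≤? height l) (factors p)

  ε : ∀ i → Monomial → Height i → ℤ
  ε i p k = - sumWhere (λ (j , l) → j Fin.≟ i ×-dec height l ℤ.≤? height k) (factors p)

  IsMaximum : ∀ {i} → (Height i → ℤ) → ℤ → Set
  IsMaximum g m = (∃ λ k → g k ≡ m) × (∀ k → g k ℤ.≤ m)

  -- The crystal operators as partial functions: f[ i ] p ↦ q says that
  -- f_i(p) is nonzero and equal to q.
  f[_]_↦_ : I → Monomial → Monomial → Set
  f[ i ] p ↦ q = ∃ λ m → ∃ λ F →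
    IsMaximum (φ i p) m × m ≢ 0ℤ ×
    φ i p F ≡ m × (∀ k → φ i p k ≡ m → k ≤ᴴ F) ×
    q ≈ p · z (i , F ↓²) ⁻¹

  e[_]_↦_ : I → Monomial → Monomial → Set
  e[ i ] p ↦ q = ∃ λ m → ∃ λ E →
    IsMaximum (ε i p) m × m ≢ 0ℤ ×
    ε i p E ≡ m × (∀ k → ε i p k ≡ m → E ≤ᴴ k) ×
    q ≈ p · z (i , E)

  data Generated (g : Monomial) : Pred Monomial 0ℓ where
    generator : ∀ {p} → p ≈ g → Generated g p
    f-closed  : ∀ {i p q} → Generated g p → f[ i ] p ↦ q → Generated g q
    e-closed  : ∀ {i p q} → Generated g p → e[ i ] p ↦ q → Generated g q

  _•ϖ_∈P : ℕ → I → Set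
  n •ϖ i ∈P = Σ[ λ′ ∈ P ] Vec.map fromℤ λ′ ≡ Vec.map (fromℤ (+ n) ℚ.*_) (ϖ i)

  private

    y-balanced : ∀ (v : I×̇ℤ) n (nϖ : n •ϖ proj₁ v ∈P) j →
                 ⟨ α∨ j , proj₁ nϖ ⟩ ≡ sumWhere (atNode? j) ((+ n , v) ∷ [])
    y-balanced v@(i , c) n (λ′ , λ′≡nϖ) j = fromℤ-injective (begin
      fromℤ ⟨ α∨ j , λ′ ⟩                               ≡⟨ sym (⟨,fromℤ⟩ (α∨ j) λ′) ⟩
      ⟨ α∨ j , Vec.map fromℤ λ′ ⟩ℚ                      ≡⟨ cong (λ x → ⟨ α∨ j , x ⟩ℚ) λ′≡nϖ ⟩
      ⟨ α∨ j , Vec.map (fromℤ (+ n) ℚ.*_) (ϖ i) ⟩ℚ      ≡⟨ ⟨,•⟩ℚ (α∨ j) (fromℤ (+ n)) (ϖ i) ⟩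
      fromℤ (+ n) ℚ.* ⟨ α∨ j , ϖ i ⟩ℚ                   ≡⟨ cong (fromℤ (+ n) ℚ.*_) (ϖ-dual j i) ⟩
      fromℤ (+ n) ℚ.* (if does (j Fin.≟ i) then 1ℚ else 0ℚ) ≡⟨ delta ⟩
      fromℤ (sumWhere (atNode? j) ((+ n , v) ∷ []))     ∎)
      where
      open ≡-Reasoning
      delta : fromℤ (+ n) ℚ.* (if does (j Fin.≟ i) then 1ℚ else 0ℚ)
              ≡ fromℤ (sumWhere (atNode? j) ((+ n , v) ∷ []))
      delta with i Fin.≟ j
      ... | yes refl rewrite dec-true (i Fin.≟ i) refl =
              trans (ℚ.*-identityʳ _) (cong fromℤ (sym (ℤ.+-identityʳ (+ n))))
      ... | no i≢j rewrite dec-false (j Fin.≟ i) (i≢j ∘ sym) = ℚ.*-zeroʳ (fromℤ (+ n))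

  y^ : ∀ (v : I×̇ℤ) n → n •ϖ proj₁ v ∈P → Monomial
  y^ v n nϖ = record
    { wt = proj₁ nϖ ; factors = (+ n , v) ∷ [] ; balanced = y-balanced v n nϖ }

  -- `support` may be any duplicate-free list containing the support.
  record Multiset : Set where
    field
      mult     : I×̇ℤ → ℕ
      support  : List I×̇ℤ
      unique   : Unique support
      complete : ∀ {v} → mult v ≢ 0 → v ∈ support

  open Multiset public

  Supp : Multiset → Pred I×̇ℤ 0ℓ
  Supp R v = mult R v ≢ 0

  Integral : Multiset → Set
  Integral R = ∀ v → mult R v •ϖ proj₁ v ∈P

  module _ (R : Multiset) (Rϖ : Integral R) where

    y-of : I×̇ℤ → Monomial
    y-of v = y^ v (mult R v) (Rϖ v)

    yᴿ : Monomial
    yᴿ = ∏ (support R) y-of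

    data Products : List I×̇ℤ → Pred Monomial 0ℓ where
      []  : ∀ {p} → p ≈ 𝟙 → Products [] p
      _∷_ : ∀ {v vs p q r} → Generated (y-of v) q × r ≈ q · p →
            Products vs p → Products (v ∷ vs) r

    -- Vertices outside the support contribute the subcrystal {1} only.
    ℳ : Pred Monomial 0ℓ
    ℳ = Products (support R)

  z^_ : Multiset → Monomial
  z^ S = ∏ (support S) λ v → z v ^ mult S v

  module _ (R : Multiset) (Rϖ : Integral R) {ℓ} (J : Pred I×̇ℤ ℓ) where

    ℳ-truncated : Pred Monomial ℓ
    ℳ-truncated p = ℳ R Rϖ p ×
      (∃ λ S → p ≈ yᴿ R Rϖ · (z^ S) ⁻¹ × Supp R ∪ Supp S ⊆ J)

  record FiniteSubset {ℓ} (X : Pred Monomial ℓ) : Set ℓ where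
    field
      elements  : List Monomial
      sound     : All X elements
      exhaust   : ∀ {p} → X p → Any (p ≈_) elements
      distinct  : AllPairs (λ p q → ¬ p ≈ q) elements

  ch : ∀ {ℓ} {X : Pred Monomial ℓ} → FiniteSubset X → ℤ[P]
  ch X = map (λ p → 1ℤ , wt p) (FiniteSubset.elements X)

-- π i (e^ λ) is the unique q in ℤ[P] with (1 − e^(−α i)) q = e^λ − e^(s i λ − α i).
module DemazureQuotient (𝒮 : Setting) where

  open Setting 𝒮
  open Weights 𝒮

  1−e^− : I → ℤ[P]
  1−e^− i = e^ 𝟎 − e^ (⊖ α i)

  private

    translate : ℤ → P → ℤ[P] → ℤ[P]
    translate k κ = map λ (b , μ) → k ℤ.* b , κ ⊕ μ

    coeff-translate : ∀ k κ f ν → coeff (translate k κ f) ν ≡ k ℤ.* coeff f (ν ⊝ κ)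
    coeff-translate k κ []            ν = sym (ℤ.*-zeroʳ k)
    coeff-translate k κ ((b , μ) ∷ f) ν with (κ ⊕ μ) ≟ᴾ ν
    ... | yes refl rewrite dec-true (μ ≟ᴾ ((κ ⊕ μ) ⊝ κ)) (sym (⊕-⊖-cancel κ μ)) =
            trans (cong (λ n → k ℤ.* b ℤ.+ n) (coeff-translate k κ f (κ ⊕ μ)))
              (sym (ℤ.*-distribˡ-+ k b _))
    ... | no neq rewrite dec-false (μ ≟ᴾ (ν ⊝ κ)) (λ { refl → neq (⊕-⊝-cancel κ ν) }) =
            trans (ℤ.+-identityˡ _)
              (trans (coeff-translate k κ f ν) (cong (λ n → k ℤ.* n) (sym (ℤ.+-identityˡ _))))

    coeff-1−e^− : ∀ i f ν → coeff (1−e^− i ⊛ f) ν ≡ coeff f ν ℤ.- coeff f (ν ⊕ α i)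
    coeff-1−e^− i f ν = begin
      coeff (translate 1ℤ 𝟎 f ++ (translate -1ℤ (⊖ α i) f ++ [])) ν
        ≡⟨ sumWhere-++ (_≟ᴾ ν) (translate 1ℤ 𝟎 f) _ ⟩
      coeff (translate 1ℤ 𝟎 f) ν ℤ.+ coeff (translate -1ℤ (⊖ α i) f ++ []) ν
        ≡⟨ cong₂ ℤ._+_ (coeff-translate 1ℤ 𝟎 f ν)
             (trans (sumWhere-++ (_≟ᴾ ν) (translate -1ℤ (⊖ α i) f) [])
               (cong (λ n → n ℤ.+ 0ℤ) (coeff-translate -1ℤ (⊖ α i) f ν))) ⟩
      1ℤ ℤ.* coeff f (ν ⊝ 𝟎) ℤ.+ (-1ℤ ℤ.* coeff f (ν ⊝ (⊖ α i)) ℤ.+ 0ℤ)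
        ≡⟨ cong₂ (λ x y → 1ℤ ℤ.* coeff f x ℤ.+ (-1ℤ ℤ.* coeff f y ℤ.+ 0ℤ)) (⊝-𝟎 ν) (⊝-⊖ ν (α i)) ⟩
      1ℤ ℤ.* coeff f ν ℤ.+ (-1ℤ ℤ.* coeff f (ν ⊕ α i) ℤ.+ 0ℤ)
        ≡⟨ arith (coeff f ν) (coeff f (ν ⊕ α i)) ⟩
      coeff f ν ℤ.- coeff f (ν ⊕ α i) ∎
      where
      open ≡-Reasoning
      arith : ∀ a b → 1ℤ ℤ.* a ℤ.+ (-1ℤ ℤ.* b ℤ.+ 0ℤ) ≡ a ℤ.- b
      arith = solve-∀

    δ : P → P → ℤ
    δ μ ν = coeff (e^ μ) ν

    δ-shift : ∀ β μ ν → δ μ (ν ⊕ β) ≡ δ (μ ⊝ β) ν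
    δ-shift β μ ν with (μ ⊝ β) ≟ᴾ ν
    ... | yes refl rewrite dec-true (μ ≟ᴾ ((μ ⊝ β) ⊕ β)) (sym (⊝-⊕-cancel β μ)) = refl
    ... | no neq rewrite dec-false (μ ≟ᴾ (ν ⊕ β)) (λ { refl → neq (⊕-⊝-cancelʳ β ν) }) = refl

    coeff-minus : ∀ μ f ν → coeff ((-1ℤ , μ) ∷ f) ν ≡ - δ μ ν ℤ.+ coeff f ν
    coeff-minus μ f ν with does (μ ≟ᴾ ν)
    ... | true  = refl
    ... | false = refl

    coeff-plus : ∀ μ f ν → coeff ((1ℤ , μ) ∷ f) ν ≡ δ μ ν ℤ.+ coeff f ν
    coeff-plus μ f ν with does (μ ≟ᴾ ν)
    ... | true  = refl
    ... | false = refl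

    telescope⁺ : ∀ β μ n ν →
      coeff (geometric β μ (+ n)) ν ℤ.- coeff (geometric β μ (+ n)) (ν ⊕ β)
        ≡ δ μ ν ℤ.- δ (μ ⊝ + n • β) ν
    telescope⁺ β μ zero ν rewrite ⊝-0• μ β = sym (ℤ.+-inverseʳ (δ μ ν))
    telescope⁺ β μ (suc n) ν
      rewrite coeff-plus μ (geometric β (μ ⊝ β) (+ n)) ν
            | coeff-plus μ (geometric β (μ ⊝ β) (+ n)) (ν ⊕ β)
            | δ-shift β μ ν
            | sym (⊝-⊝-• (+ n) μ β) = begin
      a ℤ.+ x ℤ.- (b ℤ.+ y)   ≡⟨ arith₁ a b x y ⟩
      a ℤ.- b ℤ.+ (x ℤ.- y)   ≡⟨ cong (λ t → a ℤ.- b ℤ.+ t) (telescope⁺ β (μ ⊝ β) n ν) ⟩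
      a ℤ.- b ℤ.+ (b ℤ.- c)   ≡⟨ arith₂ a b c ⟩
      a ℤ.- c                 ∎
      where
      open ≡-Reasoning
      a = δ μ ν
      b = δ (μ ⊝ β) ν
      c = δ ((μ ⊝ β) ⊝ + n • β) ν
      x = coeff (geometric β (μ ⊝ β) (+ n)) ν
      y = coeff (geometric β (μ ⊝ β) (+ n)) (ν ⊕ β)
      arith₁ : ∀ a b x y → a ℤ.+ x ℤ.- (b ℤ.+ y) ≡ a ℤ.- b ℤ.+ (x ℤ.- y)
      arith₁ = solve-∀
      arith₂ : ∀ a b c → a ℤ.- b ℤ.+ (b ℤ.- c) ≡ a ℤ.- c
      arith₂ = solve-∀

    δ-raise : ∀ β μ ν → δ (μ ⊕ β) (ν ⊕ β) ≡ δ μ ν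
    δ-raise β μ ν = trans (δ-shift β (μ ⊕ β) ν) (cong (λ κ → δ κ ν) (⊕-⊝-cancelʳ β μ))

    telescope⁻ : ∀ β μ n ν →
      coeff (geometric β μ -[1+ n ]) ν ℤ.- coeff (geometric β μ -[1+ n ]) (ν ⊕ β)
        ≡ δ μ ν ℤ.- δ (μ ⊝ -[1+ n ] • β) ν
    telescope⁻ β μ zero ν
      rewrite coeff-minus (μ ⊕ β) [] ν
            | coeff-minus (μ ⊕ β) [] (ν ⊕ β)
            | δ-raise β μ ν
            | sym (⊕-⊝-• 0ℤ μ β)
            | ⊝-0• (μ ⊕ β) β = arith (δ μ ν) (δ (μ ⊕ β) ν)
      where
      arith : ∀ a b → - b ℤ.+ 0ℤ ℤ.- (- a ℤ.+ 0ℤ) ≡ a ℤ.- b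
      arith = solve-∀
    telescope⁻ β μ (suc n) ν
      rewrite coeff-minus (μ ⊕ β) (geometric β (μ ⊕ β) -[1+ n ]) ν
            | coeff-minus (μ ⊕ β) (geometric β (μ ⊕ β) -[1+ n ]) (ν ⊕ β)
            | δ-raise β μ ν
            | sym (⊕-⊝-• -[1+ n ] μ β) = begin
      - b ℤ.+ x ℤ.- (- a ℤ.+ y)   ≡⟨ arith₁ a b x y ⟩
      a ℤ.- b ℤ.+ (x ℤ.- y)       ≡⟨ cong (λ t → a ℤ.- b ℤ.+ t) (telescope⁻ β (μ ⊕ β) n ν) ⟩
      a ℤ.- b ℤ.+ (b ℤ.- c)       ≡⟨ arith₂ a b c ⟩
      a ℤ.- c                     ∎
      where
      open ≡-Reasoning
      a = δ μ ν
      b = δ (μ ⊕ β) ν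
      c = δ ((μ ⊕ β) ⊝ -[1+ n ] • β) ν
      x = coeff (geometric β (μ ⊕ β) -[1+ n ]) ν
      y = coeff (geometric β (μ ⊕ β) -[1+ n ]) (ν ⊕ β)
      arith₁ : ∀ a b x y → - b ℤ.+ x ℤ.- (- a ℤ.+ y) ≡ a ℤ.- b ℤ.+ (x ℤ.- y)
      arith₁ = solve-∀
      arith₂ : ∀ a b c → a ℤ.- b ℤ.+ (b ℤ.- c) ≡ a ℤ.- c
      arith₂ = solve-∀

    telescope : ∀ β μ N ν →
      coeff (geometric β μ N) ν ℤ.- coeff (geometric β μ N) (ν ⊕ β) ≡ δ μ ν ℤ.- δ (μ ⊝ N • β) ν
    telescope β μ (+ n)    = telescope⁺ β μ n
    telescope β μ -[1+ n ] = telescope⁻ β μ n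

    coeff-π-e^ : ∀ i μ ν → coeff (π i (e^ μ)) ν ≡ coeff (geometric (α i) μ (⟨ α∨ i , μ ⟩ ℤ.+ 1ℤ)) ν
    coeff-π-e^ i μ ν = begin
      coeff (scale 1ℤ g ++ []) ν         ≡⟨ sumWhere-++ (_≟ᴾ ν) (scale 1ℤ g) [] ⟩
      coeff (scale 1ℤ g) ν ℤ.+ 0ℤ        ≡⟨ ℤ.+-identityʳ _ ⟩
      coeff (scale 1ℤ g) ν               ≡⟨ sumWhere-scale (_≟ᴾ ν) 1ℤ g ⟩
      1ℤ ℤ.* coeff g ν                   ≡⟨ ℤ.*-identityˡ _ ⟩
      coeff g ν                          ∎
      where
      open ≡-Reasoning
      g = geometric (α i) μ (⟨ α∨ i , μ ⟩ ℤ.+ 1ℤ)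

    coeff-difference : ∀ μ κ ν → coeff (e^ μ − e^ κ) ν ≡ δ μ ν ℤ.- δ κ ν
    coeff-difference μ κ ν =
      trans (sumWhere-++ (_≟ᴾ ν) (e^ μ) (scale -1ℤ (e^ κ)))
        (cong (λ n → δ μ ν ℤ.+ n) (sumWhere-neg (_≟ᴾ ν) (e^ κ)))

    shift : P → ℕ → P → P
    shift β zero    ν = ν
    shift β (suc k) ν = shift β k (ν ⊕ β)

    shift-pairing : ∀ i k ν → ⟨ α∨ i , shift (α i) k ν ⟩ ≡ ⟨ α∨ i , ν ⟩ ℤ.+ (+ k ℤ.+ + k)
    shift-pairing i zero    ν = sym (ℤ.+-identityʳ _)
    shift-pairing i (suc k) ν = begin
      ⟨ α∨ i , shift (α i) k (ν ⊕ α i) ⟩            ≡⟨ shift-pairing i k (ν ⊕ α i) ⟩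
      ⟨ α∨ i , ν ⊕ α i ⟩ ℤ.+ (+ k ℤ.+ + k)          ≡⟨ cong (λ n → n ℤ.+ (+ k ℤ.+ + k)) pair ⟩
      ⟨ α∨ i , ν ⟩ ℤ.+ + 2 ℤ.+ (+ k ℤ.+ + k)        ≡⟨ arith ⟨ α∨ i , ν ⟩ (+ k) ⟩
      ⟨ α∨ i , ν ⟩ ℤ.+ (+ suc k ℤ.+ + suc k)        ∎
      where
      open ≡-Reasoning
      pair : ⟨ α∨ i , ν ⊕ α i ⟩ ≡ ⟨ α∨ i , ν ⟩ ℤ.+ + 2
      pair = trans (⟨,⊕⟩ (α∨ i) ν (α i))
               (cong (λ n → ⟨ α∨ i , ν ⟩ ℤ.+ n) (pairing-two (simple i)))
      arith : ∀ m k → m ℤ.+ + 2 ℤ.+ (k ℤ.+ k) ≡ m ℤ.+ ((1ℤ ℤ.+ k) ℤ.+ (1ℤ ℤ.+ k))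
      arith = solve-∀

    bounded : ∀ i (f : ℤ[P]) → ∃ λ B → ∀ ν → B ℤ.< ⟨ α∨ i , ν ⟩ → coeff f ν ≡ 0ℤ
    bounded i []            = 0ℤ , λ _ _ → refl
    bounded i ((a , μ) ∷ f) with bounded i f
    ... | B , vanish = B ℤ.⊔ ⟨ α∨ i , μ ⟩ , vanish′
      where
      vanish′ : ∀ ν → B ℤ.⊔ ⟨ α∨ i , μ ⟩ ℤ.< ⟨ α∨ i , ν ⟩ → coeff ((a , μ) ∷ f) ν ≡ 0ℤ
      vanish′ ν lt rewrite dec-false (μ ≟ᴾ ν)
        (λ { refl → ℤ.<-irrefl refl (ℤ.≤-<-trans (ℤ.i≤j⊔i B ⟨ α∨ i , μ ⟩) lt) }) =
        trans (ℤ.+-identityˡ _) (vanish ν (ℤ.≤-<-trans (ℤ.i≤i⊔j B ⟨ α∨ i , μ ⟩) lt))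

    far : ∀ m B → let d = ∣ B ℤ.- m ∣ in B ℤ.< m ℤ.+ (+ suc d ℤ.+ + suc d)
    far m B = begin-strict
      B                                     ≡⟨ arith m B ⟩
      m ℤ.+ (B ℤ.- m)                       ≤⟨ ℤ.+-monoʳ-≤ m (i≤∣i∣ (B ℤ.- m)) ⟩
      m ℤ.+ + d                             <⟨ ℤ.+-monoʳ-< m (ℤ.+<+ (ℕ.s≤s (ℕ.m≤m+n d (suc d)))) ⟩
      m ℤ.+ (+ suc d ℤ.+ + suc d)           ∎
      where
      open ℤ.≤-Reasoning
      d = ∣ B ℤ.- m ∣
      i≤∣i∣ : ∀ i → i ℤ.≤ + ∣ i ∣
      i≤∣i∣ (+ n)    = ℤ.≤-refl
      i≤∣i∣ -[1+ n ] = ℤ.-≤+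
      arith : ∀ m B → B ≡ m ℤ.+ (B ℤ.- m)
      arith = solve-∀

  π-quotient : ∀ i λ′ → 1−e^− i ⊛ π i (e^ λ′) ≈ᴾ e^ λ′ − e^ (s i λ′ ⊝ α i)
  π-quotient i λ′ ν = begin
    coeff (1−e^− i ⊛ π i (e^ λ′)) ν                               ≡⟨ coeff-1−e^− i (π i (e^ λ′)) ν ⟩
    coeff (π i (e^ λ′)) ν ℤ.- coeff (π i (e^ λ′)) (ν ⊕ α i)       ≡⟨ cong₂ ℤ._-_ (coeff-π-e^ i λ′ ν) (coeff-π-e^ i λ′ (ν ⊕ α i)) ⟩
    coeff g ν ℤ.- coeff g (ν ⊕ α i)                               ≡⟨ telescope (α i) λ′ (m ℤ.+ 1ℤ) ν ⟩
    δ λ′ ν ℤ.- δ (λ′ ⊝ (m ℤ.+ 1ℤ) • α i) ν                        ≡⟨ cong (λ κ → δ λ′ ν ℤ.- δ κ ν) (sym (⊝-•-⊝ m λ′ (α i))) ⟩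
    δ λ′ ν ℤ.- δ (s i λ′ ⊝ α i) ν                                 ≡⟨ sym (coeff-difference λ′ (s i λ′ ⊝ α i) ν) ⟩
    coeff (e^ λ′ − e^ (s i λ′ ⊝ α i)) ν                           ∎
    where
    open ≡-Reasoning
    m = ⟨ α∨ i , λ′ ⟩
    g = geometric (α i) λ′ (m ℤ.+ 1ℤ)

  π-quotient-unique : ∀ i f g → 1−e^− i ⊛ f ≈ᴾ 1−e^− i ⊛ g → f ≈ᴾ g
  π-quotient-unique i f g eq ν =
    ℤ.i-j≡0⇒i≡j (coeff f ν) (coeff g ν) (trans (periodic k ν) (cong₂ ℤ._-_
      (proj₂ (bounded i f) _ (ℤ.≤-<-trans (ℤ.i≤i⊔j Bf Bg) large))
      (proj₂ (bounded i g) _ (ℤ.≤-<-trans (ℤ.i≤j⊔i Bf Bg) large))))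
    where
    Bf = proj₁ (bounded i f)
    Bg = proj₁ (bounded i g)
    k  = suc ∣ (Bf ℤ.⊔ Bg) ℤ.- ⟨ α∨ i , ν ⟩ ∣

    large : Bf ℤ.⊔ Bg ℤ.< ⟨ α∨ i , shift (α i) k ν ⟩
    large = subst (Bf ℤ.⊔ Bg ℤ.<_) (sym (shift-pairing i k ν)) (far ⟨ α∨ i , ν ⟩ (Bf ℤ.⊔ Bg))

    arith : ∀ a b c d → a ℤ.- b ≡ c ℤ.- d → a ℤ.- c ≡ b ℤ.- d
    arith a b c d h = trans (lhs a b c) (trans (cong (λ t → t ℤ.+ (b ℤ.- c)) h) (rhs b c d))
      where
      lhs : ∀ a b c → a ℤ.- c ≡ a ℤ.- b ℤ.+ (b ℤ.- c)
      lhs = solve-∀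
      rhs : ∀ b c d → c ℤ.- d ℤ.+ (b ℤ.- c) ≡ b ℤ.- d
      rhs = solve-∀

    periodic : ∀ k μ → coeff f μ ℤ.- coeff g μ ≡ coeff f (shift (α i) k μ) ℤ.- coeff g (shift (α i) k μ)
    periodic zero    μ = refl
    periodic (suc k) μ = trans
      (arith (coeff f μ) (coeff f (μ ⊕ α i)) (coeff g μ) (coeff g (μ ⊕ α i))
        (trans (sym (coeff-1−e^− i f μ)) (trans (eq μ) (coeff-1−e^− i g μ))))
      (periodic k (μ ⊕ α i))

{-# OPTIONS --safe #-}

-- A set of monomials is strongly closed if p[j, k] > 0 allows division of p by
-- z_{j,k−2} and p[j, k] < 0 allows multiplication by z_{j,k}.  This is stronger
-- than being a subcrystal, and unlike that it visibly passes to products of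
-- sets.  For ℳ(i, c)ⁿ it holds because the S with y_{i,c}ⁿ z_S⁻¹ ∈ ℳ(i, c)ⁿ are
-- the graded dimensions of the submodules V of the injective module over the
-- preprojective algebra with socle n copies of the simple module at (i, c − 2):
-- p[j, k] is an Euler characteristic, so its sign forces a vector by which V
-- can be enlarged or a functional whose kernel is a smaller V.
--
-- So ℳ(R) is a subcrystal.  Adding one vertex (i, c) to J replaces the truncation
-- by the union of the i-strings it meets, which it meets in their tops or
-- completely; on characters this is π i.  Hence ch ℳ(R) = π_u (ch ℳ(R, J)) for
-- some word u.  Now apply π_{w∘}, which fixes ch ℳ(R) since every π i does, and
-- satisfies π_{w∘} π i = π_{w∘} by the exchange property.

module Submission where

open import Defs
open import Data.Bool.Base using (Bool; true; false; if_then_else_; _∧_; _xor_; not)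
import Data.Bool.Properties as Bool
open import Data.Empty using (⊥; ⊥-elim; ⊥-elim-irr)
open import Data.Fin.Base as Fin using (Fin; zero; suc; toℕ)
import Data.Fin.Properties as Fin
open import Data.Integer.Base as ℤ using (ℤ; +_; -[1+_]; 0ℤ; 1ℤ; -1ℤ; ∣_∣; -_; _+_; _-_; _*_; _≤_; _<_)
import Data.Integer.Properties as ℤ
open import Data.Integer.Tactic.RingSolver using (solve-∀)
open import Data.List.Base using (List; []; _∷_; _++_; map; concatMap; length; allFin; tabulate; filter; replicate; reverse; deduplicate)
import Data.List.Properties as List
import Data.Sum.Properties as Sum
open import Data.List.Membership.Propositional using (_∈_; _∉_; find; lose)
open import Data.List.Membership.Propositional.Properties using (∈-∃++; ∈-map⁺; ∈-map⁻; ∈-++⁺ˡ; ∈-++⁺ʳ; ∈-++⁻; ∈-filter⁺; ∈-filter⁻; ∈-insert; ∈-deduplicate⁺; ∈-allFin; ∈-concatMap⁺; ∈-concatMap⁻)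
open import Data.List.Relation.Unary.All as All using (All; []; _∷_)
import Data.List.Relation.Unary.All.Properties as All
open import Data.List.Relation.Unary.Any using (here; there; any?)
open import Data.List.Relation.Unary.AllPairs as AllPairs using (AllPairs; []; _∷_)
import Data.List.Relation.Unary.AllPairs.Properties as AllPairs
open import Data.List.Relation.Unary.Unique.Propositional using (Unique)
import Data.List.Relation.Unary.Unique.Propositional.Properties as Unique
import Data.List.Relation.Unary.Unique.DecPropositional.Properties as DecUnique
open import Data.Nat.Base as ℕ using (ℕ; zero; suc; z≤n; s≤s)
import Data.Nat.Properties as ℕ
open import Data.Parity.Base using (Parity; 0ℙ; 1ℙ)
import Data.Parity.Properties as Parity
open import Data.Product.Base using (Σ-syntax; ∃; ∃₂; _×_; _,_; proj₁; proj₂)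
open import Data.Product.Properties using () renaming (≡-dec to Σ-≡-dec)
open import Data.Sum.Base using (_⊎_; inj₁; inj₂; [_,_]′)
open import Data.Vec.Base as Vec using (Vec; []; _∷_; lookup)
import Data.Vec.Properties as Vec
open import Function.Base using (_∘_; id; case_of_; flip)
open import Level using (Level; 0ℓ)
open import Relation.Binary.Construct.Closure.ReflexiveTransitive using (Star; _◅_)
open import Relation.Binary.Definitions using (DecidableEquality; tri<; tri≈; tri>)
open import Relation.Binary.PropositionalEquality.Core using (_≡_; _≢_; refl; sym; trans; cong; cong₂; subst; subst₂)
open import Relation.Binary.PropositionalEquality.Properties using (module ≡-Reasoning)
open import Relation.Nullary.Decidable.Core using (Dec; yes; no; does; _×-dec_; _⊎-dec_; ¬?)
open import Relation.Nullary.Decidable using (dec-true; dec-false; decidable-stable)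
open import Relation.Nullary.Negation.Core using (¬_; contradiction)
open import Relation.Unary using (Pred; Decidable; _⊆_; _∪_)

-- Linear algebra over 𝔽₂, with vectors as functions on finite lists of labels

-- Strong closure asks for a move at every vertex whose exponent has the right sign, not only at the
-- extremal one chosen by a crystal operator. At `w` the exponent is the Euler characteristic of a
-- complex from V at `down w`, through the frames at `w` and the neighbours one step lower, to V at
-- `w`. Its sign therefore says whether a homogeneous linear system has more unknowns than
-- equations, or the transposed system has. Over 𝔽₂ this is Boolean elimination, and subspaces are
-- handled by explicit changes of basis.
--
-- Vertices outside `J` are removed in order of increasing height, from a height so low that nothing
-- of ℳ(R) is cut off yet. The removed vertex is then the lowest of its column, its exponent is
-- minus its multiplicity in S, and as `J` is upward closed the positive exponents of the column lie
-- above it.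
--
-- `J` is an arbitrary predicate and membership in it cannot be decided, so the word u exists only
-- up to double negation. This suffices, because the claim is an equality of integers at each
-- weight.

infixr 5 _⊹_
_⊹_ : Bool → Bool → Bool
_⊹_ = _xor_

module _ {A : Set} where

  Σ₂ : List A → (A → Bool) → Bool
  Σ₂ []      f = false
  Σ₂ (a ∷ L) f = f a ⊹ Σ₂ L f

  Σ₂-cong : ∀ {f g} L → (∀ {a} → a ∈ L → f a ≡ g a) → Σ₂ L f ≡ Σ₂ L g
  Σ₂-cong []      eq = refl
  Σ₂-cong (a ∷ L) eq = cong₂ _⊹_ (eq (here refl)) (Σ₂-cong L (eq ∘ there))

  Σ₂-zero : ∀ {f} L → (∀ {a} → a ∈ L → f a ≡ false) → Σ₂ L f ≡ false
  Σ₂-zero []      eq = refl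
  Σ₂-zero (a ∷ L) eq = cong₂ _⊹_ (eq (here refl)) (Σ₂-zero L (eq ∘ there))

  Σ₂-++ : ∀ {f} L M → Σ₂ (L ++ M) f ≡ Σ₂ L f ⊹ Σ₂ M f
  Σ₂-++         []      M = refl
  Σ₂-++ {f = f} (a ∷ L) M = trans (cong (f a ⊹_) (Σ₂-++ L M)) (sym (Bool.xor-assoc (f a) _ _))

  Σ₂-⊹ : ∀ {f g} L → Σ₂ L (λ a → f a ⊹ g a) ≡ Σ₂ L f ⊹ Σ₂ L g
  Σ₂-⊹ []      = refl
  Σ₂-⊹ {f} {g} (a ∷ L) = trans (cong ((f a ⊹ g a) ⊹_) (Σ₂-⊹ L)) (shuffle (f a) (g a) _ _)
    where
    shuffle : ∀ a b c d → (a ⊹ b) ⊹ (c ⊹ d) ≡ (a ⊹ c) ⊹ (b ⊹ d)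
    shuffle false false false false = refl
    shuffle false false false true = refl
    shuffle false false true false = refl
    shuffle false false true true = refl
    shuffle false true false false = refl
    shuffle false true false true = refl
    shuffle false true true false = refl
    shuffle false true true true = refl
    shuffle true false false false = refl
    shuffle true false false true = refl
    shuffle true false true false = refl
    shuffle true false true true = refl
    shuffle true true false false = refl
    shuffle true true false true = refl
    shuffle true true true false = refl
    shuffle true true true true = refl

  Σ₂-∧ˡ : ∀ {f} b L → Σ₂ L (λ a → b ∧ f a) ≡ b ∧ Σ₂ L f
  Σ₂-∧ˡ false L = Σ₂-zero L (λ _ → refl)
  Σ₂-∧ˡ true  L = refl

  Σ₂-∧ʳ : ∀ {f} b L → Σ₂ L (λ a → f a ∧ b) ≡ Σ₂ L f ∧ b
  Σ₂-∧ʳ {f} b L = trans (Σ₂-cong L (λ {a} _ → Bool.∧-comm (f a) b))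
                    (trans (Σ₂-∧ˡ b L) (Bool.∧-comm b (Σ₂ L f)))

  Σ₂-filter : ∀ {ℓ} {Q : Pred A ℓ} (Q? : Decidable Q) {f} L →
              (∀ {a} → a ∈ L → f a ≡ true → Q a) → Σ₂ (filter Q? L) f ≡ Σ₂ L f
  Σ₂-filter Q? [] h = refl
  Σ₂-filter Q? {f} (a ∷ L) h with Q? a
  ... | yes _  = cong (f a ⊹_) (Σ₂-filter Q? L (h ∘ there))
  ... | no ¬q with f a in eq
  ...   | false = Σ₂-filter Q? L (h ∘ there)
  ...   | true  = contradiction (h (here refl) eq) ¬q

Σ₂-swap : ∀ {A B : Set} (L : List A) (M : List B) {f : A → B → Bool} →
          Σ₂ L (λ a → Σ₂ M (f a)) ≡ Σ₂ M (λ b → Σ₂ L (λ a → f a b))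
Σ₂-swap L []      = Σ₂-zero L (λ _ → refl)
Σ₂-swap L (b ∷ M) {f} = trans (Σ₂-⊹ L) (cong (Σ₂ L (λ a → f a b) ⊹_) (Σ₂-swap L M))

module _ {A : Set} (_≟_ : DecidableEquality A) where

  δ₂ : A → A → Bool
  δ₂ a b = does (a ≟ b)

  δ₂-refl : ∀ a → δ₂ a a ≡ true
  δ₂-refl a = dec-true (a ≟ a) refl

  δ₂-≢ : ∀ {a b} → a ≢ b → δ₂ a b ≡ false
  δ₂-≢ {a} {b} = dec-false (a ≟ b)

  Σ₂-δ : ∀ {f : A → Bool} a L → Unique L → a ∈ L → Σ₂ L (λ b → δ₂ a b ∧ f b) ≡ f a
  Σ₂-δ {f} a (.a ∷ L) (a∉ ∷ u) (here refl) =
    trans (cong₂ _⊹_ (cong (_∧ f a) (δ₂-refl a))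
      (Σ₂-zero L λ b∈ → cong (_∧ _) (δ₂-≢ (All.lookup a∉ b∈))))
      (Bool.xor-identityʳ (f a))
  Σ₂-δ {f} a (b ∷ L) (b∉ ∷ u) (there a∈) =
    trans (cong₂ _⊹_ (cong (_∧ f b) (δ₂-≢ (All.lookup b∉ a∈ ∘ sym))) (Σ₂-δ a L u a∈)) refl

  -- Gaussian elimination on the first column `c`. If every row vanishes there, the indicator of `c`
  -- is a solution. Otherwise a row `r` with entry 1 at `c` clears that column in the other rows,
  -- and a solution of the smaller system is completed at `c`.
  underdetermined : (cols : List A) → Unique cols → (rows : List (A → Bool)) →
    length rows ℕ.< length cols →
    Σ[ x ∈ (A → Bool) ] (∃ λ c → c ∈ cols × x c ≡ true) × (∀ c → x c ≡ true → c ∈ cols) ×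
      All (λ r → Σ₂ cols (λ c → x c ∧ r c) ≡ false) rows
  underdetermined (c ∷ cs) (c∉ ∷ u) rows lt with any? (λ r → r c Bool.≟ true) rows
  ... | no none = δ₂ c , (c , here refl , δ₂-refl c) ,
        (λ b eq → here (sym (δ-sound b eq))) ,
        All.tabulate λ {r} r∈ → trans (Σ₂-δ c (c ∷ cs) (c∉ ∷ u) (here refl))
          (Bool.¬-not λ eq → none (lose r∈ eq))
    where
    δ-sound : ∀ b → δ₂ c b ≡ true → c ≡ b
    δ-sound b eq with c ≟ b
    ... | yes p = p
    δ-sound b () | no _
  ... | yes some with find some
  ...   | r , r∈ , rc with ∈-∃++ r∈
  ...     | pre , post , refl = x , (proj₁ nz , there (proj₁ (proj₂ nz)) , x≡ (proj₁ (proj₂ nz)) (proj₂ (proj₂ nz))) ,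
            x-supp , All.++⁺ (proj₁ others) (kills-r ∷ proj₂ others)
    where
    clear : (A → Bool) → A → Bool
    clear q b = q b ⊹ (q c ∧ r b)

    shorter : length (map clear (pre ++ post)) ℕ.< length cs
    shorter = ℕ.≤-trans (ℕ.≤-reflexive (begin
      suc (length (map clear (pre ++ post))) ≡⟨ cong suc (List.length-map clear (pre ++ post)) ⟩
      suc (length (pre ++ post))             ≡⟨ cong suc (List.length-++ pre) ⟩
      suc (length pre ℕ.+ length post)       ≡⟨ ℕ.+-suc (length pre) (length post) ⟨
      length pre ℕ.+ suc (length post)       ≡⟨ List.length-++ pre ⟨
      length (pre ++ r ∷ post)               ∎)) (ℕ.≤-pred lt)
      where open ≡-Reasoning

    ih = underdetermined cs u (map clear (pre ++ post)) shorter
    x′ = proj₁ ih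
    nz = proj₁ (proj₂ ih)
    x′-supp = proj₁ (proj₂ (proj₂ ih))
    kills = proj₂ (proj₂ (proj₂ ih))

    -- The value at `c` is the one that the pivot row `r`, with entry 1 there, forces.
    x : A → Bool
    x b = if does (c ≟ b) then Σ₂ cs (λ b → x′ b ∧ r b) else x′ b

    xc : x c ≡ Σ₂ cs (λ b → x′ b ∧ r b)
    xc rewrite δ₂-refl c = refl

    x-off : ∀ {b} → b ∈ cs → x b ≡ x′ b
    x-off b∈ rewrite δ₂-≢ (All.lookup c∉ b∈) = refl

    x≡ : ∀ {b} → b ∈ cs → x′ b ≡ true → x b ≡ true
    x≡ b∈ = trans (x-off b∈)

    x-supp : ∀ b → x b ≡ true → b ∈ c ∷ cs
    x-supp b eq with c ≟ b
    ... | yes refl = here refl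
    ... | no _     = there (x′-supp b eq)

    total : ∀ q → Σ₂ (c ∷ cs) (λ b → x b ∧ q b) ≡ (Σ₂ cs (λ b → x′ b ∧ r b) ∧ q c) ⊹ Σ₂ cs (λ b → x′ b ∧ q b)
    total q = cong₂ _⊹_ (cong (_∧ q c) xc) (Σ₂-cong cs λ {b} b∈ → cong (_∧ q b) (x-off b∈))

    kills-r : Σ₂ (c ∷ cs) (λ b → x b ∧ r b) ≡ false
    kills-r = trans (total r) (trans (cong (_⊹ y) (trans (cong (y ∧_) rc) (Bool.∧-identityʳ y))) (Bool.xor-same y))
      where y = Σ₂ cs (λ b → x′ b ∧ r b)

    kills-other : ∀ {q} → Σ₂ cs (λ b → x′ b ∧ clear q b) ≡ false → Σ₂ (c ∷ cs) (λ b → x b ∧ q b) ≡ false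
    kills-other {q} eq = trans (total q) (trans (sym expand) eq)
      where
      y = Σ₂ cs (λ b → x′ b ∧ r b)
      distrib : ∀ a b c d → a ∧ (b ⊹ (c ∧ d)) ≡ (c ∧ (a ∧ d)) ⊹ (a ∧ b)
      distrib false b false d = refl
      distrib false b true  d = refl
      distrib true b false d = Bool.xor-identityʳ b
      distrib true b true d = Bool.xor-comm b d
      expand : Σ₂ cs (λ b → x′ b ∧ clear q b) ≡ (y ∧ q c) ⊹ Σ₂ cs (λ b → x′ b ∧ q b)
      expand = trans (Σ₂-cong cs λ {b} _ → distrib (x′ b) (q b) (q c) (r b))
        (trans (Σ₂-⊹ cs) (cong (_⊹ Σ₂ cs (λ b → x′ b ∧ q b)) (trans (Σ₂-∧ˡ (q c) cs) (Bool.∧-comm (q c) y))))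

    others = All.++⁻ pre (All.map kills-other (All.map⁻ kills))

-- Formal sums and the group of monomials

-- Unfolds to the summand in the definition of `sumWhere`, so that sums over conditions can be
-- compared by comparing decisions.
[_]_ : ∀ {p} {X : Set p} → Dec X → ℤ → ℤ
[ d ] a = if does d then a else 0ℤ

infix 9 [_]_

[yes] : ∀ {p} {X : Set p} (d : Dec X) {a} → X → [ d ] a ≡ a
[yes] d {a} x = cong (λ b → if b then a else 0ℤ) (dec-true d x)

[no] : ∀ {p} {X : Set p} (d : Dec X) {a} → ¬ X → [ d ] a ≡ 0ℤ
[no] d {a} x = cong (λ b → if b then a else 0ℤ) (dec-false d x)

[]-iff : ∀ {p q} {X : Set p} {Y : Set q} (d : Dec X) (e : Dec Y) {a} → (X → Y) → (Y → X) → [ d ] a ≡ [ e ] a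
[]-iff (yes x) e f g = sym ([yes] e (f x))
[]-iff (no ¬x) e f g = sym ([no] e (¬x ∘ g))

[]-0 : ∀ {p} {X : Set p} (d : Dec X) → [ d ] 0ℤ ≡ 0ℤ
[]-0 (yes _) = refl
[]-0 (no _)  = refl

[]-+ : ∀ {p} {X : Set p} (d : Dec X) a b → [ d ] (a + b) ≡ [ d ] a + [ d ] b
[]-+ (yes _) a b = refl
[]-+ (no _)  a b = refl

interchangeℤ : ∀ a b c d → a + b + (c + d) ≡ a + c + (b + d)
interchangeℤ = solve-∀

i-1<i : ∀ i → i - 1ℤ < i
i-1<i i = ℤ.<-≤-trans (ℤ.+-monoʳ-< i (ℤ.-<+ {0} {0})) (ℤ.≤-reflexive (ℤ.+-identityʳ i))

i-2<i : ∀ i → i - + 2 < i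
i-2<i i = ℤ.<-≤-trans (ℤ.+-monoʳ-< i (ℤ.-<+ {1} {0})) (ℤ.≤-reflexive (ℤ.+-identityʳ i))

module _ {A : Set} where

  Σℤ : List A → (A → ℤ) → ℤ
  Σℤ []      f = 0ℤ
  Σℤ (a ∷ L) f = f a + Σℤ L f

  Σℤ-cong : ∀ {f g} L → (∀ {a} → a ∈ L → f a ≡ g a) → Σℤ L f ≡ Σℤ L g
  Σℤ-cong []      eq = refl
  Σℤ-cong (a ∷ L) eq = cong₂ _+_ (eq (here refl)) (Σℤ-cong L (eq ∘ there))

  Σℤ-zero : ∀ {f} L → (∀ {a} → a ∈ L → f a ≡ 0ℤ) → Σℤ L f ≡ 0ℤ
  Σℤ-zero []      eq = refl
  Σℤ-zero (a ∷ L) eq = cong₂ _+_ (eq (here refl)) (Σℤ-zero L (eq ∘ there))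

  Σℤ-+ : ∀ {f g} L → Σℤ L (λ a → f a + g a) ≡ Σℤ L f + Σℤ L g
  Σℤ-+ []      = refl
  Σℤ-+ {f} {g} (a ∷ L) = trans (cong (λ n → (f a + g a) + n) (Σℤ-+ L)) (interchangeℤ (f a) (g a) _ _)

  Σℤ-neg : ∀ {f} L → Σℤ L (λ a → - f a) ≡ - Σℤ L f
  Σℤ-neg []      = refl
  Σℤ-neg {f} (a ∷ L) = trans (cong (λ n → - f a + n) (Σℤ-neg L)) (sym (ℤ.neg-distrib-+ (f a) _))

  Σℤ-++ : ∀ {f} L M → Σℤ (L ++ M) f ≡ Σℤ L f + Σℤ M f
  Σℤ-++         []      M = sym (ℤ.+-identityˡ _)
  Σℤ-++ {f = f} (a ∷ L) M = trans (cong (λ n → f a + n) (Σℤ-++ L M)) (sym (ℤ.+-assoc (f a) _ _))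

  Σℤ-indicator : ∀ {ℓ} {Q : Pred A ℓ} (Q? : Decidable Q) L →
                 Σℤ L (λ a → [ Q? a ] 1ℤ) ≡ + length (filter Q? L)
  Σℤ-indicator Q? [] = refl
  Σℤ-indicator Q? (a ∷ L) with Q? a
  ... | yes _ = cong (λ n → 1ℤ + n) (Σℤ-indicator Q? L)
  ... | no  _ = trans (ℤ.+-identityˡ _) (Σℤ-indicator Q? L)

  Σℤ-filter : ∀ {ℓ} {Q : Pred A ℓ} (Q? : Decidable Q) {f} L →
              Σℤ (filter Q? L) f ≡ Σℤ L (λ a → [ Q? a ] f a)
  Σℤ-filter Q? [] = refl
  Σℤ-filter Q? {f} (a ∷ L) with Q? a
  ... | yes _ = cong (λ n → f a + n) (Σℤ-filter Q? L)
  ... | no  _ = trans (Σℤ-filter Q? L) (sym (ℤ.+-identityˡ _))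

  sumWhere-++ : ∀ {ℓ} {Q : Pred A ℓ} (Q? : Decidable Q) (f g : FormalSum A) →
                sumWhere Q? (f ++ g) ≡ sumWhere Q? f + sumWhere Q? g
  sumWhere-++ Q? []            g = sym (ℤ.+-identityˡ _)
  sumWhere-++ Q? ((a , x) ∷ f) g =
    trans (cong (λ n → [ Q? x ] a + n) (sumWhere-++ Q? f g)) (sym (ℤ.+-assoc ([ Q? x ] a) _ _))

  sumWhere-scale : ∀ {ℓ} {Q : Pred A ℓ} (Q? : Decidable Q) k (f : FormalSum A) →
                   sumWhere Q? (scale k f) ≡ k * sumWhere Q? f
  sumWhere-scale Q? k []            = sym (ℤ.*-zeroʳ k)
  sumWhere-scale Q? k ((a , x) ∷ f) =
    trans (cong₂ _+_ (lemma (Q? x)) (sumWhere-scale Q? k f)) (sym (ℤ.*-distribˡ-+ k ([ Q? x ] a) _))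
    where
    lemma : ∀ {p} {X : Set p} (d : Dec X) → [ d ] (k * a) ≡ k * [ d ] a
    lemma (yes _) = refl
    lemma (no _)  = sym (ℤ.*-zeroʳ k)

  sumWhere-split : ∀ {ℓ ℓ₁ ℓ₂} {Q : Pred A ℓ} {Q₁ : Pred A ℓ₁} {Q₂ : Pred A ℓ₂}
                   (Q? : Decidable Q) (Q₁? : Decidable Q₁) (Q₂? : Decidable Q₂) →
                   (∀ x a → [ Q? x ] a ≡ [ Q₁? x ] a + [ Q₂? x ] a) →
                   ∀ f → sumWhere Q? f ≡ sumWhere Q₁? f + sumWhere Q₂? f
  sumWhere-split Q? Q₁? Q₂? h []            = refl
  sumWhere-split Q? Q₁? Q₂? h ((a , x) ∷ f) =
    trans (cong₂ _+_ (h x a) (sumWhere-split Q? Q₁? Q₂? h f))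
      (interchangeℤ ([ Q₁? x ] a) _ _ _)

  sumWhere-ext : ∀ {ℓ ℓ₁} {Q : Pred A ℓ} {Q₁ : Pred A ℓ₁}
                 (Q? : Decidable Q) (Q₁? : Decidable Q₁) →
                 ∀ f → (∀ {a x} → (a , x) ∈ f → [ Q? x ] a ≡ [ Q₁? x ] a) → sumWhere Q? f ≡ sumWhere Q₁? f
  sumWhere-ext Q? Q₁? []      h = refl
  sumWhere-ext Q? Q₁? (_ ∷ f) h = cong₂ _+_ (h (here refl)) (sumWhere-ext Q? Q₁? f (h ∘ there))

  sumWhere-none : ∀ {ℓ} {Q : Pred A ℓ} (Q? : Decidable Q) f →
                  (∀ {a x} → (a , x) ∈ f → ¬ Q x) → sumWhere Q? f ≡ 0ℤ
  sumWhere-none Q? []            h = refl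
  sumWhere-none Q? ((a , x) ∷ f) h = cong₂ _+_ ([no] (Q? x) (h (here refl))) (sumWhere-none Q? f (h ∘ there))

  module _ (_≟_ : DecidableEquality A) where

    Σℤ-point : ∀ {g : A → ℤ} x U → Unique U → x ∈ U → Σℤ U (λ v → [ x ≟ v ] g v) ≡ g x
    Σℤ-point x (.x ∷ U) (x∉ ∷ u) (here refl) =
      trans (cong₂ _+_ ([yes] (x ≟ x) refl)
        (Σℤ-zero U λ {v} v∈ → [no] (x ≟ v) (All.lookup x∉ v∈)))
        (ℤ.+-identityʳ _)
    Σℤ-point x (v ∷ U) (v∉ ∷ u) (there x∈) =
      trans (cong₂ _+_ ([no] (x ≟ v) (All.lookup v∉ x∈ ∘ sym)) (Σℤ-point x U u x∈)) (ℤ.+-identityˡ _)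

    sumWhere-by-values : ∀ {ℓ} {Q : Pred A ℓ} (Q? : Decidable Q) U → Unique U → ∀ f →
      (∀ {a x} → (a , x) ∈ f → x ∈ U) →
      sumWhere Q? f ≡ Σℤ U (λ v → [ Q? v ] (sumWhere (_≟ v) f))
    sumWhere-by-values Q? U u []            h = sym (Σℤ-zero U λ {v} _ → []-0 (Q? v))
    sumWhere-by-values Q? U u ((a , x) ∷ f) h = sym (begin
      Σℤ U (λ v → [ Q? v ] ([ x ≟ v ] a + sumWhere (_≟ v) f))
        ≡⟨ Σℤ-cong U (λ {v} _ → []-+ (Q? v) ([ x ≟ v ] a) _) ⟩
      Σℤ U (λ v → [ Q? v ] [ x ≟ v ] a + [ Q? v ] (sumWhere (_≟ v) f))
        ≡⟨ Σℤ-+ U ⟩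
      Σℤ U (λ v → [ Q? v ] [ x ≟ v ] a) + Σℤ U (λ v → [ Q? v ] (sumWhere (_≟ v) f))
        ≡⟨ cong₂ _+_ (trans (Σℤ-cong U λ {v} _ → commute v) (Σℤ-point x U u (h (here refl))))
             (sym (sumWhere-by-values Q? U u f (h ∘ there))) ⟩
      [ Q? x ] a + sumWhere Q? f ∎)
      where
      open ≡-Reasoning
      commute : ∀ v → [ Q? v ] [ x ≟ v ] a ≡ [ x ≟ v ] [ Q? v ] a
      commute v with does (Q? v) | does (x ≟ v)
      ... | true  | true  = refl
      ... | true  | false = refl
      ... | false | true  = refl
      ... | false | false = refl

    -- Values of φ, ε and column totals are computed from formal sums, in which an element may
    -- recur. This makes them functions of the exponents alone, hence invariant under equality of
    -- monomials.
    sumWhere-cong : ∀ {ℓ} {Q : Pred A ℓ} (Q? : Decidable Q) f g →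
      (∀ v → sumWhere (_≟ v) f ≡ sumWhere (_≟ v) g) → sumWhere Q? f ≡ sumWhere Q? g
    sumWhere-cong Q? f g eq = trans (sumWhere-by-values Q? U u f (λ x∈ → mem (∈-++⁺ˡ x∈)))
      (trans (Σℤ-cong U λ {v} _ → cong ([ Q? v ]_) (eq v))
        (sym (sumWhere-by-values Q? U u g (λ x∈ → mem (∈-++⁺ʳ f x∈)))))
      where
      U = deduplicate _≟_ (map proj₂ (f ++ g))
      u = DecUnique.deduplicate-! _≟_ (map proj₂ (f ++ g))
      mem : ∀ {a x} → (a , x) ∈ f ++ g → x ∈ U
      mem x∈ = ∈-deduplicate⁺ _≟_ (∈-map⁺ proj₂ x∈)

module Monomials (𝒮 : Setting) where

  open Setting 𝒮
  open Crystal 𝒮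

  -- A monomial is determined by its coordinates in ℤ, on which products and inverses become sums
  -- and negatives. Identities between monomials thereby reduce to ring identities.
  Coordinate : Set
  Coordinate = Fin rank ⊎ I×̇ℤ

  infix 20 _⟪_⟫
  _⟪_⟫ : Monomial → Coordinate → ℤ
  p ⟪ inj₁ r ⟫ = lookup (wt p) r
  p ⟪ inj₂ v ⟫ = p ⟦ v ⟧

  ·-⟪⟫ : ∀ p q κ → (p · q) ⟪ κ ⟫ ≡ p ⟪ κ ⟫ + q ⟪ κ ⟫
  ·-⟪⟫ p q (inj₁ r) = Vec.lookup-zipWith _+_ r (wt p) (wt q)
  ·-⟪⟫ p q (inj₂ v) = sumWhere-++ (_≟ⱽ v) (factors p) (factors q)

  ⁻¹-⟪⟫ : ∀ p κ → (p ⁻¹) ⟪ κ ⟫ ≡ - p ⟪ κ ⟫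
  ⁻¹-⟪⟫ p (inj₁ r) = Vec.lookup-map r -_ (wt p)
  ⁻¹-⟪⟫ p (inj₂ v) = trans (sumWhere-scale (_≟ⱽ v) -1ℤ (factors p)) (ℤ.-1*i≡-i _)

  𝟙-⟪⟫ : ∀ κ → 𝟙 ⟪ κ ⟫ ≡ 0ℤ
  𝟙-⟪⟫ (inj₁ r) = Vec.lookup-replicate r 0ℤ
  𝟙-⟪⟫ (inj₂ v) = refl

  quotient-⟪⟫ : ∀ p q κ → (p · q ⁻¹) ⟪ κ ⟫ ≡ p ⟪ κ ⟫ - q ⟪ κ ⟫
  quotient-⟪⟫ p q κ = trans (·-⟪⟫ p (q ⁻¹) κ) (cong (λ n → p ⟪ κ ⟫ + n) (⁻¹-⟪⟫ q κ))

  vec-ext : ∀ {n} {x y : Vec ℤ n} → (∀ r → lookup x r ≡ lookup y r) → x ≡ y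
  vec-ext {x = []}    {[]}    eq = refl
  vec-ext {x = _ ∷ _} {_ ∷ _} eq = cong₂ _∷_ (eq zero) (vec-ext (eq ∘ suc))

  -- The components of p ≈ q do not determine p and q for unification.
  infix 4 _≋_
  record _≋_ (p q : Monomial) : Set where
    constructor wrap
    field unwrap : p ≈ q
  open _≋_ public

  ≋-ext : ∀ {p q} → (∀ κ → p ⟪ κ ⟫ ≡ q ⟪ κ ⟫) → p ≋ q
  ≋-ext eq = wrap (vec-ext (eq ∘ inj₁) , eq ∘ inj₂)

  ≋-⟪⟫ : ∀ {p q} → p ≋ q → ∀ κ → p ⟪ κ ⟫ ≡ q ⟪ κ ⟫
  ≋-⟪⟫ (wrap (eq , _)) (inj₁ r) = cong (λ x → lookup x r) eq
  ≋-⟪⟫ (wrap (_ , eq)) (inj₂ v) = eq v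

  ≋-refl : ∀ {p} → p ≋ p
  ≋-refl = wrap (refl , λ _ → refl)

  ≋-sym : ∀ {p q} → p ≋ q → q ≋ p
  ≋-sym (wrap (a , b)) = wrap (sym a , sym ∘ b)

  ≋-trans : ∀ {p q r} → p ≋ q → q ≋ r → p ≋ r
  ≋-trans (wrap (a , b)) (wrap (c , d)) = wrap (trans a c , λ v → trans (b v) (d v))

  ·-cong : ∀ {p p′ q q′} → p ≋ p′ → q ≋ q′ → p · q ≋ p′ · q′
  ·-cong {p} {p′} {q} {q′} a b = ≋-ext λ κ →
    trans (·-⟪⟫ p q κ) (trans (cong₂ _+_ (≋-⟪⟫ a κ) (≋-⟪⟫ b κ)) (sym (·-⟪⟫ p′ q′ κ)))

  ⁻¹-cong : ∀ {p q} → p ≋ q → p ⁻¹ ≋ q ⁻¹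
  ⁻¹-cong {p} {q} a = ≋-ext λ κ →
    trans (⁻¹-⟪⟫ p κ) (trans (cong -_ (≋-⟪⟫ a κ)) (sym (⁻¹-⟪⟫ q κ)))

  ⁻¹·-cancel : ∀ p q → (p · q ⁻¹) · q ≋ p
  ⁻¹·-cancel p q = ≋-ext λ κ → trans (·-⟪⟫ (p · q ⁻¹) q κ)
    (trans (cong (_+ q ⟪ κ ⟫) (quotient-⟪⟫ p q κ)) (arith (p ⟪ κ ⟫) (q ⟪ κ ⟫)))
    where
    arith : ∀ a b → a - b + b ≡ a
    arith = solve-∀

  ··⁻¹-cancel : ∀ p q → (p · q) · q ⁻¹ ≋ p
  ··⁻¹-cancel p q = ≋-ext λ κ → trans (quotient-⟪⟫ (p · q) q κ)
    (trans (cong (_- q ⟪ κ ⟫) (·-⟪⟫ p q κ)) (arith (p ⟪ κ ⟫) (q ⟪ κ ⟫)))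
    where
    arith : ∀ a b → a + b - b ≡ a
    arith = solve-∀

  ·-swapʳ : ∀ p q r → (p · q) · r ≋ (p · r) · q
  ·-swapʳ p q r = ≋-ext λ κ → trans (·-⟪⟫ (p · q) r κ) (trans (cong (_+ r ⟪ κ ⟫) (·-⟪⟫ p q κ))
    (trans (arith (p ⟪ κ ⟫) (q ⟪ κ ⟫) (r ⟪ κ ⟫))
      (sym (trans (·-⟪⟫ (p · r) q κ) (cong (_+ q ⟪ κ ⟫) (·-⟪⟫ p r κ))))))
    where
    arith : ∀ a b c → a + b + c ≡ a + c + b
    arith = solve-∀

  ·-assoc : ∀ p q r → (p · q) · r ≋ p · (q · r)
  ·-assoc p q r = ≋-ext λ κ → trans (·-⟪⟫ (p · q) r κ) (trans (cong (_+ r ⟪ κ ⟫) (·-⟪⟫ p q κ))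
    (trans (ℤ.+-assoc (p ⟪ κ ⟫) _ _)
      (sym (trans (·-⟪⟫ p (q · r) κ) (cong (λ n → p ⟪ κ ⟫ + n) (·-⟪⟫ q r κ))))))

  Height-≡ : ∀ {i} {k l : Height i} → height k ≡ height l → k ≡ l
  Height-≡ {k = mkHeight a _} {mkHeight .a _} refl = refl

  up down : I×̇ℤ → I×̇ℤ
  up   (i , k) = i , k ↑²
  down (i , k) = i , k ↓²

  ↑²↓² : ∀ {i} (k : Height i) → k ↓² ↑² ≡ k
  ↑²↓² (mkHeight k _) = Height-≡ (arith k)
    where
    arith : ∀ k → k - + 2 + + 2 ≡ k
    arith = solve-∀

  ↓²↑² : ∀ {i} (k : Height i) → k ↑² ↓² ≡ k
  ↓²↑² (mkHeight k _) = Height-≡ (arith k)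
    where
    arith : ∀ k → k + + 2 - + 2 ≡ k
    arith = solve-∀

  up-down : ∀ v → up (down v) ≡ v
  up-down (i , k) = cong (i ,_) (↑²↓² k)

  down-up : ∀ v → down (up v) ≡ v
  down-up (i , k) = cong (i ,_) (↓²↑² k)

  ht : I×̇ℤ → ℤ
  ht (_ , k) = height k

  vertex-≡ : ∀ {v w} → proj₁ v ≡ proj₁ w → ht v ≡ ht w → v ≡ w
  vertex-≡ refl eq = cong (_ ,_) (Height-≡ eq)

  -- The covering relation across an edge of the diagram, with an equation between integers in place
  -- of `cross`, so that it is decidable and free of parity proofs.
  Diagonal : I×̇ℤ → I×̇ℤ → Set
  Diagonal v w = proj₁ w ∼ proj₁ v × ht w ≡ ht v + 1ℤ

  Diagonal? : ∀ v w → Dec (Diagonal v w)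
  Diagonal? v w = (proj₁ w ∼? proj₁ v) ×-dec (ht w ℤ.≟ ht v + 1ℤ)

  diagonal-≼ : ∀ {v w} → Diagonal v w → v ≼ w
  diagonal-≼ {i , c} {j , d} (j∼i , eq) =
    subst (λ d → (i , c) ≼ (j , d)) (Height-≡ {k = cross j∼i c} {d} (sym eq)) (diagonal j∼i ◅ Star.ε)

  ∼-irrefl : ∀ {i} → ¬ i ∼ i
  ∼-irrefl {i} i∼i = contradiction (trans (sym i∼i) (pairing-two (simple i))) λ ()

  private

    neighbour-value : ∀ {i} (k : Height i) j l →
      sumWhere (_≟ⱽ (j , l)) (neighbour k j) ≡ - [ Diagonal? (i , k) (j , l) ] 1ℤ
    neighbour-value {i} k j l with j ∼? i
    ... | no  _   = refl
    ... | yes j∼i with (j , cross j∼i k) ≟ⱽ (j , l) | height l ℤ.≟ height k + 1ℤ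
    ...   | yes _    | yes _  = refl
    ...   | no _     | no _   = refl
    ...   | yes refl | no neq = contradiction refl neq
    ...   | no neq   | yes eq = contradiction (cong (j ,_) (Height-≡ (sym eq))) neq

    neighbour-off : ∀ {i} (k : Height i) j j′ l → j′ ≢ j → sumWhere (_≟ⱽ (j , l)) (neighbour k j′) ≡ 0ℤ
    neighbour-off {i} k j j′ l j′≢j with j′ ∼? i
    ... | no  _    = refl
    ... | yes j′∼i = trans (cong (_+ 0ℤ) ([no] ((j′ , cross j′∼i k) ≟ⱽ (j , l)) (j′≢j ∘ cong proj₁))) refl

    neighbours : ∀ {i} (k : Height i) j l js → Unique js → j ∈ js →
      sumWhere (_≟ⱽ (j , l)) (concatMap (neighbour k) js) ≡ sumWhere (_≟ⱽ (j , l)) (neighbour k j)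
    neighbours k j l js u j∈ = trans (sum js) (trans (Σℤ-cong js λ {j′} _ → point j′) (Σℤ-point Fin._≟_ j js u j∈))
      where
      h : I → ℤ
      h j′ = sumWhere (_≟ⱽ (j , l)) (neighbour k j′)
      sum : ∀ js → sumWhere (_≟ⱽ (j , l)) (concatMap (neighbour k) js) ≡ Σℤ js h
      sum []        = refl
      sum (j′ ∷ js) = trans (sumWhere-++ (_≟ⱽ (j , l)) (neighbour k j′) _) (cong (λ n → h j′ + n) (sum js))
      point : ∀ j′ → h j′ ≡ [ j Fin.≟ j′ ] h j′
      point j′ with j Fin.≟ j′
      ... | yes _  = refl
      ... | no neq = neighbour-off k j j′ l (neq ∘ sym)

  z-value : ∀ v w → z v ⟦ w ⟧ ≡ [ v ≟ⱽ w ] 1ℤ + ([ up v ≟ⱽ w ] 1ℤ + - [ Diagonal? v w ] 1ℤ)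
  z-value (i , k) (j , l) = cong (λ n → [ (i , k) ≟ⱽ (j , l) ] 1ℤ + ([ (i , k ↑²) ≟ⱽ (j , l) ] 1ℤ + n))
    (trans (neighbours k j l (allFin #simple) (Unique.allFin⁺ #simple) (∈-allFin j)) (neighbour-value k j l))

  ∏z : List I×̇ℤ → Monomial
  ∏z L = ∏ L z

  ∏-⟪⟫ : ∀ (L : List I×̇ℤ) p κ → (∏ L p) ⟪ κ ⟫ ≡ Σℤ L (λ v → p v ⟪ κ ⟫)
  ∏-⟪⟫ []      p κ = 𝟙-⟪⟫ κ
  ∏-⟪⟫ (v ∷ L) p κ = trans (·-⟪⟫ (p v) (∏ L p) κ) (cong (λ n → p v ⟪ κ ⟫ + n) (∏-⟪⟫ L p κ))

  #≡ #↑ #∠ : I×̇ℤ → List I×̇ℤ → ℕ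
  #≡ w L = length (filter (_≟ⱽ w) L)
  #↑ w L = length (filter (λ v → up v ≟ⱽ w) L)
  #∠ w L = length (filter (λ v → Diagonal? v w) L)

  -- Read `L` as a dimension vector: the terms are the dimensions at `w`, at `down w`, and at the
  -- neighbouring vertices one step lower, which are the terms of the complex at `w` without its
  -- frames.
  ∏z-value : ∀ L w → ∏z L ⟦ w ⟧ ≡ + #≡ w L + (+ #↑ w L - + #∠ w L)
  ∏z-value L w = begin
    ∏z L ⟦ w ⟧ ≡⟨ ∏-⟪⟫ L z (inj₂ w) ⟩
    Σℤ L (λ v → z v ⟦ w ⟧) ≡⟨ Σℤ-cong L (λ {v} _ → z-value v w) ⟩
    Σℤ L (λ v → [ v ≟ⱽ w ] 1ℤ + ([ up v ≟ⱽ w ] 1ℤ + - [ Diagonal? v w ] 1ℤ)) ≡⟨ Σℤ-+ L ⟩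
    Σℤ L (λ v → [ v ≟ⱽ w ] 1ℤ) + Σℤ L (λ v → [ up v ≟ⱽ w ] 1ℤ + - [ Diagonal? v w ] 1ℤ)
      ≡⟨ cong₂ _+_ (Σℤ-indicator (_≟ⱽ w) L) (trans (Σℤ-+ L) (cong₂ _+_ (Σℤ-indicator (λ v → up v ≟ⱽ w) L)
           (trans (Σℤ-neg L) (cong -_ (Σℤ-indicator (λ v → Diagonal? v w) L))))) ⟩
    + #≡ w L + (+ #↑ w L - + #∠ w L) ∎
    where open ≡-Reasoning

-- Graded modules over the preprojective algebra

module Modules (𝒮 : Setting) where

  open Setting 𝒮
  open Crystal 𝒮
  open Monomials 𝒮

  ∼-sym : ∀ {i j} → i ∼ j → j ∼ i
  ∼-sym {i} {j} i∼j = trans (cartan-symmetric j i) i∼j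

  ≢-down : ∀ v → down v ≢ v
  ≢-down v eq = ℤ.<-irrefl (cong ht eq) (i-2<i (ht v))

  -- The number only tells apart basis vectors at the same vertex.
  Cell : Set
  Cell = I×̇ℤ × ℕ

  infix 4 _≟ᶜ_
  _≟ᶜ_ : DecidableEquality Cell
  _≟ᶜ_ = Σ-≡-dec _≟ⱽ_ ℕ._≟_

  -- A graded module V over the preprojective algebra of the Dynkin diagram, with
  -- 𝔽₂-basis the cells in L, framed by n copies of 𝔽₂ at v₀ (over 𝔽₂ the relations
  -- need no signs).  The arrows A raise the height by 1; they embed V at
  -- (j , k − 2), with retraction Λ, in the sum of V at (j′ , k − 1) over j′ ∼ j
  -- and of the frames if v₀ = (j , k), which is Nakajima's stability condition.
  module Framed (v₀ : I×̇ℤ) (n : ℕ) where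

    Label : Set
    Label = Fin n ⊎ Cell

    labels : List Cell → List Label
    labels L = map inj₁ (allFin n) ++ map inj₂ L

    Into : I×̇ℤ → Pred Label 0ℓ
    Into w (inj₁ _)       = v₀ ≡ w
    Into w (inj₂ (v , _)) = Diagonal v w

    Into? : ∀ w → Decidable (Into w)
    Into? w (inj₁ _)       = v₀ ≟ⱽ w
    Into? w (inj₂ (v , _)) = Diagonal? v w

    fromCell : (Cell → Label → Bool) → Label → Cell → Bool
    -- No arrow leaves a frame: the way from V to the frames ends there.
    fromCell A (inj₁ _) b = false
    fromCell A (inj₂ c) b = A c (inj₂ b)

    record Module (L : List Cell) : Set where
      field
        nodup   : Unique L
        low      : ∀ {c} → c ∈ L → ht (proj₁ c) < ht v₀
        A        : Cell → Label → Bool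
        Λ        : Label → Cell → Bool
        graded   : ∀ a m → A a m ≡ true → Into (up (proj₁ a)) m
        relation : ∀ {a b} → a ∈ L → b ∈ L → up (proj₁ a) ≡ proj₁ b →
                   Σ₂ (labels L) (λ m → A a m ∧ fromCell A m b) ≡ false
        split    : ∀ {a b} → a ∈ L → b ∈ L → proj₁ a ≡ proj₁ b →
                   Σ₂ (labels L) (λ m → A a m ∧ Λ m b) ≡ δ₂ _≟ᶜ_ a b

    Σ₂-map : ∀ {X Y : Set} (g : X → Y) {f} L → Σ₂ (map g L) f ≡ Σ₂ L (f ∘ g)
    Σ₂-map g []      = refl
    Σ₂-map g {f} (x ∷ L) = cong (f (g x) ⊹_) (Σ₂-map g L)

    Σ₂-labels : ∀ {f} L → Σ₂ (labels L) f ≡ Σ₂ (allFin n) (f ∘ inj₁) ⊹ Σ₂ L (f ∘ inj₂)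
    Σ₂-labels L = trans (Σ₂-++ (map inj₁ (allFin n)) (map inj₂ L))
      (cong₂ _⊹_ (Σ₂-map inj₁ (allFin n)) (Σ₂-map inj₂ L))

    labels-nodup : ∀ {L} → Unique L → Unique (labels L)
    labels-nodup {L} u = Unique.++⁺
      (Unique.map⁺ (λ { refl → refl }) (Unique.allFin⁺ n))
      (Unique.map⁺ (λ { refl → refl }) u)
      λ (a∈ , b∈) → case ∈-map⁻ inj₁ a∈ , ∈-map⁻ inj₂ b∈ of λ { ((_ , _ , refl) , (_ , _ , ())) }

    ∈-labels⁺ : ∀ {c L} → c ∈ L → inj₂ c ∈ labels L
    ∈-labels⁺ c∈ = ∈-++⁺ʳ (map inj₁ (allFin n)) (∈-map⁺ inj₂ c∈)

    ∈-labels⁻ : ∀ {c L} → inj₂ c ∈ labels L → c ∈ L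
    ∈-labels⁻ {c} {L} c∈ with ∈-++⁻ (map inj₁ (allFin n)) c∈
    ... | inj₁ c∈′ = case ∈-map⁻ inj₁ c∈′ of λ { (_ , _ , ()) }
    ... | inj₂ c∈′ with ∈-map⁻ inj₂ c∈′
    ...   | _ , c∈L , refl = c∈L

    -- `below w`, `above w` and `at w` are bases of the three terms of the complex at `w`, in the
    -- order of its maps. `above` is meant relative to `down w`.
    above : I×̇ℤ → List Cell → List Label
    above w L = filter (Into? w) (labels L)

    at below : I×̇ℤ → List Cell → List Cell
    at    w L = filter (λ c → proj₁ c ≟ⱽ w) L
    below w L = filter (λ c → up (proj₁ c) ≟ⱽ w) L

    ∈-at : ∀ {w b} L → b ∈ at w L → b ∈ L × proj₁ b ≡ w
    ∈-at {w} L = ∈-filter⁻ (λ c → proj₁ c ≟ⱽ w)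

    ∈-below : ∀ {w b} L → b ∈ below w L → b ∈ L × up (proj₁ b) ≡ w
    ∈-below {w} L = ∈-filter⁻ (λ c → up (proj₁ c) ≟ⱽ w)

    fresh : ∀ L → ∃ λ q → ∀ {c : Cell} → c ∈ L → proj₂ c ℕ.< q
    fresh []      = 0 , λ ()
    fresh (c ∷ L) = let q , h = fresh L in suc (proj₂ c) ℕ.⊔ q , λ where
      (here refl) → ℕ.m≤m⊔n (suc (proj₂ c)) q
      (there c∈)  → ℕ.≤-trans (h c∈) (ℕ.m≤n⊔m (suc (proj₂ c)) q)

    infix 4 _≟ᴸ_
    _≟ᴸ_ : DecidableEquality Label
    _≟ᴸ_ = Sum.≡-dec Fin._≟_ _≟ᶜ_

    -- V is enlarged below w by a vector x in the kernel of the relation map to V at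
    -- w, hence outside V as Λ kills it too.
    module Extend {L} (V : Module L) (w : I×̇ℤ) (x : Label → Bool) (r : Label) (xr : x r ≡ true)
      (x-supp : ∀ m → x m ≡ true → m ∈ labels L × Into w m)
      (x-relation : ∀ {b} → b ∈ L → proj₁ b ≡ w → Σ₂ (labels L) (λ m → x m ∧ fromCell (Module.A V) m b) ≡ false)
      (x-Λ : ∀ {b} → b ∈ L → up (proj₁ b) ≡ w → Σ₂ (labels L) (λ m → x m ∧ Module.Λ V m b) ≡ false) where

      open Module V

      q = proj₁ (fresh L)

      a* : Cell
      a* = down w , q

      a*∉ : ∀ {c} → c ∈ L → a* ≢ c
      a*∉ c∈ refl = ℕ.<-irrefl refl (proj₂ (fresh L) c∈)

      A′ : Cell → Label → Bool
      -- The guard erases arrows into the new cell: outside `L` the matrix `A` is only known to be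
      -- graded.
      A′ a m = if does (a* ≟ᶜ a) then x m else A a m ∧ not (does (inj₂ a* ≟ᴸ m))

      -- The new component of the retraction: the `r` coordinate after subtracting A Λ. It vanishes
      -- on the image of an old cell at `down w`, where Λ A is the identity, and is `x r`, that is
      -- 1, on `x`, which Λ kills.
      g : Label → Bool
      g m = δ₂ _≟ᴸ_ r m ⊹ Σ₂ (below w L) (λ b → Λ m b ∧ A b r)

      Λ′ : Label → Cell → Bool
      Λ′ m b = if does (a* ≟ᶜ b) then g m else Λ m b

      A′-new : ∀ m → A′ a* m ≡ x m
      A′-new m rewrite dec-true (a* ≟ᶜ a*) refl = refl

      A′-old : ∀ {a m} → a ∈ L → m ∈ labels L → A′ a m ≡ A a m
      A′-old {a} {m} a∈ m∈ rewrite dec-false (a* ≟ᶜ a) (a*∉ a∈)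
        | dec-false (inj₂ a* ≟ᴸ m) (λ { refl → a*∉ (∈-labels⁻ m∈) refl }) = Bool.∧-identityʳ _

      x-a* : x (inj₂ a*) ≡ false
      x-a* = Bool.¬-not λ eq → a*∉ (∈-labels⁻ (proj₁ (x-supp (inj₂ a*) eq))) refl

      A′-to-new : ∀ a → A′ a (inj₂ a*) ≡ false
      A′-to-new a with does (a* ≟ᶜ a)
      ... | true  = x-a*
      ... | false rewrite dec-true (a* ≟ᶜ a*) refl = Bool.∧-zeroʳ _

      Λ′-new : ∀ m → Λ′ m a* ≡ g m
      Λ′-new m rewrite dec-true (a* ≟ᶜ a*) refl = refl

      Λ′-old : ∀ {b} m → b ∈ L → Λ′ m b ≡ Λ m b
      Λ′-old {b} m b∈ rewrite dec-false (a* ≟ᶜ b) (a*∉ b∈) = refl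

      graded′ : ∀ a m → A′ a m ≡ true → Into (up (proj₁ a)) m
      graded′ a m with a* ≟ᶜ a
      ... | yes refl = λ eq → subst (λ v → Into v m) (sym (up-down w)) (proj₂ (x-supp m eq))
      ... | no  _    = λ eq → graded a m (∧-true eq)
        where
        ∧-true : ∀ {a b} → a ∧ b ≡ true → a ≡ true
        ∧-true {true} _ = refl

      sum′ : ∀ a (f : Label → Bool) → Σ₂ (labels (a* ∷ L)) (λ m → A′ a m ∧ f m) ≡ Σ₂ (labels L) (λ m → A′ a m ∧ f m)
      sum′ a f = trans (Σ₂-labels (a* ∷ L))
        (trans (cong (λ z → Σ₂ (allFin n) (λ m → A′ a (inj₁ m) ∧ f (inj₁ m)) ⊹ ((z ∧ f (inj₂ a*)) ⊹ Σ₂ L (λ m → A′ a (inj₂ m) ∧ f (inj₂ m)))) (A′-to-new a))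
          (sym (Σ₂-labels L)))

      sum-old : ∀ {a} (f : Label → Bool) → a ∈ L → Σ₂ (labels (a* ∷ L)) (λ m → A′ a m ∧ f m) ≡ Σ₂ (labels L) (λ m → A a m ∧ f m)
      sum-old {a} f a∈ = trans (sum′ a f) (Σ₂-cong (labels L) λ {m} m∈ → cong (_∧ f m) (A′-old a∈ m∈))

      sum-new : (f : Label → Bool) → Σ₂ (labels (a* ∷ L)) (λ m → A′ a* m ∧ f m) ≡ Σ₂ (labels L) (λ m → x m ∧ f m)
      sum-new f = trans (sum′ a* f) (Σ₂-cong (labels L) λ {m} _ → cong (_∧ f m) (A′-new m))

      fromCell-new : ∀ m → fromCell A′ m a* ≡ false
      fromCell-new (inj₁ _) = refl
      fromCell-new (inj₂ c) = A′-to-new c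

      fromCell-old : ∀ {b} m → m ∈ labels L → b ∈ L → fromCell A′ m b ≡ fromCell A m b
      fromCell-old (inj₁ _) m∈ b∈ = refl
      fromCell-old (inj₂ c) m∈ b∈ = A′-old (∈-labels⁻ m∈) (∈-labels⁺ b∈)

      relation′ : ∀ {a b} → a ∈ a* ∷ L → b ∈ a* ∷ L → up (proj₁ a) ≡ proj₁ b →
                  Σ₂ (labels (a* ∷ L)) (λ m → A′ a m ∧ fromCell A′ m b) ≡ false
      relation′ {a} a∈ (here refl) eq = Σ₂-zero (labels (a* ∷ L)) λ {m} _ →
        trans (cong (A′ a m ∧_) (fromCell-new m)) (Bool.∧-zeroʳ _)
      relation′ {b = b} (here refl) (there b∈) eq = trans (sum-new (λ m → fromCell A′ m b))
        (trans (Σ₂-cong (labels L) λ {m} m∈ → cong (x m ∧_) (fromCell-old m m∈ b∈))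
          (x-relation b∈ (trans (sym eq) (up-down w))))
      relation′ {a} {b} (there a∈) (there b∈) eq = trans (sum-old (λ m → fromCell A′ m b) a∈)
        (trans (Σ₂-cong (labels L) λ {m} m∈ → cong (A a m ∧_) (fromCell-old m m∈ b∈)) (relation a∈ b∈ eq))

      functional : (f : Label → Bool) → Σ₂ (labels L) (λ m → f m ∧ g m) ≡
        f r ⊹ Σ₂ (below w L) (λ b → Σ₂ (labels L) (λ m → f m ∧ Λ m b) ∧ A b r)
      functional f = begin
        Σ₂ (labels L) (λ m → f m ∧ g m)
          ≡⟨ Σ₂-cong (labels L) (λ {m} _ → expand m) ⟩
        Σ₂ (labels L) (λ m → (δ₂ _≟ᴸ_ r m ∧ f m) ⊹ Σ₂ (below w L) (λ b → (f m ∧ Λ m b) ∧ A b r))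
          ≡⟨ Σ₂-⊹ (labels L) ⟩
        Σ₂ (labels L) (λ m → δ₂ _≟ᴸ_ r m ∧ f m) ⊹
        Σ₂ (labels L) (λ m → Σ₂ (below w L) (λ b → (f m ∧ Λ m b) ∧ A b r))
          ≡⟨ cong₂ _⊹_ (Σ₂-δ _≟ᴸ_ r (labels L) (labels-nodup nodup) (proj₁ (x-supp r xr)))
               (trans (Σ₂-swap (labels L) (below w L)) (Σ₂-cong (below w L) λ {b} _ → Σ₂-∧ʳ (A b r) (labels L))) ⟩
        f r ⊹ Σ₂ (below w L) (λ b → Σ₂ (labels L) (λ m → f m ∧ Λ m b) ∧ A b r) ∎
        where
        open ≡-Reasoning
        expand : ∀ m → f m ∧ g m ≡ (δ₂ _≟ᴸ_ r m ∧ f m) ⊹ Σ₂ (below w L) (λ b → (f m ∧ Λ m b) ∧ A b r)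
        expand m = trans (Bool.∧-distribˡ-xor (f m) (δ₂ _≟ᴸ_ r m) _) (cong₂ _⊹_ (Bool.∧-comm (f m) (δ₂ _≟ᴸ_ r m))
          (trans (sym (Σ₂-∧ˡ (f m) (below w L)))
            (Σ₂-cong (below w L) λ {b} _ → sym (Bool.∧-assoc (f m) (Λ m b) (A b r)))))

      below⁺ : ∀ {b} → b ∈ L → proj₁ b ≡ down w → b ∈ below w L
      below⁺ b∈ eq = ∈-filter⁺ (λ c → up (proj₁ c) ≟ⱽ w) b∈ (trans (cong up eq) (up-down w))

      up-injective : ∀ {v} → up v ≡ w → v ≡ down w
      up-injective {v} eq = trans (sym (down-up v)) (cong down eq)

      split′ : ∀ {a b} → a ∈ a* ∷ L → b ∈ a* ∷ L → proj₁ a ≡ proj₁ b →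
               Σ₂ (labels (a* ∷ L)) (λ m → A′ a m ∧ Λ′ m b) ≡ δ₂ _≟ᶜ_ a b
      split′ {a} {b} (there a∈) (there b∈) eq = trans (sum-old (λ m → Λ′ m b) a∈)
        (trans (Σ₂-cong (labels L) λ {m} _ → cong (A a m ∧_) (Λ′-old m b∈)) (split a∈ b∈ eq))
      split′ {b = b} (here refl) (there b∈) eq = trans (sum-new (λ m → Λ′ m b))
        (trans (Σ₂-cong (labels L) λ {m} _ → cong (x m ∧_) (Λ′-old m b∈))
          (trans (x-Λ b∈ (trans (cong up (sym eq)) (up-down w))) (sym (δ₂-≢ _≟ᶜ_ (a*∉ b∈)))))
      split′ {a = a} (there a∈) (here refl) eq = begin
        Σ₂ (labels (a* ∷ L)) (λ m → A′ a m ∧ Λ′ m a*) ≡⟨ sum-old (λ m → Λ′ m a*) a∈ ⟩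
        Σ₂ (labels L) (λ m → A a m ∧ Λ′ m a*) ≡⟨ Σ₂-cong (labels L) (λ {m} _ → cong (A a m ∧_) (Λ′-new m)) ⟩
        Σ₂ (labels L) (λ m → A a m ∧ g m) ≡⟨ functional (A a) ⟩
        A a r ⊹ Σ₂ (below w L) (λ b → Σ₂ (labels L) (λ m → A a m ∧ Λ m b) ∧ A b r)
          ≡⟨ cong (A a r ⊹_) (Σ₂-cong (below w L) λ {b} b∈ → let b∈L , up≡ = ∈-filter⁻ (λ c → up (proj₁ c) ≟ⱽ w) b∈ in
               cong (_∧ A b r) (split a∈ b∈L (trans eq (sym (up-injective up≡))))) ⟩
        A a r ⊹ Σ₂ (below w L) (λ b → δ₂ _≟ᶜ_ a b ∧ A b r)
          ≡⟨ cong (A a r ⊹_) (Σ₂-δ _≟ᶜ_ a (below w L) (Unique.filter⁺ _ nodup) (below⁺ a∈ eq)) ⟩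
        A a r ⊹ A a r ≡⟨ Bool.xor-same (A a r) ⟩
        false ≡⟨ δ₂-≢ _≟ᶜ_ (a*∉ a∈ ∘ sym) ⟨
        δ₂ _≟ᶜ_ a a* ∎
        where open ≡-Reasoning
      split′ (here refl) (here refl) eq = begin
        Σ₂ (labels (a* ∷ L)) (λ m → A′ a* m ∧ Λ′ m a*) ≡⟨ sum-new (λ m → Λ′ m a*) ⟩
        Σ₂ (labels L) (λ m → x m ∧ Λ′ m a*) ≡⟨ Σ₂-cong (labels L) (λ {m} _ → cong (x m ∧_) (Λ′-new m)) ⟩
        Σ₂ (labels L) (λ m → x m ∧ g m) ≡⟨ functional x ⟩
        x r ⊹ Σ₂ (below w L) (λ b → Σ₂ (labels L) (λ m → x m ∧ Λ m b) ∧ A b r)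
          ≡⟨ cong₂ _⊹_ xr (Σ₂-zero (below w L) λ {b} b∈ → let b∈L , up≡ = ∈-filter⁻ (λ c → up (proj₁ c) ≟ⱽ w) b∈ in
               cong (_∧ A b r) (x-Λ b∈L up≡)) ⟩
        true ≡⟨ δ₂-refl _≟ᶜ_ a* ⟨
        δ₂ _≟ᶜ_ a* a* ∎
        where open ≡-Reasoning

      low-new : ht (down w) < ht v₀
      low-new = below-label r (x-supp r xr)
        where
        arith : ∀ k → k + 1ℤ - + 2 ≡ k - 1ℤ
        arith = solve-∀
        below-label : ∀ m → m ∈ labels L × Into w m → ht (down w) < ht v₀
        below-label (inj₁ _) (_ , refl) = i-2<i (ht v₀)
        below-label (inj₂ c) (c∈ , _ , htw) = ℤ.≤-<-trans
          (ℤ.≤-trans (ℤ.≤-reflexive (trans (cong (_- + 2) htw) (arith (ht (proj₁ c))))) (ℤ.<⇒≤ (i-1<i (ht (proj₁ c)))))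
          (low (∈-labels⁻ c∈))

      extended : Module (a* ∷ L)
      extended = record
        { nodup   = All.tabulate (λ c∈ → a*∉ c∈) ∷ nodup
        ; low      = λ { (here refl) → low-new ; (there c∈) → low c∈ }
        ; A        = A′
        ; Λ        = Λ′
        ; graded   = graded′
        ; relation = relation′
        ; split    = split′
        }

    Σ₂-pick : ∀ {X : Set} {f} (pre : List X) c post →
              Σ₂ (pre ++ c ∷ post) f ≡ f c ⊹ Σ₂ (pre ++ post) f
    Σ₂-pick []        c post = refl
    Σ₂-pick {f = f} (a ∷ pre) c post = trans (cong (f a ⊹_) (Σ₂-pick pre c post)) (swap (f a) (f c) _)
      where
      swap : ∀ a b c → a ⊹ (b ⊹ c) ≡ b ⊹ (a ⊹ c)
      swap false b c = refl
      swap true false c = refl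
      swap true true c = refl

    -- V is replaced at w by the kernel of a functional ξ vanishing on the image of A.
    module Shrink {L} (V : Module L) (w : I×̇ℤ) (x : Cell → Bool)
      (nonzero : ∃ λ c → c ∈ at w L ++ below w L × x c ≡ true)
      (kills : ∀ {m} → m ∈ labels L → Into w m →
        Σ₂ (at w L) (λ b → x b ∧ fromCell (Module.A V) m b) ⊹ Σ₂ (below w L) (λ b → x b ∧ Module.Λ V m b) ≡ false) where

      open Module V

      ξη : Label → Bool
      ξη m = Σ₂ (at w L) (λ b → x b ∧ fromCell A m b) ⊹ Σ₂ (below w L) (λ b → x b ∧ Λ m b)

      ∧-swap : ∀ a b c → a ∧ (b ∧ c) ≡ b ∧ (a ∧ c)
      ∧-swap false false c = refl
      ∧-swap false true  c = refl
      ∧-swap true  false c = refl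
      ∧-swap true  true  c = refl

      pull : ∀ (f : Label → Bool) (g : Label → Cell → Bool) M →
        Σ₂ (labels L) (λ m → f m ∧ Σ₂ M (λ b → x b ∧ g m b)) ≡
        Σ₂ M (λ b → x b ∧ Σ₂ (labels L) (λ m → f m ∧ g m b))
      pull f g M = begin
        Σ₂ (labels L) (λ m → f m ∧ Σ₂ M (λ b → x b ∧ g m b))
          ≡⟨ Σ₂-cong (labels L) (λ {m} _ → trans (sym (Σ₂-∧ˡ (f m) M)) (Σ₂-cong M λ {b} _ → ∧-swap (f m) (x b) (g m b))) ⟩
        Σ₂ (labels L) (λ m → Σ₂ M (λ b → x b ∧ (f m ∧ g m b)))
          ≡⟨ Σ₂-swap (labels L) M ⟩
        Σ₂ M (λ b → Σ₂ (labels L) (λ m → x b ∧ (f m ∧ g m b)))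
          ≡⟨ Σ₂-cong M (λ {b} _ → Σ₂-∧ˡ (x b) (labels L)) ⟩
        Σ₂ M (λ b → x b ∧ Σ₂ (labels L) (λ m → f m ∧ g m b)) ∎
        where open ≡-Reasoning

      -- The unknown `x` is a pair of functionals, ξ at `w` and η at `down w`, with ξ A + η Λ = 0.
      -- Precomposing with A leaves η alone, since A A = 0 and Λ A is the identity. So η = 0, and a
      -- nonzero `x` has ξ ≠ 0.
      η≡0 : ∀ {a} → a ∈ below w L → x a ≡ false
      η≡0 {a} a∈ = begin
        x a
          ≡⟨ Σ₂-δ _≟ᶜ_ {f = x} a (below w L) (Unique.filter⁺ _ nodup) a∈ ⟨
        Σ₂ (below w L) (λ b → δ₂ _≟ᶜ_ a b ∧ x b)
          ≡⟨ Σ₂-cong (below w L) (λ {b} b∈ → trans (Bool.∧-comm (δ₂ _≟ᶜ_ a b) (x b)) (cong (x b ∧_) (sym (split a∈L (proj₁ (∈-below L b∈))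
               (trans (sym (down-up (proj₁ a))) (trans (cong down (trans up≡ (sym (proj₂ (∈-below L b∈))))) (down-up (proj₁ b)))))))) ⟩
        Σ₂ (below w L) (λ b → x b ∧ Σ₂ (labels L) (λ m → A a m ∧ Λ m b))
          ≡⟨ cong (_⊹ S₂) (sym (Σ₂-zero (at w L) λ {b} b∈ → trans (cong (x b ∧_)
               (relation a∈L (proj₁ (∈-at L b∈)) (trans up≡ (sym (proj₂ (∈-at L b∈)))))) (Bool.∧-zeroʳ (x b)))) ⟩
        Σ₂ (at w L) (λ b → x b ∧ Σ₂ (labels L) (λ m → A a m ∧ fromCell A m b)) ⊹ S₂
          ≡⟨ cong₂ _⊹_ (sym (pull (A a) (fromCell A) (at w L))) (sym (pull (A a) Λ (below w L))) ⟩
        Σ₂ (labels L) (λ m → A a m ∧ Σ₂ (at w L) (λ b → x b ∧ fromCell A m b)) ⊹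
        Σ₂ (labels L) (λ m → A a m ∧ Σ₂ (below w L) (λ b → x b ∧ Λ m b))
          ≡⟨ Σ₂-⊹ (labels L) ⟨
        Σ₂ (labels L) (λ m → (A a m ∧ Σ₂ (at w L) (λ b → x b ∧ fromCell A m b)) ⊹
                             (A a m ∧ Σ₂ (below w L) (λ b → x b ∧ Λ m b)))
          ≡⟨ Σ₂-zero (labels L) (λ {m} m∈ → trans (sym (Bool.∧-distribˡ-xor (A a m) _ _)) (vanish m m∈)) ⟩
        false ∎
        where
        open ≡-Reasoning
        a∈L = proj₁ (∈-below L a∈)
        up≡ = proj₂ (∈-below L a∈)
        S₂ = Σ₂ (below w L) (λ b → x b ∧ Σ₂ (labels L) (λ m → A a m ∧ Λ m b))
        vanish : ∀ m → m ∈ labels L → A a m ∧ ξη m ≡ false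
        vanish m m∈ with A a m in eq
        ... | false = refl
        ... | true  = kills m∈ (subst (λ v → Into v m) up≡ (graded a m eq))

      pivot : ∃ λ r → r ∈ at w L × x r ≡ true
      pivot = let c , c∈ , xc = nonzero in c , not-below xc (∈-++⁻ (at w L) c∈) , xc
        where
        not-below : ∀ {c} → x c ≡ true → c ∈ at w L ⊎ c ∈ below w L → c ∈ at w L
        not-below xc (inj₁ c∈) = c∈
        not-below xc (inj₂ c∈) = contradiction (trans (sym (η≡0 c∈)) xc) λ ()

      r = proj₁ pivot
      r∈L = proj₁ (∈-at L (proj₁ (proj₂ pivot)))
      r-at = proj₂ (∈-at L (proj₁ (proj₂ pivot)))

      ξ : Cell → Bool
      ξ b = x b ∧ does (proj₁ b ≟ⱽ w)

      ξr : ξ r ≡ true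
      ξr = cong₂ _∧_ (proj₂ (proj₂ pivot)) (dec-true (proj₁ r ≟ⱽ w) r-at)

      ξ-at : ∀ {b} → ξ b ≡ true → proj₁ b ≡ w
      ξ-at {b} eq with x b | proj₁ b ≟ⱽ w
      ξ-at eq | true | yes p = p

      ξᴸ : Label → Bool
      ξᴸ (inj₁ _) = false
      ξᴸ (inj₂ b) = ξ b

      -- For cells one diagonal step below `w` this is `kills` with η = 0. From any other cell the
      -- grading allows no arrow to `w`.
      ξA : ∀ {a} → a ∈ L → Σ₂ L (λ m → A a (inj₂ m) ∧ ξ m) ≡ false
      ξA {a} a∈ with Into? w (inj₂ a)
      ... | no ¬into = Σ₂-zero L zero-term
        where
        zero-term : ∀ {m} → m ∈ L → A a (inj₂ m) ∧ ξ m ≡ false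
        zero-term {m} m∈ with A a (inj₂ m) in eqA | ξ m in eqξ
        ... | false | _     = refl
        ... | true  | false = refl
        ... | true  | true  = contradiction (reverse-diagonal (graded a (inj₂ m) eqA) (ξ-at {m} eqξ)) ¬into
          where
          arith : ∀ {h k} → h + + 2 ≡ k + 1ℤ → k ≡ h + 1ℤ
          arith {h} {k} eq = trans (e₁ k) (trans (cong (_- 1ℤ) (sym eq)) (e₂ h))
            where
            e₁ : ∀ k → k ≡ k + 1ℤ - 1ℤ
            e₁ = solve-∀
            e₂ : ∀ h → h + + 2 - 1ℤ ≡ h + 1ℤ
            e₂ = solve-∀
          reverse-diagonal : Diagonal (proj₁ m) (up (proj₁ a)) → proj₁ m ≡ w → Diagonal (proj₁ a) w
          reverse-diagonal (j∼i , eq) refl = ∼-sym j∼i , arith {ht (proj₁ a)} {ht (proj₁ m)} eq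
      ... | yes into = begin
        Σ₂ L (λ m → A a (inj₂ m) ∧ ξ m)
          ≡⟨ Σ₂-filter (λ c → proj₁ c ≟ⱽ w) L (λ {m} _ eq → ξ-at {m} (∧-true (A a (inj₂ m)) eq)) ⟨
        Σ₂ (at w L) (λ m → A a (inj₂ m) ∧ ξ m)
          ≡⟨ Σ₂-cong (at w L) (λ {m} m∈ → trans (cong (λ d → A a (inj₂ m) ∧ (x m ∧ d)) (dec-true (proj₁ m ≟ⱽ w) (proj₂ (∈-at L m∈))))
               (trans (cong (A a (inj₂ m) ∧_) (Bool.∧-identityʳ (x m))) (Bool.∧-comm (A a (inj₂ m)) (x m)))) ⟩
        Σ₂ (at w L) (λ m → x m ∧ A a (inj₂ m))
          ≡⟨ Bool.xor-identityʳ _ ⟨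
        Σ₂ (at w L) (λ m → x m ∧ A a (inj₂ m)) ⊹ false
          ≡⟨ cong (Σ₂ (at w L) (λ m → x m ∧ A a (inj₂ m)) ⊹_)
               (sym (Σ₂-zero (below w L) λ {b} b∈ → cong (_∧ Λ (inj₂ a) b) (η≡0 b∈))) ⟩
        ξη (inj₂ a)
          ≡⟨ kills (∈-labels⁺ a∈) into ⟩
        false ∎
        where
        open ≡-Reasoning
        ∧-true : ∀ a {b} → a ∧ b ≡ true → b ≡ true
        ∧-true true eq = eq

      module _ (pre post : List Cell) (L≡ : L ≡ pre ++ r ∷ post) where

        L′ : List Cell
        L′ = pre ++ post

        ⊆L : ∀ {c} → c ∈ L′ → c ∈ L
        ⊆L {c} c∈ with ∈-++⁻ pre c∈
        ... | inj₁ h = subst (c ∈_) (sym L≡) (∈-++⁺ˡ h)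
        ... | inj₂ h = subst (c ∈_) (sym L≡) (∈-++⁺ʳ pre (there h))

        nodup-parts : ∀ pre → Unique (pre ++ r ∷ post) → Unique (pre ++ post) × (∀ {c} → c ∈ pre ++ post → r ≢ c)
        nodup-parts []        (r∉ ∷ u) = u , All.lookup r∉
        nodup-parts (a ∷ pre) (a∉ ∷ u) with nodup-parts pre u
        ... | u′ , r∉ = All.tabulate (λ c∈ → All.lookup a∉ (weaken c∈)) ∷ u′ , λ where
            (here refl) eq → All.lookup a∉ (∈-insert pre) (sym eq)
            (there c∈)     → r∉ c∈
          where
          weaken : ∀ {c} → c ∈ pre ++ post → c ∈ pre ++ r ∷ post
          weaken c∈ with ∈-++⁻ pre c∈
          ... | inj₁ h = ∈-++⁺ˡ h
          ... | inj₂ h = ∈-++⁺ʳ pre (there h)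

        nodup′ = nodup-parts pre (subst Unique L≡ nodup)

        -- As ξ is 1 on `r`, the vectors a + ξ(a) r with a ≠ r form a basis of the kernel of ξ. Here
        -- A is applied to them; coordinates in this basis are the old ones with that of `r`
        -- dropped.
        A′ : Cell → Label → Bool
        A′ a m = A a m ⊹ (ξ a ∧ A r m)

        -- The values of the functional `h` on the basis vectors m + ξ(m) r of the kernel.
        transport : (Label → Bool) → Label → Bool
        transport h m = h m ⊹ (ξᴸ m ∧ h (inj₂ r))

        distribʳ : ∀ a b c d → (a ⊹ (b ∧ c)) ∧ d ≡ (a ∧ d) ⊹ (b ∧ (c ∧ d))
        distribʳ a false c d = trans (cong (_∧ d) (Bool.xor-identityʳ a)) (sym (Bool.xor-identityʳ (a ∧ d)))
        distribʳ a true  c d = Bool.∧-distribʳ-xor d a c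

        A′-sum : ∀ {X : Set} (M : List X) (ι : X → Label) a (h : X → Bool) →
                 Σ₂ M (λ m → A′ a (ι m) ∧ h m) ≡
                 Σ₂ M (λ m → A a (ι m) ∧ h m) ⊹ (ξ a ∧ Σ₂ M (λ m → A r (ι m) ∧ h m))
        A′-sum M ι a h = trans (Σ₂-cong M λ {m} _ → distribʳ (A a (ι m)) (ξ a) (A r (ι m)) (h m))
          (trans (Σ₂-⊹ M) (cong (Σ₂ M (λ m → A a (ι m) ∧ h m) ⊹_) (Σ₂-∧ˡ (ξ a) M)))

        ξA′ : ∀ {a} → a ∈ L → Σ₂ L′ (λ m → A′ a (inj₂ m) ∧ ξ m) ≡ A′ a (inj₂ r)
        ξA′ {a} a∈ = sym (cancel (A′ a (inj₂ r)) _ (begin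
          A′ a (inj₂ r) ⊹ Σ₂ L′ (λ m → A′ a (inj₂ m) ∧ ξ m)
            ≡⟨ cong (_⊹ Σ₂ L′ (λ m → A′ a (inj₂ m) ∧ ξ m)) (trans (sym (Bool.∧-identityʳ _)) (cong (A′ a (inj₂ r) ∧_) (sym ξr))) ⟩
          (A′ a (inj₂ r) ∧ ξ r) ⊹ Σ₂ L′ (λ m → A′ a (inj₂ m) ∧ ξ m)
            ≡⟨ Σ₂-pick pre r post ⟨
          Σ₂ (pre ++ r ∷ post) (λ m → A′ a (inj₂ m) ∧ ξ m)
            ≡⟨ cong (λ L → Σ₂ L (λ m → A′ a (inj₂ m) ∧ ξ m)) L≡ ⟨
          Σ₂ L (λ m → A′ a (inj₂ m) ∧ ξ m)
            ≡⟨ A′-sum L inj₂ a ξ ⟩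
          Σ₂ L (λ m → A a (inj₂ m) ∧ ξ m) ⊹ (ξ a ∧ Σ₂ L (λ m → A r (inj₂ m) ∧ ξ m))
            ≡⟨ cong₂ (λ s t → s ⊹ (ξ a ∧ t)) (ξA a∈) (ξA r∈L) ⟩
          ξ a ∧ false
            ≡⟨ Bool.∧-zeroʳ (ξ a) ⟩
          false ∎))
          where
          open ≡-Reasoning
          cancel : ∀ a b → a ⊹ b ≡ false → a ≡ b
          cancel false false _ = refl
          cancel true  true  _ = refl

        -- Evaluating `h` in the new coordinates agrees with evaluating it in the old ones on a +
        -- ξ(a) r. The coordinate dropped at `r` is recovered from the others by `ξA′`, because the
        -- image lies in the kernel of ξ.
        transport-sum : ∀ {a} (h : Label → Bool) → a ∈ L →
          Σ₂ (labels L′) (λ m → A′ a m ∧ transport h m) ≡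
          Σ₂ (labels L) (λ m → A a m ∧ h m) ⊹ (ξ a ∧ Σ₂ (labels L) (λ m → A r m ∧ h m))
        transport-sum {a} h a∈ = begin
          Σ₂ (labels L′) (λ m → A′ a m ∧ transport h m)
            ≡⟨ Σ₂-labels L′ ⟩
          Σ₂ (allFin n) (λ m → A′ a (inj₁ m) ∧ (h (inj₁ m) ⊹ false)) ⊹ Σ₂ L′ (λ m → A′ a (inj₂ m) ∧ transport h (inj₂ m))
            ≡⟨ cong₂ _⊹_ (Σ₂-cong (allFin n) λ {m} _ → cong (A′ a (inj₁ m) ∧_) (Bool.xor-identityʳ (h (inj₁ m)))) onCells ⟩
          Σ₂ (allFin n) (λ m → A′ a (inj₁ m) ∧ h (inj₁ m)) ⊹ Σ₂ L (λ m → A′ a (inj₂ m) ∧ h (inj₂ m))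
            ≡⟨ Σ₂-labels L ⟨
          Σ₂ (labels L) (λ m → A′ a m ∧ h m)
            ≡⟨ A′-sum (labels L) id a h ⟩
          Σ₂ (labels L) (λ m → A a m ∧ h m) ⊹ (ξ a ∧ Σ₂ (labels L) (λ m → A r m ∧ h m)) ∎
          where
          open ≡-Reasoning
          H = Σ₂ L′ (λ m → A′ a (inj₂ m) ∧ h (inj₂ m))
          onCells : Σ₂ L′ (λ m → A′ a (inj₂ m) ∧ transport h (inj₂ m)) ≡ Σ₂ L (λ m → A′ a (inj₂ m) ∧ h (inj₂ m))
          onCells = begin
            Σ₂ L′ (λ m → A′ a (inj₂ m) ∧ transport h (inj₂ m))
              ≡⟨ Σ₂-cong L′ (λ {m} _ → trans (Bool.∧-distribˡ-xor (A′ a (inj₂ m)) (h (inj₂ m)) _)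
                   (cong ((A′ a (inj₂ m) ∧ h (inj₂ m)) ⊹_) (sym (Bool.∧-assoc (A′ a (inj₂ m)) (ξ m) (h (inj₂ r)))))) ⟩
            Σ₂ L′ (λ m → (A′ a (inj₂ m) ∧ h (inj₂ m)) ⊹ ((A′ a (inj₂ m) ∧ ξ m) ∧ h (inj₂ r)))
              ≡⟨ Σ₂-⊹ L′ ⟩
            H ⊹ Σ₂ L′ (λ m → (A′ a (inj₂ m) ∧ ξ m) ∧ h (inj₂ r))
              ≡⟨ cong (H ⊹_) (trans (Σ₂-∧ʳ (h (inj₂ r)) L′) (cong (_∧ h (inj₂ r)) (ξA′ a∈))) ⟩
            H ⊹ (A′ a (inj₂ r) ∧ h (inj₂ r))
              ≡⟨ Bool.xor-comm H _ ⟩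
            (A′ a (inj₂ r) ∧ h (inj₂ r)) ⊹ H
              ≡⟨ Σ₂-pick pre r post ⟨
            Σ₂ (pre ++ r ∷ post) (λ m → A′ a (inj₂ m) ∧ h (inj₂ m))
              ≡⟨ cong (λ L → Σ₂ L (λ m → A′ a (inj₂ m) ∧ h (inj₂ m))) L≡ ⟨
            Σ₂ L (λ m → A′ a (inj₂ m) ∧ h (inj₂ m)) ∎

        fromCell-transport : ∀ m b → fromCell A′ m b ≡ transport (λ m → fromCell A m b) m
        fromCell-transport (inj₁ _) b = refl
        fromCell-transport (inj₂ c) b = refl

        only-at : ∀ a {z} → (proj₁ a ≡ w → z ≡ false) → ξ a ∧ z ≡ false
        only-at a h with ξ a in eq
        ... | false = refl
        ... | true  = h (ξ-at {a} eq)

        graded′ : ∀ a m → A′ a m ≡ true → Into (up (proj₁ a)) m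
        graded′ a m eq with A a m in eq₁
        ... | true  = graded a m eq₁
        ... | false with ξ a in eqξ | A r m in eq₂
        ...   | true | true = subst (λ v → Into (up v) m) (trans r-at (sym (ξ-at {a} eqξ))) (graded r m eq₂)

        shrunk : Module L′
        shrunk = record
          { nodup    = proj₁ nodup′
          ; low      = low ∘ ⊆L
          ; A        = A′
          ; Λ        = λ m b → transport (λ m → Λ m b) m
          ; graded   = graded′
          ; relation = λ {a} {b} a∈ b∈ eq → trans
              (Σ₂-cong (labels L′) λ {m} _ → cong (A′ a m ∧_) (fromCell-transport m b))
              (trans (transport-sum (λ m → fromCell A m b) (⊆L a∈))
                (cong₂ _⊹_ (relation (⊆L a∈) (⊆L b∈) eq) (only-at a λ a-at →
                  relation r∈L (⊆L b∈) (trans (cong up (trans r-at (sym a-at))) eq))))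
          ; split    = λ {a} {b} a∈ b∈ eq → trans (transport-sum (λ m → Λ m b) (⊆L a∈))
              (trans (cong₂ _⊹_ (split (⊆L a∈) (⊆L b∈) eq) (only-at a λ a-at →
                  trans (split r∈L (⊆L b∈) (trans r-at (trans (sym a-at) eq))) (δ₂-≢ _≟ᶜ_ (proj₂ nodup′ b∈))))
                (Bool.xor-identityʳ _))
          }

    -- The unknowns are the coordinates of a vector in the middle term of the complex; the equations
    -- say that its image at `w` and its retraction to `down w` vanish.
    extension : ∀ {L} → Module L → ∀ w → length (at w L) ℕ.+ length (below w L) ℕ.< length (above w L) →
             ∃ λ q → Module ((down w , q) ∷ L)
    extension {L} V w lt = Ext.q , Ext.extended
      where
      open Module V

      atRows belowRows : List (Label → Bool)
      atRows    = map (λ b m → fromCell A m b) (at w L)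
      belowRows = map (λ b m → Λ m b) (below w L)

      rows-length : length (atRows ++ belowRows) ≡ length (at w L) ℕ.+ length (below w L)
      rows-length = trans (List.length-++ atRows) (cong₂ ℕ._+_ (List.length-map _ (at w L)) (List.length-map _ (below w L)))

      solution = underdetermined _≟ᴸ_ (above w L) (Unique.filter⁺ (Into? w) (labels-nodup nodup)) (atRows ++ belowRows)
                   (subst (ℕ._< length (above w L)) (sym rows-length) lt)

      module _ (x : Label → Bool) (x-supp : ∀ m → x m ≡ true → m ∈ above w L) where

        on-labels : ∀ {f : Label → Bool} → Σ₂ (above w L) (λ m → x m ∧ f m) ≡ false → Σ₂ (labels L) (λ m → x m ∧ f m) ≡ false
        on-labels = trans (sym (Σ₂-filter (Into? w) (labels L) λ {m} _ eq → proj₂ (∈-filter⁻ (Into? w) {xs = labels L} (x-supp m (∧-true eq)))))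
          where
          ∧-true : ∀ {a b} → a ∧ b ≡ true → a ≡ true
          ∧-true {true} _ = refl

      module Ext where
        x = proj₁ solution
        r = proj₁ (proj₁ (proj₂ solution))
        xr = proj₂ (proj₂ (proj₁ (proj₂ solution)))
        x-supp = proj₁ (proj₂ (proj₂ solution))
        kills = All.++⁻ atRows (proj₂ (proj₂ (proj₂ solution)))
        open Extend V w x r xr
          (λ m eq → ∈-filter⁻ (Into? w) {xs = labels L} (x-supp m eq))
          (λ b∈ eq → on-labels x x-supp (All.lookup (All.map⁻ (proj₁ kills)) (∈-filter⁺ (λ c → proj₁ c ≟ⱽ w) b∈ eq)))
          (λ b∈ eq → on-labels x x-supp (All.lookup (All.map⁻ (proj₂ kills)) (∈-filter⁺ (λ c → up (proj₁ c) ≟ⱽ w) b∈ eq)))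
          public

    -- The transposed system: the unknowns are functionals on V at `w` and at `down w`, with one
    -- equation for each basis vector of the middle term.
    contraction : ∀ {L} → Module L → ∀ w → length (above w L) ℕ.< length (at w L) ℕ.+ length (below w L) →
             ∃ λ r → ∃₂ λ pre post → L ≡ pre ++ r ∷ post × proj₁ r ≡ w × Module (pre ++ post)
    contraction {L} V w lt = let pre , post , L≡ = ∈-∃++ Shr.r∈L in
      Shr.r , pre , post , L≡ , Shr.r-at , Shr.shrunk pre post L≡
      where
      open Module V

      cols : List Cell
      cols = at w L ++ below w L

      cols-nodup : Unique cols
      cols-nodup = Unique.++⁺ (Unique.filter⁺ _ nodup) (Unique.filter⁺ _ nodup) λ {c} (c∈ , c∈′) →
        ≢-down w (trans (cong down (sym (proj₂ (∈-below L c∈′))))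
          (trans (down-up (proj₁ c)) (proj₂ (∈-at L c∈))))

      entry : Label → Cell → Bool
      entry m b = if does (proj₁ b ≟ⱽ w) then fromCell A m b else Λ m b

      entry-at : ∀ m {b} → proj₁ b ≡ w → entry m b ≡ fromCell A m b
      entry-at m {b} eq rewrite dec-true (proj₁ b ≟ⱽ w) eq = refl

      entry-below : ∀ m {b} → up (proj₁ b) ≡ w → entry m b ≡ Λ m b
      entry-below m {b} eq rewrite dec-false (proj₁ b ≟ⱽ w)
        (λ eq′ → ≢-down w (trans (cong down (sym eq)) (trans (down-up (proj₁ b)) eq′))) = refl

      solution = underdetermined _≟ᶜ_ cols cols-nodup (map entry (above w L))
        (subst₂ ℕ._<_ (sym (List.length-map entry (above w L))) (sym (List.length-++ (at w L))) lt)

      by-parts : ∀ x m → Σ₂ cols (λ b → x b ∧ entry m b) ≡ false →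
        Σ₂ (at w L) (λ b → x b ∧ fromCell A m b) ⊹ Σ₂ (below w L) (λ b → x b ∧ Λ m b) ≡ false
      by-parts x m = trans (sym (trans (Σ₂-++ (at w L) (below w L)) (cong₂ _⊹_
          (Σ₂-cong (at w L) λ {b} b∈ → cong (x b ∧_) (entry-at m (proj₂ (∈-at L b∈))))
          (Σ₂-cong (below w L) λ {b} b∈ → cong (x b ∧_) (entry-below m (proj₂ (∈-below L b∈)))))))

      module Shr = Shrink V w (proj₁ solution) (proj₁ (proj₂ solution))
        (λ {m} m∈ into → by-parts (proj₁ solution) m
          (All.lookup (All.map⁻ (proj₂ (proj₂ (proj₂ solution)))) (∈-filter⁺ (Into? w) m∈ into)))

    abstract

      extend : ∀ {L} → Module L → ∀ w → length (at w L) ℕ.+ length (below w L) ℕ.< length (above w L) →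
               ∃ λ q → Module ((down w , q) ∷ L)
      extend = extension

      shrink : ∀ {L} → Module L → ∀ w → length (above w L) ℕ.< length (at w L) ℕ.+ length (below w L) →
               ∃ λ r → ∃₂ λ pre post → L ≡ pre ++ r ∷ post × proj₁ r ≡ w × Module (pre ++ post)
      shrink = contraction

    zeroModule : Module []
    zeroModule = record
      { nodup = [] ; low = λ () ; A = λ _ _ → false ; Λ = λ _ _ → false
      ; graded = λ _ _ () ; relation = λ () ; split = λ () }

-- Crystal operators

module CrystalOperators (𝒮 : Setting) where

  open Setting 𝒮
  open Crystal 𝒮
  open Monomials 𝒮
  open Modules 𝒮 using (∼-sym)

  parity-suc-≢ : ∀ n → ℕ.parity n ≢ ℕ.parity (suc n)
  parity-suc-≢ (suc (suc n)) eq = parity-suc-≢ n eq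

  parityℤ-+1-≢ : ∀ k → parityℤ k ≢ parityℤ (k + 1ℤ)
  parityℤ-+1-≢ (+ n) eq = parity-suc-≢ n (trans eq (cong ℕ.parity (ℕ.+-comm n 1)))
  parityℤ-+1-≢ -[1+ zero ]  ()
  parityℤ-+1-≢ -[1+ suc n ] eq = parity-suc-≢ n eq

  <⇒+1≤ : ∀ {a b} → a < b → a + 1ℤ ≤ b
  <⇒+1≤ {a} lt = ℤ.≤-trans (ℤ.≤-reflexive (ℤ.+-comm a 1ℤ)) (ℤ.i<j⇒suc[i]≤j lt)

  +1≤⇒< : ∀ {a b} → a + 1ℤ ≤ b → a < b
  +1≤⇒< {a} le = ℤ.suc[i]≤j⇒i<j (ℤ.≤-trans (ℤ.≤-reflexive (ℤ.+-comm 1ℤ a)) le)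

  <⇒≤-1 : ∀ {a b} → a < b → a ≤ b - 1ℤ
  <⇒≤-1 {a} {b} lt = ℤ.≤-trans (ℤ.≤-reflexive (arith a)) (ℤ.+-monoˡ-≤ -1ℤ (<⇒+1≤ lt))
    where
    arith : ∀ a → a ≡ a + 1ℤ - 1ℤ
    arith = solve-∀

  same-height-parity : ∀ {i} (k l : Height i) → height l ≢ height k + 1ℤ
  same-height-parity (mkHeight k p) (mkHeight .(k + 1ℤ) q) refl =
    ⊥-elim-irr (parityℤ-+1-≢ k (trans p (sym q)))

  -- Heights in one column have the same parity, so distinct ones differ by at least 2.
  gap : ∀ {i} (k l : Height i) → height k < height l → (k ↑²) ≤ᴴ l
  gap k l k<l = ℤ.≤-trans (ℤ.≤-reflexive (sym (ℤ.+-assoc (height k) 1ℤ 1ℤ)))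
    (<⇒+1≤ (ℤ.≤∧≢⇒< (<⇒+1≤ k<l) (same-height-parity k l ∘ sym)))

  ↑²-> : ∀ {i} (k : Height i) → height k < height (k ↑²)
  ↑²-> k = subst (_< height (k ↑²)) (ℤ.+-identityʳ _) (ℤ.+-monoʳ-< (height k) (ℤ.+<+ {0} {2} (s≤s z≤n)))

  ↓²-< : ∀ {i} (k : Height i) → height (k ↓²) < height k
  ↓²-< k = i-2<i (height k)

  ≤-↑² : ∀ {i} {k l : Height i} → k ≤ᴴ l → (k ↑²) ≤ᴴ (l ↑²)
  ≤-↑² = ℤ.+-monoˡ-≤ (+ 2)

  ≤-↓² : ∀ {i} {k l : Height i} → k ≤ᴴ l → (k ↓²) ≤ᴴ (l ↓²)
  ≤-↓² = ℤ.+-monoˡ-≤ (- + 2)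

  -- `IsMaximum` asks for a height at which the maximum is attained, also in a column where the
  -- monomial has no factor.
  someHeight : ∀ i → Height i
  someHeight i with colour i in eq
  ... | 0ℙ = mkHeight 0ℤ (sym eq)
  ... | 1ℙ = mkHeight 1ℤ (sym eq)

  columnHeights : ∀ i → FormalSum I×̇ℤ → List (Height i)
  columnHeights i [] = []
  columnHeights i ((_ , (j , l)) ∷ f) with j Fin.≟ i
  ... | yes refl = l ∷ columnHeights i f
  ... | no  _    = columnHeights i f

  ∈-columnHeights : ∀ {i a l} f → (a , (i , l)) ∈ f → l ∈ columnHeights i f
  ∈-columnHeights {i} ((_ , (j , l)) ∷ f) (here refl) with i Fin.≟ i
  ... | yes refl = here refl
  ... | no neq   = contradiction refl neq
  ∈-columnHeights {i} ((_ , (j , l)) ∷ f) (there h∈) with j Fin.≟ i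
  ... | yes refl = there (∈-columnHeights f h∈)
  ... | no  _    = ∈-columnHeights f h∈

  -- ⊑ is ≤ for φ and ≥ for ε, and g the signed partial sum over the heights ⊑-above.
  module Extremum {i : I} (_⊑_ : ℤ → ℤ → Set) (_⊑?_ : ∀ a b → Dec (a ⊑ b))
    (⊑-total : ∀ a b → a ⊑ b ⊎ b ⊑ a) (⊑-trans : ∀ {a b c} → a ⊑ b → b ⊑ c → a ⊑ c)
    (far : (hs : List (Height i)) → ∃ λ (k : Height i) → ∀ {h : Height i} → h ∈ hs → ¬ height k ⊑ height h)
    (f : FormalSum I×̇ℤ) (σ : ℤ → ℤ) (σ0 : σ 0ℤ ≡ 0ℤ) where

    R : Height i → Height i → Set
    R k l = height k ⊑ height l

    R? : ∀ k l → Dec (R k l)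
    R? k l = height k ⊑? height l

    R-total : ∀ k l → R k l ⊎ R l k
    R-total k l = ⊑-total (height k) (height l)

    R?′ : ∀ (k : Height i) → Decidable {A = I×̇ℤ} (λ x → proj₁ x ≡ i × height k ⊑ ht x)
    R?′ k x = (proj₁ x Fin.≟ i) ×-dec (height k ⊑? ht x)

    G g : Height i → ℤ
    G k = sumWhere (R?′ k) f
    g = σ ∘ G

    hs : List (Height i)
    hs = columnHeights i f

    R-refl : ∀ k → R k k
    R-refl k = [ id , id ]′ (R-total k k)

    nearest : ∀ k (L : List (Height i)) →
      (∀ {h} → h ∈ L → ¬ R k h) ⊎ (∃ λ h → h ∈ L × R k h × (∀ {h′} → h′ ∈ L → R k h′ → R h h′))
    nearest k [] = inj₁ λ ()
    nearest k (h ∷ L) with nearest k L | R? k h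
    ... | inj₁ none | no ¬r = inj₁ λ { (here refl) → ¬r ; (there h∈) → none h∈ }
    ... | inj₁ none | yes r = inj₂ (h , here refl , r , λ { (here refl) _ → R-refl h ; (there h∈) r′ → contradiction r′ (none h∈) })
    ... | inj₂ (h₁ , h₁∈ , r₁ , least) | no ¬r = inj₂ (h₁ , there h₁∈ , r₁ ,
            λ { (here refl) r → contradiction r ¬r ; (there h∈) → least h∈ })
    ... | inj₂ (h₁ , h₁∈ , r₁ , least) | yes r with R-total h h₁
    ...   | inj₁ hh₁ = inj₂ (h , here refl , r , λ { (here refl) _ → R-refl h ; (there h∈) r′ → ⊑-trans hh₁ (least h∈ r′) })
    ...   | inj₂ h₁h = inj₂ (h₁ , there h₁∈ , r₁ , λ { (here refl) _ → h₁h ; (there h∈) → least h∈ })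

    -- A partial sum changes only at heights that occur in the formal sum, so finitely many heights,
    -- together with the value 0 far out, account for all its values.
    values : ∀ k → g k ≡ 0ℤ ⊎ (∃ λ h → h ∈ hs × R k h × g k ≡ g h)
    values k with nearest k hs
    ... | inj₁ none = inj₁ (trans (cong σ (sumWhere-none (R?′ k) f λ { x∈ (refl , r) → none (∈-columnHeights {i} f x∈) r })) σ0)
    ... | inj₂ (h , h∈ , r , least) = inj₂ (h , h∈ , r , cong σ (sumWhere-ext (R?′ k) (R?′ h) f λ {a} {x} x∈ →
            []-iff (R?′ k x) (R?′ h x)
              (λ { (refl , r′) → refl , least (∈-columnHeights {i} f x∈) r′ })
              (λ { (refl , r′) → refl , ⊑-trans r r′ })))

    maximal : ∀ L → ∃ λ m → (m ≡ 0ℤ ⊎ (∃ λ h → h ∈ L × g h ≡ m)) × 0ℤ ≤ m × (∀ {h} → h ∈ L → g h ≤ m)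
    maximal [] = 0ℤ , inj₁ refl , ℤ.≤-refl , λ ()
    maximal (h ∷ L) with maximal L
    ... | m , attained , m≥0 , bound with ℤ.≤-total (g h) m
    ...   | inj₁ le = m , weaken attained , m≥0 , λ { (here refl) → le ; (there h∈) → bound h∈ }
            where
            weaken : m ≡ 0ℤ ⊎ (∃ λ h → h ∈ L × g h ≡ m) → m ≡ 0ℤ ⊎ (∃ λ h′ → h′ ∈ h ∷ L × g h′ ≡ m)
            weaken (inj₁ eq) = inj₁ eq
            weaken (inj₂ (h′ , h∈ , eq)) = inj₂ (h′ , there h∈ , eq)
    ...   | inj₂ ge = g h , inj₂ (h , here refl , refl) , ℤ.≤-trans m≥0 ge ,
            λ { (here refl) → ℤ.≤-refl ; (there h∈) → ℤ.≤-trans (bound h∈) ge }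

    furthest : ∀ m L → (∃ λ h → h ∈ L × g h ≡ m) → ∃ λ F → F ∈ L × g F ≡ m × (∀ {h} → h ∈ L → g h ≡ m → R h F)
    furthest m (h ∷ L) (h₀ , h₀∈ , eq₀) with any? (λ h → g h ℤ.≟ m) L
    furthest m (h ∷ L) (.h , here refl , eq₀) | no none =
      h , here refl , eq₀ , λ { (here refl) _ → R-refl h ; (there h∈) eq → contradiction (lose h∈ eq) none }
    furthest m (h ∷ L) (h₀ , there h₀∈ , eq₀) | no none = contradiction (lose h₀∈ eq₀) none
    ... | yes some with furthest m L (find some) | g h ℤ.≟ m
    ...   | F , F∈ , eq , far′ | no neq = F , there F∈ , eq , λ { (here refl) eq → contradiction eq neq ; (there h∈) → far′ h∈ }
    ...   | F , F∈ , eq , far′ | yes eqh with R-total h F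
    ...     | inj₁ hF = F , there F∈ , eq , λ { (here refl) _ → hF ; (there h∈) → far′ h∈ }
    ...     | inj₂ Fh = h , here refl , eqh , λ { (here refl) _ → R-refl h ; (there h∈) eq → ⊑-trans (far′ h∈ eq) Fh }

    -- The value 0 is taken at all heights far enough out. Hence the maximum is never negative, and
    -- if it is 0 there is no furthest place where it is attained, whence the condition on `m`.
    extremum : ∃ λ m → IsMaximum g m × 0ℤ ≤ m ×
               (m ≢ 0ℤ → ∃ λ F → g F ≡ m × (∀ k → g k ≡ m → R k F))
    extremum with maximal hs
    ... | m , attained , m≥0 , bound = m , (attained′ attained , bound′) , m≥0 , largest attained
      where
      attained′ : m ≡ 0ℤ ⊎ (∃ λ h → h ∈ hs × g h ≡ m) → ∃ λ k → g k ≡ m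
      attained′ (inj₁ refl) = let k , out = far hs in k ,
        trans (cong σ (sumWhere-none (R?′ k) f λ { x∈ (refl , r) → out (∈-columnHeights {i} f x∈) r })) σ0
      attained′ (inj₂ (h , _ , eq)) = h , eq
      bound′ : ∀ k → g k ≤ m
      bound′ k with values k
      ... | inj₁ eq = ℤ.≤-trans (ℤ.≤-reflexive eq) m≥0
      ... | inj₂ (h , h∈ , _ , eq) = ℤ.≤-trans (ℤ.≤-reflexive eq) (bound h∈)
      largest : m ≡ 0ℤ ⊎ (∃ λ h → h ∈ hs × g h ≡ m) → m ≢ 0ℤ → ∃ λ F → g F ≡ m × (∀ k → g k ≡ m → R k F)
      largest (inj₁ eq) m≢0 = contradiction eq m≢0
      largest (inj₂ some) m≢0 with furthest m hs some
      ... | F , _ , eqF , far′ = F , eqF , λ k eqk → case values k of λ where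
              (inj₁ eq0) → contradiction (trans (sym eqk) eq0) m≢0
              (inj₂ (h , h∈ , r , eq)) → ⊑-trans r (far′ h∈ (trans (sym eq) eqk))

  far-above : ∀ {i} (hs : List (Height i)) → ∃ λ k → ∀ {h} → h ∈ hs → ¬ k ≤ᴴ h
  far-above {i} [] = someHeight i , λ ()
  far-above (h ∷ hs) with far-above hs
  ... | k , out with height k ℤ.≤? height h
  ...   | no ¬le = k , λ { (here refl) → ¬le ; (there h∈) → out h∈ }
  ...   | yes le = h ↑² , λ { (here refl) le′ → ℤ.<⇒≱ (↑²-> h) le′
                            ; (there h∈) le′ → out h∈ (ℤ.≤-trans le (ℤ.≤-trans (ℤ.<⇒≤ (↑²-> h)) le′)) }

  far-below : ∀ {i} (hs : List (Height i)) → ∃ λ k → ∀ {h} → h ∈ hs → ¬ h ≤ᴴ k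
  far-below {i} [] = someHeight i , λ ()
  far-below (h ∷ hs) with far-below hs
  ... | k , out with height h ℤ.≤? height k
  ...   | no ¬le = k , λ { (here refl) → ¬le ; (there h∈) → out h∈ }
  ...   | yes le = h ↓² , λ { (here refl) le′ → ℤ.<⇒≱ (↓²-< h) le′
                            ; (there h∈) le′ → out h∈ (ℤ.≤-trans le′ (ℤ.≤-trans (ℤ.<⇒≤ (↓²-< h)) le)) }

  total : I → Monomial → ℤ
  total i p = ⟨ α∨ i , wt p ⟩

  φ-cong : ∀ i {p q} → p ≋ q → ∀ k → φ i p k ≡ φ i q k
  φ-cong i {p} {q} (wrap (_ , eq)) k = sumWhere-cong _≟ⱽ_ _ (factors p) (factors q) eq

  total-cong : ∀ i {p q} → p ≋ q → total i p ≡ total i q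
  total-cong i (wrap (eq , _)) = cong ⟨ α∨ i ,_⟩ eq

  φ-step : ∀ i p k → φ i p k ≡ p ⟦ i , k ⟧ + φ i p (k ↑²)
  φ-step i p k = sumWhere-split _ (_≟ⱽ (i , k)) _ entry (factors p)
    where
    entry : ∀ (x : I×̇ℤ) a →
      [ (proj₁ x Fin.≟ i) ×-dec (height k ℤ.≤? ht x) ] a ≡
      [ x ≟ⱽ (i , k) ] a + [ (proj₁ x Fin.≟ i) ×-dec (height (k ↑²) ℤ.≤? ht x) ] a
    entry x a = split (x ≟ⱽ (i , k)) x
      where
      split : ∀ {x} (d : Dec (x ≡ (i , k))) y → {{x ≡ y}} →
        [ (proj₁ x Fin.≟ i) ×-dec (height k ℤ.≤? ht x) ] a ≡
        [ d ] a + [ (proj₁ x Fin.≟ i) ×-dec (height (k ↑²) ℤ.≤? ht x) ] a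
      split (yes refl) _ = trans ([yes] ((i Fin.≟ i) ×-dec (height k ℤ.≤? height k)) (refl , ℤ.≤-refl))
        (sym (trans (cong (λ n → a + n) ([no] ((i Fin.≟ i) ×-dec (height (k ↑²) ℤ.≤? height k)) λ (_ , le) → ℤ.<⇒≱ (↑²-> k) le)) (ℤ.+-identityʳ a)))
      split {j , l} (no neq) _ = trans ([]-iff ((j Fin.≟ i) ×-dec (height k ℤ.≤? height l)) ((j Fin.≟ i) ×-dec (height (k ↑²) ℤ.≤? height l))
        (λ { (refl , le) → refl , gap k l (ℤ.≤∧≢⇒< le λ eq → neq (vertex-≡ refl (sym eq))) })
        (λ (eq , le) → eq , ℤ.≤-trans (ℤ.<⇒≤ (↑²-> k)) le)) (sym (ℤ.+-identityˡ _))

  -- Heights up to k and from k + 2 on exhaust the column, whose exponents add up to the pairing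
  -- with the weight by `balanced`. Questions about ε are reduced to φ through this.
  ε-φ : ∀ i p k → ε i p k ≡ φ i p (k ↑²) - total i p
  ε-φ i p k = trans (arith s₁ t) (cong (λ n → φ i p (k ↑²) - n) (sym (trans (balanced p i) (sumWhere-split _ _ _ entry (factors p)))))
    where
    s₁ = sumWhere (λ (j , l) → (j Fin.≟ i) ×-dec (height l ℤ.≤? height k)) (factors p)
    t = φ i p (k ↑²)
    arith : ∀ s t → - s ≡ t - (s + t)
    arith = solve-∀
    entry : ∀ (x : I×̇ℤ) a → [ atNode? i x ] a ≡
      [ (proj₁ x Fin.≟ i) ×-dec (ht x ℤ.≤? height k) ] a + [ (proj₁ x Fin.≟ i) ×-dec (height (k ↑²) ℤ.≤? ht x) ] a
    entry (j , l) a = split (j Fin.≟ i) (height l ℤ.≤? height k) (height (k ↑²) ℤ.≤? height l)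
      where
      split : (d : Dec (j ≡ i)) (d₁ : Dec (height l ≤ height k)) (d₂ : Dec (height (k ↑²) ≤ height l)) →
        [ d ] a ≡ [ d ×-dec d₁ ] a + [ d ×-dec d₂ ] a
      split (no _)     d₁         d₂         = refl
      split (yes refl) (yes le)   (yes le′)  = contradiction (ℤ.≤-trans le′ le) (ℤ.<⇒≱ (↑²-> k))
      split (yes refl) (yes _)    (no _)     = sym (ℤ.+-identityʳ a)
      split (yes refl) (no _)     (yes _)    = sym (ℤ.+-identityˡ a)
      split (yes refl) (no l≰k)   (no ¬le)   = contradiction (gap k l (ℤ.≰⇒> l≰k)) ¬le

  φ-· : ∀ i p q k → φ i (p · q) k ≡ φ i p k + φ i q k
  φ-· i p q k = sumWhere-++ _ (factors p) (factors q)

  φ-⁻¹ : ∀ i p k → φ i (p ⁻¹) k ≡ - φ i p k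
  φ-⁻¹ i p k = trans (sumWhere-scale _ -1ℤ (factors p)) (ℤ.-1*i≡-i _)

  φ-z : ∀ i h k → φ i (z (i , h)) k ≡ [ height k ℤ.≤? height h ] 1ℤ + [ height k ℤ.≤? height (h ↑²) ] 1ℤ
  φ-z i h k = cong₂ _+_ (simplify h) (trans (cong₂ _+_ (simplify (h ↑²))
    (sumWhere-none _ (concatMap (neighbour h) (allFin #simple)) λ x∈ (eq , _) → off x∈ eq)) (ℤ.+-identityʳ _))
    where
    simplify : ∀ l → [ (i Fin.≟ i) ×-dec (height k ℤ.≤? height l) ] 1ℤ ≡ [ height k ℤ.≤? height l ] 1ℤ
    simplify l = []-iff ((i Fin.≟ i) ×-dec (height k ℤ.≤? height l)) (height k ℤ.≤? height l) proj₂ (refl ,_)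
    off : ∀ {a x} → (a , x) ∈ concatMap (neighbour h) (allFin #simple) → ¬ proj₁ x ≡ i
    off x∈ refl with find (∈-concatMap⁻ (neighbour h) {xs = allFin #simple} x∈)
    ... | j , _ , x∈′ with j ∼? i
    off x∈ refl | j , _ , here refl | yes j∼i = ∼-irrefl j∼i

  total-· : ∀ i p q → total i (p · q) ≡ total i p + total i q
  total-· i p q = trans (balanced (p · q) i) (trans (sumWhere-++ _ (factors p) (factors q))
    (sym (cong₂ _+_ (balanced p i) (balanced q i))))

  total-⁻¹ : ∀ i p → total i (p ⁻¹) ≡ - total i p
  total-⁻¹ i p = trans (balanced (p ⁻¹) i) (trans (trans (sumWhere-scale _ -1ℤ (factors p)) (ℤ.-1*i≡-i _))
    (sym (cong -_ (balanced p i))))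

  total-z : ∀ i h → total i (z (i , h)) ≡ + 2
  total-z i h = pairing-two (simple i)

  IsMaximum-unique : ∀ {i} {g : Height i → ℤ} {m m′} → IsMaximum g m → IsMaximum g m′ → m ≡ m′
  IsMaximum-unique ((k , refl) , bound) ((k′ , refl) , bound′) = ℤ.≤-antisym (bound′ k) (bound k′)

  φ-extremum : ∀ i p → ∃ λ m → IsMaximum (φ i p) m × 0ℤ ≤ m ×
               (m ≢ 0ℤ → ∃ λ F → φ i p F ≡ m × (∀ k → φ i p k ≡ m → k ≤ᴴ F))
  φ-extremum i p = Extremum.extremum _≤_ ℤ._≤?_ ℤ.≤-total ℤ.≤-trans far-above (factors p) id refl

  ε-extremum : ∀ i p → ∃ λ m → IsMaximum (ε i p) m × 0ℤ ≤ m ×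
               (m ≢ 0ℤ → ∃ λ E → ε i p E ≡ m × (∀ k → ε i p k ≡ m → E ≤ᴴ k))
  ε-extremum i p = Extremum.extremum (flip _≤_) (flip ℤ._≤?_) (flip ℤ.≤-total) (flip ℤ.≤-trans) far-below (factors p) -_ refl

  φ-quotient : ∀ i p h k → φ i (p · z (i , h) ⁻¹) k ≡
    φ i p k - ([ height k ℤ.≤? height h ] 1ℤ + [ height k ℤ.≤? height (h ↑²) ] 1ℤ)
  φ-quotient i p h k = trans (φ-· i p (z (i , h) ⁻¹) k) (cong (λ n → φ i p k + n)
    (trans (φ-⁻¹ i (z (i , h)) k) (cong -_ (φ-z i h k))))

  φ-product : ∀ i p h k → φ i (p · z (i , h)) k ≡
    φ i p k + ([ height k ℤ.≤? height h ] 1ℤ + [ height k ℤ.≤? height (h ↑²) ] 1ℤ)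
  φ-product i p h k = trans (φ-· i p (z (i , h)) k) (cong (λ n → φ i p k + n) (φ-z i h k))

  total-quotient : ∀ i p h → total i (p · z (i , h) ⁻¹) ≡ total i p - + 2
  total-quotient i p h = trans (total-· i p (z (i , h) ⁻¹)) (cong (λ n → total i p + n)
    (trans (total-⁻¹ i (z (i , h))) (cong -_ (total-z i h))))

  φ̂ ε̂ : I → Monomial → ℤ
  φ̂ i p = proj₁ (φ-extremum i p)
  ε̂ i p = proj₁ (ε-extremum i p)

  φ̂-max : ∀ i p → IsMaximum (φ i p) (φ̂ i p)
  φ̂-max i p = proj₁ (proj₂ (φ-extremum i p))

  ε̂-max : ∀ i p → IsMaximum (ε i p) (ε̂ i p)
  ε̂-max i p = proj₁ (proj₂ (ε-extremum i p))

  φ̂≥0 : ∀ i p → 0ℤ ≤ φ̂ i p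
  φ̂≥0 i p = proj₁ (proj₂ (proj₂ (φ-extremum i p)))

  ε̂≥0 : ∀ i p → 0ℤ ≤ ε̂ i p
  ε̂≥0 i p = proj₁ (proj₂ (proj₂ (ε-extremum i p)))

  -- By `ε-φ`, after a shift of heights the two families of partial sums differ by a constant, so
  -- their maxima do too.
  ε̂-φ̂ : ∀ i p → ε̂ i p ≡ φ̂ i p - total i p
  ε̂-φ̂ i p = IsMaximum-unique (ε̂-max i p) ((proj₁ k ↓² , attained) , bound)
    where
    k = proj₁ (φ̂-max i p)
    attained : ε i p (proj₁ k ↓²) ≡ φ̂ i p - total i p
    attained = trans (ε-φ i p (proj₁ k ↓²)) (cong (_- total i p) (trans (cong (φ i p) (↑²↓² (proj₁ k))) (proj₂ k)))
    bound : ∀ k → ε i p k ≤ φ̂ i p - total i p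
    bound k = ℤ.≤-trans (ℤ.≤-reflexive (ε-φ i p k)) (ℤ.+-monoˡ-≤ _ (proj₂ (φ̂-max i p) (k ↑²)))

  φ̂-cong : ∀ i {p q} → p ≋ q → φ̂ i p ≡ φ̂ i q
  φ̂-cong i {p} {q} eq = IsMaximum-unique (φ̂-max i p) (let (k , eqk) , bound = φ̂-max i q in
    (k , trans (φ-cong i eq k) eqk) , λ k → ℤ.≤-trans (ℤ.≤-reflexive (φ-cong i eq k)) (bound k))

  ε̂-cong : ∀ i {p q} → p ≋ q → ε̂ i p ≡ ε̂ i q
  ε̂-cong i {p} {q} eq = trans (ε̂-φ̂ i p) (trans (cong₂ _-_ (φ̂-cong i eq) (total-cong i eq)) (sym (ε̂-φ̂ i q)))

  f-defined : ∀ i p → φ̂ i p ≢ 0ℤ → ∃ λ q → f[ i ] p ↦ q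
  f-defined i p m≢0 = let F , eqF , far = proj₂ (proj₂ (proj₂ (φ-extremum i p))) m≢0 in
    p · z (i , F ↓²) ⁻¹ , φ̂ i p , F , φ̂-max i p , m≢0 , eqF , far , unwrap (≋-refl {p · z (i , F ↓²) ⁻¹})

  e-defined : ∀ i p → ε̂ i p ≢ 0ℤ → ∃ λ q → e[ i ] p ↦ q
  e-defined i p m≢0 = let E , eqE , far = proj₂ (proj₂ (proj₂ (ε-extremum i p))) m≢0 in
    p · z (i , E) , ε̂ i p , E , ε̂-max i p , m≢0 , eqE , far , unwrap (≋-refl {p · z (i , E)})

  -- Beyond the largest maximiser F the partial sum drops strictly, and the drop from F to F + 2 is
  -- the exponent at F.
  f-positive : ∀ {i p q} ((m , F , _) : f[ i ] p ↦ q) → 0ℤ < p ⟦ i , F ⟧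
  f-positive {i} {p} (m , F , (_ , bound) , _ , eqF , far , _) = ℤ.≰⇒> λ le →
    ℤ.<⇒≱ (↑²-> F) (far (F ↑²) (ℤ.≤-antisym (bound (F ↑²)) (ℤ.≤-trans (ℤ.≤-reflexive (sym eqF))
      (ℤ.≤-trans (ℤ.≤-reflexive (φ-step i p F)) (ℤ.≤-trans (ℤ.+-monoˡ-≤ _ le) (ℤ.≤-reflexive (ℤ.+-identityˡ _)))))))

  e-negative : ∀ {i p q} ((m , E , _) : e[ i ] p ↦ q) → p ⟦ i , E ⟧ < 0ℤ
  e-negative {i} {p} (m , E , (_ , bound) , _ , eqE , far , _) = ℤ.≰⇒> λ le →
    ℤ.<⇒≱ (↓²-< E) (far (E ↓²) (ℤ.≤-antisym (bound (E ↓²)) (ℤ.≤-trans (ℤ.≤-reflexive (sym eqE))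
      (subst₂ _≤_ (sym (ε-φ i p E)) (sym (trans (ε-φ i p (E ↓²)) (cong (λ k → φ i p k - total i p) (↑²↓² E))))
        (ℤ.+-monoˡ-≤ (- total i p) (ℤ.≤-trans (ℤ.≤-reflexive (sym (ℤ.+-identityˡ (φ i p (E ↑²)))))
          (ℤ.≤-trans (ℤ.+-monoˡ-≤ (φ i p (E ↑²)) le) (ℤ.≤-reflexive (sym (φ-step i p E))))))))))

  f-unique : ∀ {i p p′ q q′} → p ≋ p′ → f[ i ] p ↦ q → f[ i ] p′ ↦ q′ → q ≋ q′
  f-unique {i} {p} {p′} p≈p′ (m , F , max , _ , eqF , far , q≈) (m′ , F′ , max′ , _ , eqF′ , far′ , q≈′) =
    ≋-trans (wrap q≈) (≋-trans (subst (λ F → p · z (i , F ↓²) ⁻¹ ≋ p′ · z (i , F′ ↓²) ⁻¹) (sym F≡) (·-cong p≈p′ ≋-refl)) (≋-sym (wrap q≈′)))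
    where
    m≡ : m ≡ m′
    m≡ = IsMaximum-unique max (let (k , eq) , bound = max′ in
      (k , trans (φ-cong i p≈p′ k) eq) , λ k → ℤ.≤-trans (ℤ.≤-reflexive (φ-cong i p≈p′ k)) (bound k))
    F≡ : F ≡ F′
    F≡ = Height-≡ (ℤ.≤-antisym
      (far′ F (trans (sym (φ-cong i p≈p′ F)) (trans eqF m≡)))
      (far F′ (trans (φ-cong i p≈p′ F′) (trans eqF′ (sym m≡)))))

  e-unique : ∀ {i p p′ q q′} → p ≋ p′ → e[ i ] p ↦ q → e[ i ] p′ ↦ q′ → q ≋ q′
  e-unique {i} {p} {p′} p≈p′ (m , E , max , _ , eqE , far , q≈) (m′ , E′ , max′ , _ , eqE′ , far′ , q≈′) =
    ≋-trans (wrap q≈) (≋-trans (subst (λ E → p · z (i , E) ≋ p′ · z (i , E′)) (sym E≡) (·-cong p≈p′ ≋-refl)) (≋-sym (wrap q≈′)))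
    where
    ε-cong : ∀ k → ε i p k ≡ ε i p′ k
    ε-cong k = trans (ε-φ i p k) (trans (cong₂ _-_ (φ-cong i p≈p′ (k ↑²)) (total-cong i p≈p′)) (sym (ε-φ i p′ k)))
    m≡ : m ≡ m′
    m≡ = IsMaximum-unique max (let (k , eq) , bound = max′ in
      (k , trans (ε-cong k) eq) , λ k → ℤ.≤-trans (ℤ.≤-reflexive (ε-cong k)) (bound k))
    E≡ : E ≡ E′
    E≡ = Height-≡ (ℤ.≤-antisym
      (far E′ (trans (ε-cong E′) (trans eqE′ (sym m≡))))
      (far′ E (trans (sym (ε-cong E)) (trans eqE m≡))))

  -- At F the partial sum drops by 1, below F by 2, above F not at all.
  f-lowers : ∀ {i p q} → f[ i ] p ↦ q → φ̂ i q ≡ φ̂ i p - 1ℤ × e[ i ] q ↦ p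
  f-lowers {i} {p} {q} (m , F , max@(_ , bound) , m≢0 , eqF , far , q≈) = φ̂q≡ , ε̂ i q , F ↓² , ε̂-max i q , ε̂≢0 ,
    trans (ε-φ i q (F ↓²)) (trans (cong (λ k → φ i q k - total i q) (↑²↓² F)) (trans (cong (_- total i q) (trans φqF (sym φ̂q≡′))) (sym (ε̂-φ̂ i q)))) ,
    least , unwrap (≋-trans (≋-sym (⁻¹·-cancel p (z (i , F ↓²)))) (·-cong (≋-sym q≋) ≋-refl))
    where
    q≋ : q ≋ p · z (i , F ↓²) ⁻¹
    q≋ = wrap q≈

    φq : ∀ k → φ i q k ≡ φ i p k - ([ height k ℤ.≤? height (F ↓²) ] 1ℤ + [ height k ℤ.≤? height F ] 1ℤ)
    φq k = trans (φ-cong i q≋ k) (trans (φ-quotient i p (F ↓²) k)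
      (cong (λ l → φ i p k - ([ height k ℤ.≤? height (F ↓²) ] 1ℤ + [ height k ℤ.≤? height l ] 1ℤ)) (↑²↓² F)))

    φqF : φ i q F ≡ m - 1ℤ
    φqF = trans (φq F) (cong₂ _-_ eqF (cong₂ _+_
      ([no] (height F ℤ.≤? height (F ↓²)) (ℤ.<⇒≱ (↓²-< F))) ([yes] (height F ℤ.≤? height F) ℤ.≤-refl)))

    above-F : ∀ k → height F < height k → φ i q k ≤ m - 1ℤ
    above-F k F<k = ℤ.≤-trans (ℤ.≤-reflexive (trans (φq k) (trans (cong₂ (λ a b → φ i p k - (a + b))
        ([no] (height k ℤ.≤? height (F ↓²)) (λ le → ℤ.<⇒≱ F<k (ℤ.≤-trans le (ℤ.<⇒≤ (↓²-< F)))))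
        ([no] (height k ℤ.≤? height F) (ℤ.<⇒≱ F<k))) (ℤ.+-identityʳ _))))
      (<⇒≤-1 (ℤ.≤∧≢⇒< (bound k) λ eq → ℤ.<⇒≱ F<k (far k eq)))

    below-F : ∀ k → height k < height F → φ i q k < m - 1ℤ
    below-F k k<F = ℤ.≤-<-trans (ℤ.≤-reflexive (trans (φq k) (trans (cong₂ (λ a b → φ i p k - (a + b))
        ([yes] (height k ℤ.≤? height (F ↓²)) (subst (_≤ᴴ (F ↓²)) (↓²↑² k) (≤-↓² {k = k ↑²} {F} (gap k F k<F))))
        ([yes] (height k ℤ.≤? height F) (ℤ.<⇒≤ k<F))) (arith (φ i p k)))))
      (ℤ.≤-<-trans (ℤ.+-monoˡ-≤ -1ℤ (ℤ.+-monoˡ-≤ -1ℤ (bound k))) (i-1<i (m - 1ℤ)))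
      where
      arith : ∀ a → a - (1ℤ + 1ℤ) ≡ a - 1ℤ - 1ℤ
      arith = solve-∀

    max-q : IsMaximum (φ i q) (m - 1ℤ)
    max-q = (F , φqF) , λ k → case ℤ.<-cmp (height k) (height F) of λ where
      (tri< lt _ _) → ℤ.<⇒≤ (below-F k lt)
      (tri≈ _ eq _) → ℤ.≤-reflexive (trans (cong (φ i q) (Height-≡ {k = k} {F} eq)) φqF)
      (tri> _ _ gt) → above-F k gt

    φ̂q≡′ : φ̂ i q ≡ m - 1ℤ
    φ̂q≡′ = IsMaximum-unique (φ̂-max i q) max-q

    φ̂q≡ : φ̂ i q ≡ φ̂ i p - 1ℤ
    φ̂q≡ = trans φ̂q≡′ (cong (_- 1ℤ) (IsMaximum-unique max (φ̂-max i p)))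

    ε̂q≡ : ε̂ i q ≡ 1ℤ + ε̂ i p
    ε̂q≡ = trans (ε̂-φ̂ i q) (trans (cong₂ _-_ φ̂q≡ (trans (total-cong i q≋) (total-quotient i p (F ↓²))))
      (trans (arith (φ̂ i p) (total i p)) (cong (λ n → 1ℤ + n) (sym (ε̂-φ̂ i p)))))
      where
      arith : ∀ a t → a - 1ℤ - (t - + 2) ≡ 1ℤ + (a - t)
      arith = solve-∀

    ε̂≢0 : ε̂ i q ≢ 0ℤ
    ε̂≢0 eq = ℤ.<-irrefl (sym (trans (sym ε̂q≡) eq)) (ℤ.+-mono-<-≤ (ℤ.+<+ {0} {1} (s≤s z≤n)) (ε̂≥0 i p))

    least : ∀ k → ε i q k ≡ ε̂ i q → (F ↓²) ≤ᴴ k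
    least k eq = subst ((F ↓²) ≤ᴴ_) (↓²↑² k) (≤-↓² {k = F} {k ↑²} (ℤ.≮⇒≥ λ lt → ℤ.<-irrefl at-max (below-F (k ↑²) lt)))
      where
      arith : ∀ a b → a ≡ a - b + b
      arith = solve-∀
      at-max : φ i q (k ↑²) ≡ m - 1ℤ
      at-max = trans (arith (φ i q (k ↑²)) (total i q)) (trans (cong (_+ total i q)
        (trans (sym (ε-φ i q k)) (trans eq (ε̂-φ̂ i q)))) (trans (sym (arith (φ̂ i q) (total i q))) φ̂q≡′))

  -- Multiplying by `z (i , E)` adds 0 to the partial sums φ above G = E + 2, adds 1 at G and 2
  -- below. Below G the old sums are not maximal, because E is least, so adding 2 does not take them
  -- beyond m + 1.
  e-raises : ∀ {i p q} → e[ i ] p ↦ q → f[ i ] q ↦ p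
  e-raises {i} {p} {q} (me , E , maxe , me≢0 , eqE , least , q≈) = m + 1ℤ , G , max-q , m+1≢0 , φqG , largest ,
    unwrap (≋-trans (≋-sym (··⁻¹-cancel p (z (i , E)))) (·-cong (≋-sym q≋) (subst (λ h → z (i , E) ⁻¹ ≋ z (i , h) ⁻¹) (sym (↓²↑² E)) ≋-refl)))
    where
    q≋ : q ≋ p · z (i , E)
    q≋ = wrap q≈

    G = E ↑²
    m = φ̂ i p

    me≡ : me ≡ m - total i p
    me≡ = trans (IsMaximum-unique maxe (ε̂-max i p)) (ε̂-φ̂ i p)

    φ-of-ε : ∀ k → φ i p (k ↑²) ≡ ε i p k + total i p
    φ-of-ε k = trans (arith _ _) (cong (_+ total i p) (sym (ε-φ i p k)))
      where
      arith : ∀ a t → a ≡ a - t + t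
      arith = solve-∀

    φpG : φ i p G ≡ m
    φpG = trans (φ-of-ε E) (trans (cong (_+ total i p) (trans eqE me≡)) (arith m (total i p)))
      where
      arith : ∀ a t → a - t + t ≡ a
      arith = solve-∀

    φq : ∀ k → φ i q k ≡ φ i p k + ([ height k ℤ.≤? height E ] 1ℤ + [ height k ℤ.≤? height G ] 1ℤ)
    φq k = trans (φ-cong i q≋ k) (φ-product i p E k)

    φqG : φ i q G ≡ m + 1ℤ
    φqG = trans (φq G) (cong₂ _+_ φpG (cong₂ _+_
      ([no] (height G ℤ.≤? height E) (ℤ.<⇒≱ (↑²-> E))) ([yes] (height G ℤ.≤? height G) ℤ.≤-refl)))

    above-G : ∀ k → height G < height k → φ i q k ≤ m
    above-G k G<k = ℤ.≤-trans (ℤ.≤-reflexive (trans (φq k) (trans (cong₂ (λ a b → φ i p k + (a + b))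
        ([no] (height k ℤ.≤? height E) (λ le → ℤ.<⇒≱ G<k (ℤ.≤-trans le (ℤ.<⇒≤ (↑²-> E)))))
        ([no] (height k ℤ.≤? height G) (ℤ.<⇒≱ G<k))) (ℤ.+-identityʳ _))))
      (proj₂ (φ̂-max i p) k)

    below-G : ∀ k → height k < height G → φ i q k ≤ m + 1ℤ
    below-G k k<G = ℤ.≤-trans (ℤ.≤-reflexive (trans (φq k) (cong₂ (λ a b → φ i p k + (a + b))
        ([yes] (height k ℤ.≤? height E) (subst₂ _≤ᴴ_ (↓²↑² k) (↓²↑² E) (≤-↓² {k = k ↑²} {G} (gap k G k<G))))
        ([yes] (height k ℤ.≤? height G) (ℤ.<⇒≤ k<G)))))
      (ℤ.≤-trans (ℤ.+-monoˡ-≤ (1ℤ + 1ℤ) (<⇒≤-1 (ℤ.≤∧≢⇒< (proj₂ (φ̂-max i p) k) λ eq →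
          ℤ.<⇒≱ k<G (subst (G ≤ᴴ_) (↑²↓² k) (≤-↑² {k = E} {k ↓²} (least (k ↓²) (ε-at k eq)))))))
        (ℤ.≤-reflexive (arith m)))
      where
      arith : ∀ a → a - 1ℤ + (1ℤ + 1ℤ) ≡ a + 1ℤ
      arith = solve-∀
      ε-at : ∀ k → φ i p k ≡ m → ε i p (k ↓²) ≡ me
      ε-at k eq = trans (ε-φ i p (k ↓²)) (trans (cong (_- total i p) (trans (cong (φ i p) (↑²↓² k)) eq)) (sym me≡))

    max-q : IsMaximum (φ i q) (m + 1ℤ)
    max-q = (G , φqG) , λ k → case ℤ.<-cmp (height k) (height G) of λ where
      (tri< lt _ _) → below-G k lt
      (tri≈ _ eq _) → ℤ.≤-reflexive (trans (cong (φ i q) (Height-≡ {k = k} {G} eq)) φqG)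
      (tri> _ _ gt) → ℤ.≤-trans (above-G k gt) (ℤ.i≤i+j m 1ℤ)

    m+1≢0 : m + 1ℤ ≢ 0ℤ
    m+1≢0 eq = ℤ.<-irrefl (sym eq) (ℤ.+-mono-≤-< (φ̂≥0 i p) (ℤ.+<+ {0} {1} (s≤s z≤n)))

    largest : ∀ k → φ i q k ≡ m + 1ℤ → k ≤ᴴ G
    largest k eq = ℤ.≮⇒≥ λ lt → ℤ.<⇒≱ (+1≤⇒< (ℤ.≤-reflexive refl)) (ℤ.≤-trans (ℤ.≤-reflexive (sym eq)) (above-G k lt))

  f-ε̂ : ∀ {i p q} → f[ i ] p ↦ q → ε̂ i q ≡ ε̂ i p + 1ℤ
  f-ε̂ {i} {p} {q} step@(_ , F , _ , _ , _ , _ , q≈) = trans (ε̂-φ̂ i q)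
    (trans (cong₂ _-_ (proj₁ (f-lowers {i} {p} {q} step)) (trans (total-cong i q≋) (total-quotient i p (F ↓²))))
      (trans (arith (φ̂ i p) (total i p)) (cong (_+ 1ℤ) (sym (ε̂-φ̂ i p)))))
    where
    q≋ : q ≋ p · z (i , F ↓²) ⁻¹
    q≋ = wrap q≈
    arith : ∀ a t → a - 1ℤ - (t - + 2) ≡ a - t + 1ℤ
    arith = solve-∀

  -- Implies closure under the crystal operators, as f acts at an F with
  -- p[i , F] > 0 and e at an E with p[i , E] < 0.
  record StronglyClosed {ℓ} (X : Pred Monomial ℓ) : Set ℓ where
    field
      resp  : ∀ {p q} → p ≋ q → X p → X q
      lower : ∀ {p} w → X p → 0ℤ < p ⟦ w ⟧ → X (p · z (down w) ⁻¹)
      raise : ∀ {p} w → X p → p ⟦ w ⟧ < 0ℤ → X (p · z w)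

    closed-f : ∀ {i p q} → X p → f[ i ] p ↦ q → X q
    closed-f {i} {p} {q} xp step@(_ , F , _ , _ , _ , _ , q≈) = resp (≋-sym (wrap q≈)) (lower (i , F) xp (f-positive {i} {p} {q} step))

    closed-e : ∀ {i p q} → X p → e[ i ] p ↦ q → X q
    closed-e {i} {p} {q} xp step@(_ , E , _ , _ , _ , _ , q≈) = resp (≋-sym (wrap q≈)) (raise (i , E) xp (e-negative {i} {p} {q} step))

-- The subcrystals ℳ(i, c)ⁿ and their products

length-filter-map : ∀ {A B : Set} {ℓ} {Q : Pred B ℓ} (Q? : Decidable Q) (g : A → B) L →
                    length (filter Q? (map g L)) ≡ length (filter (Q? ∘ g) L)
length-filter-map Q? g []      = refl
length-filter-map Q? g (x ∷ L) with does (Q? (g x))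
... | true  = cong suc (length-filter-map Q? g L)
... | false = length-filter-map Q? g L

lowest : ∀ {A : Set} (h : A → ℤ) x L → ∃ λ a → a ∈ x ∷ L × (∀ {b} → b ∈ x ∷ L → h a ≤ h b)
lowest h x []      = x , here refl , λ { (here refl) → ℤ.≤-refl }
lowest h x (y ∷ L) with lowest h y L
... | a , a∈ , least with ℤ.≤-total (h x) (h a)
...   | inj₁ le = x , here refl , λ { (here refl) → ℤ.≤-refl ; (there b∈) → ℤ.≤-trans le (least b∈) }
...   | inj₂ ge = a , there a∈ , λ { (here refl) → ge ; (there b∈) → least b∈ }

module ProductCrystals (𝒮 : Setting) where

  open Setting 𝒮
  open Crystal 𝒮
  open Monomials 𝒮
  open Modules 𝒮
  open CrystalOperators 𝒮

  z-neighbours : ∀ v {a x} → (a , x) ∈ concatMap (neighbour (proj₂ v)) (allFin #simple) → Diagonal v x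
  z-neighbours (i , k) x∈ with find (∈-concatMap⁻ (neighbour k) {xs = allFin #simple} x∈)
  ... | j , _ , x∈′ with j ∼? i
  z-neighbours (i , k) x∈ | j , _ , here refl | yes j∼i = j∼i , refl

  sumBelow : ∀ i → Height i → Monomial → ℤ
  sumBelow i k p = sumWhere (λ (j , l) → (j Fin.≟ i) ×-dec (height l ℤ.≤? height k)) (factors p)

  sumBelow-· : ∀ i k p q → sumBelow i k (p · q) ≡ sumBelow i k p + sumBelow i k q
  sumBelow-· i k p q = sumWhere-++ _ (factors p) (factors q)

  sumBelow-⁻¹ : ∀ i k p → sumBelow i k (p ⁻¹) ≡ - sumBelow i k p
  sumBelow-⁻¹ i k p = trans (sumWhere-scale _ -1ℤ (factors p)) (ℤ.-1*i≡-i _)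

  -- The other factors of `z v` lie strictly higher than `v`, so only y at `v` itself can count.
  sumBelow-z : ∀ i k v → height k ≤ ht v → sumBelow i k (z v) ≡ [ v ≟ⱽ (i , k) ] 1ℤ
  sumBelow-z i k v@(j , l) k≤v = trans (cong₂ _+_
      ([]-iff ((j Fin.≟ i) ×-dec (height l ℤ.≤? height k)) (v ≟ⱽ (i , k))
        (λ (eq , le) → vertex-≡ eq (ℤ.≤-antisym le k≤v)) (λ { refl → refl , ℤ.≤-refl }))
      (cong₂ _+_ ([no] ((j Fin.≟ i) ×-dec (height (l ↑²) ℤ.≤? height k)) (λ (_ , le) → ℤ.<⇒≱ (ℤ.≤-<-trans k≤v (↑²-> l)) le))
        (sumWhere-none _ (concatMap (neighbour l) (allFin #simple)) λ x∈ (_ , le) →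
          ℤ.<⇒≱ (ℤ.≤-<-trans k≤v (+1≤⇒< ℤ.≤-refl)) (ℤ.≤-trans (ℤ.≤-reflexive (sym (proj₂ (z-neighbours v x∈)))) le))))
    (ℤ.+-identityʳ _)

  module _ (v : I×̇ℤ) (n : ℕ) (nϖ : n •ϖ proj₁ v ∈P) where

    open Framed v n

    g : Monomial
    g = y^ v n nϖ

    g-value : ∀ w → g ⟦ w ⟧ ≡ [ v ≟ⱽ w ] (+ n)
    g-value w = ℤ.+-identityʳ _

    vertices : List Cell → List I×̇ℤ
    vertices = map proj₁

    length-above : ∀ w L → + length (above w L) ≡ [ v ≟ⱽ w ] (+ n) + + #∠ w (vertices L)
    length-above w L = trans (cong +_ (trans (cong length (List.filter-++ (Into? w) (map inj₁ (allFin n)) (map inj₂ L)))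
        (List.length-++ (filter (Into? w) (map inj₁ (allFin n))))))
      (cong₂ _+_ (trans (cong +_ (length-filter-map (Into? w) inj₁ (allFin n))) (frames (v ≟ⱽ w)))
        (cong +_ (trans (length-filter-map (Into? w) inj₂ L) (sym (length-filter-map (λ u → Diagonal? u w) proj₁ L)))))
      where
      frames : (d : Dec (v ≡ w)) → + length (filter (λ _ → d) (allFin n)) ≡ [ d ] (+ n)
      frames d@(yes eq) = cong +_ (trans (cong length (List.filter-all (λ _ → d) {allFin n} (All.tabulate λ _ → eq))) (List.length-tabulate {n = n} id))
      frames d@(no neq) = cong (+_ ∘ length) (List.filter-none (λ _ → d) {allFin n} (All.tabulate λ _ → neq))

    -- The monomials of modules of dimension `l`. The dimension is recorded as the measure for the
    -- induction that shows them to be generated by `g`.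
    N : ℕ → Pred Monomial 0ℓ
    N l p = ∃ λ L → Module L × length L ≡ l × p ≋ g · ∏z (vertices L) ⁻¹

    -- The Euler characteristic of the complex at `w`: the exponent of `g` counts the frames, and
    -- `∏z-value` supplies the rest.
    N-value : ∀ {p} L → p ≋ g · ∏z (vertices L) ⁻¹ → ∀ w →
              p ⟦ w ⟧ ≡ + length (above w L) - + (length (at w L) ℕ.+ length (below w L))
    N-value {p} L p≋ w = begin
      p ⟦ w ⟧ ≡⟨ ≋-⟪⟫ p≋ (inj₂ w) ⟩
      (g · ∏z (vertices L) ⁻¹) ⟦ w ⟧ ≡⟨ quotient-⟪⟫ g (∏z (vertices L)) (inj₂ w) ⟩
      g ⟦ w ⟧ - ∏z (vertices L) ⟦ w ⟧ ≡⟨ cong₂ _-_ (g-value w) (∏z-value (vertices L) w) ⟩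
      y - (t + (u - m)) ≡⟨ arith y t u m ⟩
      y + m - (t + u) ≡⟨ cong₂ _-_ (sym (length-above w L)) (cong₂ (λ a b → + (a ℕ.+ b))
        (length-filter-map (_≟ⱽ w) proj₁ L) (length-filter-map (λ u → up u ≟ⱽ w) proj₁ L)) ⟩
      + length (above w L) - + (length (at w L) ℕ.+ length (below w L)) ∎
      where
      open ≡-Reasoning
      y = [ v ≟ⱽ w ] (+ n)
      t = + #≡ w (vertices L)
      u = + #↑ w (vertices L)
      m = + #∠ w (vertices L)
      arith : ∀ y t u m → y - (t + (u - m)) ≡ y + m - (t + u)
      arith = solve-∀

    N-resp : ∀ {l p q} → p ≋ q → N l p → N l q
    N-resp eq (L , V , len , p≋) = L , V , len , ≋-trans (≋-sym eq) p≋

    N-lower : ∀ {l p} w → N l p → 0ℤ < p ⟦ w ⟧ → N (suc l) (p · z (down w) ⁻¹)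
    N-lower {l} {p} w (L , V , len , p≋) pos =
      let q , V′ = extend V w (ℤ.drop‿+<+ (subst₂ _<_ (ℤ.+-identityˡ _) (arith (+ length (above w L)) (+ (length (at w L) ℕ.+ length (below w L))))
            (ℤ.+-monoˡ-< (+ (length (at w L) ℕ.+ length (below w L))) (subst (0ℤ <_) (N-value {p} L p≋ w) pos))))
      in (down w , q) ∷ L , V′ , cong suc len , ≋-trans (·-cong p≋ ≋-refl) (divide (∏z (vertices L)) (z (down w)))
      where
      arith : ∀ a b → a - b + b ≡ a
      arith = solve-∀
      divide : ∀ q r → (g · q ⁻¹) · r ⁻¹ ≋ g · (r · q) ⁻¹
      divide q r = ≋-ext λ κ → trans (quotient-⟪⟫ (g · q ⁻¹) r κ) (trans (cong (_- r ⟪ κ ⟫) (quotient-⟪⟫ g q κ))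
        (trans (arith′ (g ⟪ κ ⟫) (q ⟪ κ ⟫) (r ⟪ κ ⟫)) (sym (trans (quotient-⟪⟫ g (r · q) κ) (cong (λ t → g ⟪ κ ⟫ - t) (·-⟪⟫ r q κ))))))
        where
        arith′ : ∀ a b c → a - b - c ≡ a - (c + b)
        arith′ = solve-∀

    N-raise : ∀ {l p} w → N l p → p ⟦ w ⟧ < 0ℤ → ∃ λ l′ → l ≡ suc l′ × N l′ (p · z w)
    N-raise {l} {p} w (L , V , len , p≋) neg with shrink V w
        (ℤ.drop‿+<+ (subst₂ _<_ (arith (+ length (above w L)) (+ (length (at w L) ℕ.+ length (below w L)))) (ℤ.+-identityˡ _)
          (ℤ.+-monoˡ-< (+ (length (at w L) ℕ.+ length (below w L))) (subst (_< 0ℤ) (N-value {p} L p≋ w) neg))))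
      where
      arith : ∀ a b → a - b + b ≡ a
      arith = solve-∀
    ... | r , pre , post , refl , refl , V′ = length (pre ++ post) ,
          trans (sym len) (trans (List.length-++ pre) (trans (ℕ.+-suc (length pre) (length post)) (cong suc (sym (List.length-++ pre))))) ,
          pre ++ post , V′ , refl , ≋-trans (·-cong p≋ ≋-refl) (≋-ext λ κ →
            trans (·-⟪⟫ (g · ∏z (vertices (pre ++ r ∷ post)) ⁻¹) (z w) κ)
              (trans (cong (_+ z w ⟪ κ ⟫) (quotient-⟪⟫ g (∏z (vertices (pre ++ r ∷ post))) κ))
                (trans (cong (λ t → g ⟪ κ ⟫ - t + z w ⟪ κ ⟫) (remove κ))
                  (trans (arith (g ⟪ κ ⟫) (z w ⟪ κ ⟫) (∏z (vertices (pre ++ post)) ⟪ κ ⟫))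
                    (sym (quotient-⟪⟫ g (∏z (vertices (pre ++ post))) κ))))))
      where
      arith : ∀ a b c → a - (b + c) + b ≡ a - c
      arith = solve-∀
      swap : ∀ a b c → a + (b + c) ≡ b + (a + c)
      swap = solve-∀
      remove : ∀ κ → ∏z (vertices (pre ++ r ∷ post)) ⟪ κ ⟫ ≡ z w ⟪ κ ⟫ + ∏z (vertices (pre ++ post)) ⟪ κ ⟫
      remove κ = go pre
        where
        go : ∀ pre → ∏z (vertices (pre ++ r ∷ post)) ⟪ κ ⟫ ≡ z w ⟪ κ ⟫ + ∏z (vertices (pre ++ post)) ⟪ κ ⟫
        go []        = ·-⟪⟫ (z w) (∏z (vertices post)) κ
        go (c ∷ pre) = trans (·-⟪⟫ (z (proj₁ c)) (∏z (vertices (pre ++ r ∷ post))) κ)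
          (trans (cong (λ t → z (proj₁ c) ⟪ κ ⟫ + t) (go pre))
            (trans (swap (z (proj₁ c) ⟪ κ ⟫) (z w ⟪ κ ⟫) _)
              (cong (λ t → z w ⟪ κ ⟫ + t) (sym (·-⟪⟫ (z (proj₁ c)) (∏z (vertices (pre ++ post))) κ)))))

    generated⇒N : ∀ {p} → Generated g p → ∃ λ l → N l p
    generated⇒N (generator p≈) = 0 , [] , zeroModule , refl , ≋-ext λ κ →
      trans (≋-⟪⟫ (wrap p≈) κ) (sym (trans (quotient-⟪⟫ g 𝟙 κ) (trans (cong (λ t → g ⟪ κ ⟫ - t) (𝟙-⟪⟫ κ)) (ℤ.+-identityʳ _))))
    generated⇒N (f-closed {i} {p} {q} gen step@(_ , F , _ , _ , _ , _ , q≈)) =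
      let l , Np = generated⇒N gen in
      suc l , N-resp (≋-sym (wrap q≈)) (N-lower {p = p} (i , F) Np (f-positive {i} {p} {q} step))
    generated⇒N (e-closed {i} {p} {q} gen step@(_ , E , _ , _ , _ , _ , q≈)) =
      let l , Np = generated⇒N gen
          l′ , _ , Nq = N-raise {p = p} (i , E) Np (e-negative {i} {p} {q} step)
      in l′ , N-resp (≋-sym (wrap q≈)) Nq

    -- A cell of least height k, at (i , k), makes ε i p k positive.
    ε-positive : ∀ {p} L → Module L → p ≋ g · ∏z (vertices L) ⁻¹ → ∀ {c} → c ∈ L →
                 (∀ {b} → b ∈ L → ht (proj₁ c) ≤ ht (proj₁ b)) → ε̂ (proj₁ (proj₁ c)) p ≢ 0ℤ
    ε-positive {p} L V p≋ {c} c∈ least ε̂≡0 = ℤ.<⇒≱ pos (ℤ.≤-trans (ℤ.≤-reflexive (sym value)) (ℤ.≤-trans (proj₂ (ε̂-max i p) k) (ℤ.≤-reflexive ε̂≡0)))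
      where
      i = proj₁ (proj₁ c)
      k = proj₂ (proj₁ c)

      at-least : ∀ L → (∀ {b} → b ∈ L → height k ≤ ht (proj₁ b)) → sumBelow i k (∏z (vertices L)) ≡ + #≡ (i , k) (vertices L)
      at-least []      h = refl
      at-least (b ∷ L) h = trans (sumBelow-· i k (z (proj₁ b)) (∏z (vertices L)))
        (trans (cong₂ _+_ (sumBelow-z i k (proj₁ b) (h (here refl))) (at-least L (h ∘ there))) (count (proj₁ b) (vertices L)))
        where
        count : ∀ u L → [ u ≟ⱽ (i , k) ] 1ℤ + + #≡ (i , k) L ≡ + #≡ (i , k) (u ∷ L)
        count u L with does (u ≟ⱽ (i , k))
        ... | true  = refl
        ... | false = refl

      value : ε i p k ≡ + #≡ (i , k) (vertices L)
      value = begin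
        - sumBelow i k p
          ≡⟨ cong -_ (sumWhere-cong _≟ⱽ_ _ (factors p) (factors (g · ∏z (vertices L) ⁻¹)) (λ w → ≋-⟪⟫ p≋ (inj₂ w))) ⟩
        - sumBelow i k (g · ∏z (vertices L) ⁻¹)
          ≡⟨ cong -_ (trans (sumBelow-· i k g (∏z (vertices L) ⁻¹)) (cong₂ _+_ g-below (sumBelow-⁻¹ i k (∏z (vertices L))))) ⟩
        - (0ℤ + - sumBelow i k (∏z (vertices L)))
          ≡⟨ arith _ ⟩
        sumBelow i k (∏z (vertices L))
          ≡⟨ at-least L least ⟩
        + #≡ (i , k) (vertices L) ∎
        where
        open ≡-Reasoning
        arith : ∀ a → - (0ℤ + - a) ≡ a
        arith = solve-∀
        -- All cells lie strictly below `v`, so the factor y at `v` is out of reach of the sum.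
        g-below : sumBelow i k g ≡ 0ℤ
        g-below = trans (ℤ.+-identityʳ _) ([no] ((proj₁ v Fin.≟ i) ×-dec (ht v ℤ.≤? height k))
          λ (_ , le) → ℤ.<⇒≱ (Module.low V c∈) le)

      pos : 0ℤ < + #≡ (i , k) (vertices L)
      pos = ℤ.+<+ (nonempty (∈-filter⁺ (_≟ⱽ (i , k)) (∈-map⁺ proj₁ c∈) refl))
        where
        nonempty : ∀ {x : I×̇ℤ} {L} → x ∈ L → 0 ℕ.< length L
        nonempty (here _)  = s≤s z≤n
        nonempty (there _) = s≤s z≤n

    -- A nonzero module has positive ε in the column of a lowest cell, so e applies there and leads
    -- to a module of smaller dimension. From its monomial, generated by induction, f leads back to
    -- `p`.
    N⇒generated : ∀ l {p} → N l p → Generated g p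
    N⇒generated zero {p} ([] , V , len , p≋) = generator (unwrap (≋-trans p≋ (≋-ext {g · 𝟙 ⁻¹} {g} λ κ →
      trans (quotient-⟪⟫ g 𝟙 κ) (trans (cong (λ t → g ⟪ κ ⟫ - t) (𝟙-⟪⟫ κ)) (ℤ.+-identityʳ _)))))
    N⇒generated (suc l) {p} (b ∷ L , V , len , p≋) =
      let c , c∈ , least = lowest (ht ∘ proj₁) b L
          i = proj₁ (proj₁ c)
          q , step = e-defined i p (ε-positive {p} (b ∷ L) V p≋ c∈ least)
          E = proj₁ (proj₂ step)
          q≈ = proj₂ (proj₂ (proj₂ (proj₂ (proj₂ (proj₂ step)))))
          l′ , l≡ , Nq = N-raise {p = p} (i , E) (b ∷ L , V , len , p≋) (e-negative {i} {p} {q} step)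
      in f-closed {i = i} {p = q} (N⇒generated l (N-resp (≋-sym (wrap q≈)) (subst (λ l → N l (p · z (i , E))) (sym (ℕ.suc-injective l≡)) Nq)))
           (e-raises {i} {p} {q} step)

    Generated-closed : StronglyClosed (Generated g)
    Generated-closed = record
      { resp  = λ {p} {q} eq gen → let l , Np = generated⇒N gen in N⇒generated l (N-resp eq Np)
      ; lower = λ {p} w gen pos → let l , Np = generated⇒N gen in N⇒generated (suc l) (N-lower {p = p} w Np pos)
      ; raise = λ {p} w gen neg → let l , Np = generated⇒N gen ; l′ , _ , Nq = N-raise {p = p} w Np neg in N⇒generated l′ Nq
      }

    -- The bound on heights comes from the modules and is kept because the descent to `J` ends by
    -- means of it.
    generated-form : ∀ {p} → Generated g p → ∃ λ L → p ≋ g · ∏z L ⁻¹ × (∀ {w} → w ∈ L → ht w < ht v)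
    generated-form {p} gen = let _ , L , V , _ , p≋ = generated⇒N {p} gen in
      vertices L , p≋ , λ w∈ → low V (∈-map⁻ proj₁ w∈)
      where
      low : ∀ {L} → Module L → ∀ {w} → ∃ (λ c → c ∈ L × w ≡ proj₁ c) → ht w < ht v
      low V (c , c∈ , refl) = Module.low V c∈

  module _ (R : Multiset) (Rϖ : Integral R) where

    positive-summand : ∀ a b → 0ℤ < a + b → 0ℤ < a ⊎ 0ℤ < b
    positive-summand a b pos with 0ℤ ℤ.<? a | 0ℤ ℤ.<? b
    ... | yes p | _     = inj₁ p
    ... | no _  | yes p = inj₂ p
    ... | no p  | no q  = contradiction (ℤ.+-mono-≤ (ℤ.≮⇒≥ p) (ℤ.≮⇒≥ q)) (ℤ.<⇒≱ pos)

    negative-summand : ∀ a b → a + b < 0ℤ → a < 0ℤ ⊎ b < 0ℤ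
    negative-summand a b neg with a ℤ.<? 0ℤ | b ℤ.<? 0ℤ
    ... | yes p | _     = inj₁ p
    ... | no _  | yes p = inj₂ p
    ... | no p  | no q  = contradiction (ℤ.+-mono-≤ (ℤ.≮⇒≥ p) (ℤ.≮⇒≥ q)) (ℤ.<⇒≱ neg)

    factor-closed : ∀ v → StronglyClosed (Generated (y-of R Rϖ v))
    factor-closed v = Generated-closed v (mult R v) (Rϖ v)

    products-resp : ∀ {vs p q} → p ≋ q → Products R Rϖ vs p → Products R Rϖ vs q
    products-resp {p = r} eq ([] r≈) = [] (unwrap (≋-trans (≋-sym eq) (wrap {r} {𝟙} r≈)))
    products-resp {p = r} eq (_∷_ {p = p} {q} (gen , r≈) rest) =
      (gen , unwrap (≋-trans (≋-sym eq) (wrap {r} {q · p} r≈))) ∷ rest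

    -- If the exponent of a product is positive, that of some factor is, and this factor can be
    -- divided. The same argument fails for f, which may act at a height that is not extremal for
    -- the factor.
    products-lower : ∀ {vs p} w → Products R Rϖ vs p → 0ℤ < p ⟦ w ⟧ → Products R Rϖ vs (p · z (down w) ⁻¹)
    products-lower w ([] (_ , p≈)) pos = contradiction (subst (0ℤ <_) (p≈ w) pos) (ℤ.<-irrefl refl)
    products-lower {v ∷ vs} {r} w (_∷_ {p = p} {q} (gen , r≈) rest) pos
      with positive-summand (q ⟦ w ⟧) (p ⟦ w ⟧) (subst (0ℤ <_) (trans (proj₂ r≈ w) (·-⟪⟫ q p (inj₂ w))) pos)
    ... | inj₁ pos-q = (StronglyClosed.lower (factor-closed v) {q} w gen pos-q ,
            unwrap (≋-trans (·-cong (wrap {r} {q · p} r≈) ≋-refl) (·-swapʳ q p (z (down w) ⁻¹)))) ∷ rest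
    ... | inj₂ pos-p = (gen , unwrap (≋-trans (·-cong (wrap {r} {q · p} r≈) ≋-refl) (·-assoc q p (z (down w) ⁻¹)))) ∷
            products-lower {p = p} w rest pos-p

    products-raise : ∀ {vs p} w → Products R Rϖ vs p → p ⟦ w ⟧ < 0ℤ → Products R Rϖ vs (p · z w)
    products-raise w ([] (_ , p≈)) neg = contradiction (subst (_< 0ℤ) (p≈ w) neg) (ℤ.<-irrefl refl)
    products-raise {v ∷ vs} {r} w (_∷_ {p = p} {q} (gen , r≈) rest) neg
      with negative-summand (q ⟦ w ⟧) (p ⟦ w ⟧) (subst (_< 0ℤ) (trans (proj₂ r≈ w) (·-⟪⟫ q p (inj₂ w))) neg)
    ... | inj₁ neg-q = (StronglyClosed.raise (factor-closed v) {q} w gen neg-q ,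
            unwrap (≋-trans (·-cong (wrap {r} {q · p} r≈) ≋-refl) (·-swapʳ q p (z w)))) ∷ rest
    ... | inj₂ neg-p = (gen , unwrap (≋-trans (·-cong (wrap {r} {q · p} r≈) ≋-refl) (·-assoc q p (z w)))) ∷
            products-raise {p = p} w rest neg-p

    ℳ-closed : StronglyClosed (ℳ R Rϖ)
    ℳ-closed = record
      { resp  = products-resp
      ; lower = λ {p} → products-lower {p = p}
      ; raise = λ {p} → products-raise {p = p}
      }

    -- The multisets of the factors are joined. Each of their vertices stays below a vertex of `vs`,
    -- namely that of its own factor.
    products-form : ∀ {vs p} → Products R Rϖ vs p →
      ∃ λ L → p ≋ ∏ vs (y-of R Rϖ) · ∏z L ⁻¹ × (∀ {w} → w ∈ L → ∃ λ v → v ∈ vs × ht w < ht v)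
    products-form {p = p} ([] p≈) = [] , ≋-trans (wrap p≈) (≋-ext λ κ →
      sym (trans (quotient-⟪⟫ 𝟙 𝟙 κ) (trans (cong (λ t → 𝟙 ⟪ κ ⟫ - t) (𝟙-⟪⟫ κ)) (ℤ.+-identityʳ _)))) , λ ()
    products-form {v ∷ vs} {r} (_∷_ {p = p} {q} (gen , r≈) rest) =
      let K , q≋ , K-low = generated-form v (mult R v) (Rϖ v) gen
          L , p≋ , L-low = products-form rest
      in K ++ L , ≋-trans (wrap {r} {q · p} r≈) (≋-trans (·-cong q≋ p≋) (≋-ext (regroup K L))) , low K L K-low L-low
      where
      y = y-of R Rϖ v
      Y = ∏ vs (y-of R Rϖ)
      regroup : ∀ K L κ → ((y · ∏z K ⁻¹) · (Y · ∏z L ⁻¹)) ⟪ κ ⟫ ≡ ((y · Y) · ∏z (K ++ L) ⁻¹) ⟪ κ ⟫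
      regroup K L κ = begin
        ((y · ∏z K ⁻¹) · (Y · ∏z L ⁻¹)) ⟪ κ ⟫
          ≡⟨ ·-⟪⟫ (y · ∏z K ⁻¹) (Y · ∏z L ⁻¹) κ ⟩
        (y · ∏z K ⁻¹) ⟪ κ ⟫ + (Y · ∏z L ⁻¹) ⟪ κ ⟫
          ≡⟨ cong₂ _+_ (quotient-⟪⟫ y (∏z K) κ) (quotient-⟪⟫ Y (∏z L) κ) ⟩
        (y ⟪ κ ⟫ - ∏z K ⟪ κ ⟫) + (Y ⟪ κ ⟫ - ∏z L ⟪ κ ⟫)
          ≡⟨ arith (y ⟪ κ ⟫) _ (Y ⟪ κ ⟫) _ ⟩
        (y ⟪ κ ⟫ + Y ⟪ κ ⟫) - (∏z K ⟪ κ ⟫ + ∏z L ⟪ κ ⟫)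
          ≡⟨ cong₂ _-_ (·-⟪⟫ y Y κ) (trans (∏-⟪⟫ (K ++ L) z κ) (trans (Σℤ-++ K L) (sym (cong₂ _+_ (∏-⟪⟫ K z κ) (∏-⟪⟫ L z κ))))) ⟨
        (y · Y) ⟪ κ ⟫ - ∏z (K ++ L) ⟪ κ ⟫
          ≡⟨ quotient-⟪⟫ (y · Y) (∏z (K ++ L)) κ ⟨
        ((y · Y) · ∏z (K ++ L) ⁻¹) ⟪ κ ⟫ ∎
        where
        open ≡-Reasoning
        arith : ∀ a b c d → a - b + (c - d) ≡ a + c - (b + d)
        arith = solve-∀
      low : ∀ K L → (∀ {w} → w ∈ K → ht w < ht v) → (∀ {w} → w ∈ L → ∃ λ u → u ∈ vs × ht w < ht u) →
            ∀ {w} → w ∈ K ++ L → ∃ λ u → u ∈ v ∷ vs × ht w < ht u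
      low K L K-low L-low w∈ with ∈-++⁻ K w∈
      ... | inj₁ w∈K = v , here refl , K-low w∈K
      ... | inj₂ w∈L = let u , u∈ , lt = L-low w∈L in u , there u∈ , lt

-- Demazure operators and the Weyl group

module _ {n : ℕ} where

  ⊕-at : ∀ (x y : Vec ℤ n) r → lookup (x ⊕ y) r ≡ lookup x r + lookup y r
  ⊕-at x y r = Vec.lookup-zipWith _+_ r x y

  ⊖-at : ∀ (x : Vec ℤ n) r → lookup (⊖ x) r ≡ - lookup x r
  ⊖-at x r = Vec.lookup-map r -_ x

  •-at : ∀ k (x : Vec ℤ n) r → lookup (k • x) r ≡ k * lookup x r
  •-at k x r = Vec.lookup-map r (k *_) x

  ⊝-at : ∀ (x y : Vec ℤ n) r → lookup (x ⊝ y) r ≡ lookup x r - lookup y r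
  ⊝-at x y r = trans (⊕-at x (⊖ y) r) (cong (λ a → lookup x r + a) (⊖-at y r))

⟨,⊕⟩ : ∀ {n} (x y z : Vec ℤ n) → ⟨ x , y ⊕ z ⟩ ≡ ⟨ x , y ⟩ + ⟨ x , z ⟩
⟨,⊕⟩ []      []      []      = refl
⟨,⊕⟩ (a ∷ x) (b ∷ y) (c ∷ z) =
  trans (cong₂ _+_ (ℤ.*-distribˡ-+ a b c) (⟨,⊕⟩ x y z)) (interchangeℤ (a * b) _ _ _)

⟨,•⟩ : ∀ {n} (x : Vec ℤ n) k y → ⟨ x , k • y ⟩ ≡ k * ⟨ x , y ⟩
⟨,•⟩ []      k []      = sym (ℤ.*-zeroʳ k)
⟨,•⟩ (a ∷ x) k (b ∷ y) = trans (cong (λ n → a * (k * b) + n) (⟨,•⟩ x k y)) (arith a k b _)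
  where
  arith : ∀ a k b t → a * (k * b) + k * t ≡ k * (a * b + t)
  arith = solve-∀

⟨,⊖⟩ : ∀ {n} (x y : Vec ℤ n) → ⟨ x , ⊖ y ⟩ ≡ - ⟨ x , y ⟩
⟨,⊖⟩ []      []      = refl
⟨,⊖⟩ (a ∷ x) (b ∷ y) = trans (cong₂ _+_ (sym (ℤ.neg-distribʳ-* a b)) (⟨,⊖⟩ x y)) (sym (ℤ.neg-distrib-+ (a * b) _))

⟨,⊝⟩ : ∀ {n} (x y z : Vec ℤ n) → ⟨ x , y ⊝ z ⟩ ≡ ⟨ x , y ⟩ - ⟨ x , z ⟩
⟨,⊝⟩ x y z = trans (⟨,⊕⟩ x y (⊖ z)) (cong (λ n → ⟨ x , y ⟩ + n) (⟨,⊖⟩ x z))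

module DemazureOperators (𝒮 : Setting) where

  open Setting 𝒮
  open Weights 𝒮
  open DemazureQuotient 𝒮
  open Monomials 𝒮 using (vec-ext)

  -- reflect 0 is the linear action of W on P, and reflect 1 its ρ-shifted action.
  reflect : ℤ → I → P → P
  reflect c i x = x ⊝ (⟨ α∨ i , x ⟩ + c) • α i

  reflect-at : ∀ c i x r → lookup (reflect c i x) r ≡ lookup x r - (⟨ α∨ i , x ⟩ + c) * lookup (α i) r
  reflect-at c i x r = trans (⊝-at x ((⟨ α∨ i , x ⟩ + c) • α i) r)
    (cong (λ a → lookup x r - a) (•-at (⟨ α∨ i , x ⟩ + c) (α i) r))

  pairing-reflect : ∀ c i j x → ⟨ α∨ j , reflect c i x ⟩ ≡ ⟨ α∨ j , x ⟩ - (⟨ α∨ i , x ⟩ + c) * ⟨ α∨ j , α i ⟩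
  pairing-reflect c i j x = trans (⟨,⊝⟩ (α∨ j) x ((⟨ α∨ i , x ⟩ + c) • α i))
    (cong (λ a → ⟨ α∨ j , x ⟩ - a) (⟨,•⟩ (α∨ j) (⟨ α∨ i , x ⟩ + c) (α i)))

  s-reflect : ∀ i x → s i x ≡ reflect 0ℤ i x
  s-reflect i x = cong (λ k → x ⊝ k • α i) (sym (ℤ.+-identityʳ ⟨ α∨ i , x ⟩))

  αα : ∀ i → ⟨ α∨ i , α i ⟩ ≡ + 2
  αα i = pairing-two (simple i)

  pairing-reflect-as : ∀ c i j x {a} → ⟨ α∨ j , α i ⟩ ≡ a → ⟨ α∨ j , reflect c i x ⟩ ≡ ⟨ α∨ j , x ⟩ - (⟨ α∨ i , x ⟩ + c) * a
  pairing-reflect-as c i j x refl = pairing-reflect c i j x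

  -- With the Cartan integer as a variable, each coordinate is a polynomial, and the relations
  -- between reflections, linear and shifted alike, become ring identities.
  reflect²-at : ∀ c i j x r {a} → ⟨ α∨ j , α i ⟩ ≡ a →
    lookup (reflect c j (reflect c i x)) r ≡
    lookup x r - (⟨ α∨ i , x ⟩ + c) * lookup (α i) r
      - (⟨ α∨ j , x ⟩ - (⟨ α∨ i , x ⟩ + c) * a + c) * lookup (α j) r
  reflect²-at c i j x r eq = trans (reflect-at c j (reflect c i x) r)
    (cong₂ (λ u v → u - (v + c) * lookup (α j) r) (reflect-at c i x r) (pairing-reflect-as c i j x eq))

  reflect-involutive : ∀ c i x → reflect c i (reflect c i x) ≡ x
  reflect-involutive c i x = vec-ext λ r → trans (reflect²-at c i i x r (αα i))
    (arith c (lookup x r) ⟨ α∨ i , x ⟩ (lookup (α i) r))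
    where
    arith : ∀ c x p a → x - (p + c) * a - (p - (p + c) * + 2 + c) * a ≡ x
    arith = solve-∀

  reflect-comm : ∀ c i j x → ⟨ α∨ i , α j ⟩ ≡ 0ℤ → reflect c j (reflect c i x) ≡ reflect c i (reflect c j x)
  reflect-comm c i j x eq = vec-ext λ r → trans (reflect²-at c i j x r (trans (cartan-symmetric j i) eq))
    (trans (arith c (lookup x r) ⟨ α∨ i , x ⟩ ⟨ α∨ j , x ⟩ (lookup (α i) r) (lookup (α j) r))
      (sym (reflect²-at c j i x r eq)))
    where
    arith : ∀ c x p q a b →
      x - (p + c) * a - (q - (p + c) * 0ℤ + c) * b ≡
      x - (q + c) * b - (p - (q + c) * 0ℤ + c) * a
    arith = solve-∀

  reflect³-at : ∀ c i j x r → ⟨ α∨ j , α i ⟩ ≡ -1ℤ → ⟨ α∨ i , α j ⟩ ≡ -1ℤ →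
    lookup (reflect c i (reflect c j (reflect c i x))) r ≡
    lookup x r - (⟨ α∨ i , x ⟩ + c) * lookup (α i) r
      - (⟨ α∨ j , x ⟩ - (⟨ α∨ i , x ⟩ + c) * -1ℤ + c) * lookup (α j) r
      - (⟨ α∨ i , x ⟩ - (⟨ α∨ i , x ⟩ + c) * + 2 - (⟨ α∨ j , x ⟩ - (⟨ α∨ i , x ⟩ + c) * -1ℤ + c) * -1ℤ + c) * lookup (α i) r
  reflect³-at c i j x r eqj eqi = trans (reflect-at c i (reflect c j (reflect c i x)) r)
    (cong₂ (λ u v → u - (v + c) * lookup (α i) r) (reflect²-at c i j x r eqj)
      (trans (pairing-reflect-as c j i (reflect c i x) eqi)
        (cong₂ (λ u v → u - (v + c) * -1ℤ) (pairing-reflect-as c i i x (αα i)) (pairing-reflect-as c i j x eqj))))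

  reflect-braid : ∀ c i j x → ⟨ α∨ i , α j ⟩ ≡ -1ℤ →
    reflect c i (reflect c j (reflect c i x)) ≡ reflect c j (reflect c i (reflect c j x))
  reflect-braid c i j x eq = vec-ext λ r → trans (reflect³-at c i j x r eq′ eq)
    (trans (arith c (lookup x r) ⟨ α∨ i , x ⟩ ⟨ α∨ j , x ⟩ (lookup (α i) r) (lookup (α j) r))
      (sym (reflect³-at c j i x r eq eq′)))
    where
    eq′ = trans (cartan-symmetric j i) eq
    arith : ∀ c x p q a b →
      x - (p + c) * a - (q - (p + c) * -1ℤ + c) * b
        - (p - (p + c) * + 2 - (q - (p + c) * -1ℤ + c) * -1ℤ + c) * a ≡
      x - (q + c) * b - (p - (q + c) * -1ℤ + c) * a
        - (q - (q + c) * + 2 - (p - (q + c) * -1ℤ + c) * -1ℤ + c) * b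
    arith = solve-∀

  reflect-⊕ : ∀ c i x y {a} → ⟨ α∨ i , y ⟩ ≡ a → reflect c i (x ⊕ y) ≡ reflect c i x ⊕ (y ⊝ a • α i)
  reflect-⊕ c i x y refl = vec-ext λ r → trans (reflect-at c i (x ⊕ y) r)
    (trans (cong₂ (λ u v → u - (v + c) * lookup (α i) r) (⊕-at x y r) (⟨,⊕⟩ (α∨ i) x y))
      (trans (arith c (lookup x r) (lookup y r) ⟨ α∨ i , x ⟩ ⟨ α∨ i , y ⟩ (lookup (α i) r))
        (sym (trans (⊕-at (reflect c i x) (y ⊝ ⟨ α∨ i , y ⟩ • α i) r) (cong₂ _+_ (reflect-at c i x r)
          (trans (⊝-at y (⟨ α∨ i , y ⟩ • α i) r) (cong (λ a → lookup y r - a) (•-at ⟨ α∨ i , y ⟩ (α i) r))))))))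
    where
    arith : ∀ c x y p q a → x + y - (p + q + c) * a ≡ x - (p + c) * a + (y - q * a)
    arith = solve-∀

  ⊕-assoc : ∀ (x y z : P) → (x ⊕ y) ⊕ z ≡ x ⊕ (y ⊕ z)
  ⊕-assoc = Vec.zipWith-assoc ℤ.+-assoc

  ⊕-comm : ∀ (x y : P) → x ⊕ y ≡ y ⊕ x
  ⊕-comm = Vec.zipWith-comm ℤ.+-comm

  ⊕-swap : ∀ (x y z : P) → (x ⊕ y) ⊕ z ≡ (x ⊕ z) ⊕ y
  ⊕-swap x y z = trans (⊕-assoc x y z) (trans (cong (x ⊕_) (⊕-comm y z)) (sym (⊕-assoc x z y)))

  ⊝-0• : ∀ (x y : P) → x ⊝ 0ℤ • y ≡ x
  ⊝-0• x y = vec-ext λ r → trans (⊝-at x (0ℤ • y) r) (trans (cong (λ a → lookup x r - a) (•-at 0ℤ y r)) (ℤ.+-identityʳ _))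

  ⊝--1• : ∀ (x y : P) → x ⊝ -1ℤ • y ≡ x ⊕ y
  ⊝--1• x y = vec-ext λ r → trans (⊝-at x (-1ℤ • y) r) (trans (cong (λ a → lookup x r - a) (•-at -1ℤ y r))
    (trans (arith (lookup x r) (lookup y r)) (sym (⊕-at x y r))))
    where
    arith : ∀ a b → a - -1ℤ * b ≡ a + b
    arith = solve-∀

  -- The map ν ↦ s_i ν - α_i, which is s_i (ν + ρ) - ρ.
  t : I → P → P
  t = reflect 1ℤ

  t-lower : ∀ i x → t i (x ⊕ α i) ⊕ α i ≡ t i x
  t-lower i x = trans (cong (_⊕ α i) (reflect-⊕ 1ℤ i x (α i) (αα i)))
    (vec-ext λ r → trans (⊕-at (t i x ⊕ (α i ⊝ + 2 • α i)) (α i) r) (trans (cong (_+ lookup (α i) r) (trans (⊕-at (t i x) (α i ⊝ + 2 • α i) r)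
      (cong (λ a → lookup (t i x) r + a) (trans (⊝-at (α i) (+ 2 • α i) r) (cong (λ a → lookup (α i) r - a) (•-at (+ 2) (α i) r))))))
      (arith (lookup (t i x) r) (lookup (α i) r))))
    where
    arith : ∀ x a → x + (a - + 2 * a) + a ≡ x
    arith = solve-∀

  t-⊕-orthogonal : ∀ i j x → ⟨ α∨ i , α j ⟩ ≡ 0ℤ → t i (x ⊕ α j) ≡ t i x ⊕ α j
  t-⊕-orthogonal i j x eq = trans (reflect-⊕ 1ℤ i x (α j) eq) (cong (t i x ⊕_) (⊝-0• (α j) (α i)))

  t-⊕-adjacent : ∀ i j x → ⟨ α∨ i , α j ⟩ ≡ -1ℤ → t i (x ⊕ α j) ≡ t i x ⊕ (α i ⊕ α j)
  t-⊕-adjacent i j x eq = trans (reflect-⊕ 1ℤ i x (α j) eq)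
    (cong (t i x ⊕_) (trans (⊝--1• (α j) (α i)) (⊕-comm (α j) (α i))))

  t-⊕-sum : ∀ i j x → ⟨ α∨ i , α j ⟩ ≡ -1ℤ → t i (x ⊕ (α i ⊕ α j)) ≡ t i x ⊕ α j
  t-⊕-sum i j x eq = trans (reflect-⊕ 1ℤ i x (α i ⊕ α j) (trans (⟨,⊕⟩ (α∨ i) (α i) (α j)) (cong₂ _+_ (αα i) eq)))
    (cong (t i x ⊕_) (vec-ext λ r → trans (⊝-at (α i ⊕ α j) (1ℤ • α i) r)
      (trans (cong₂ _-_ (⊕-at (α i) (α j) r) (•-at 1ℤ (α i) r)) (arith (lookup (α i) r) (lookup (α j) r)))))
    where
    arith : ∀ a b → a + b - 1ℤ * a ≡ b
    arith = solve-∀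

  -- Multiplication by 1 - e^(-β) on coefficient functions.
  Δ : P → (P → ℤ) → P → ℤ
  Δ β g ν = g ν - g (ν ⊕ β)

  FiniteSupport : (P → ℤ) → Set
  FiniteSupport g = ∃ λ (L : List P) → ∀ ν → ν ∉ L → g ν ≡ 0ℤ

  coeff-finite : ∀ f → FiniteSupport (coeff f)
  coeff-finite f = map proj₂ f , λ ν ν∉ → sumWhere-none (_≟ᴾ ν) f λ { x∈ refl → ν∉ (∈-map⁺ proj₂ x∈) }

  minus-finite : ∀ {g h} → FiniteSupport g → FiniteSupport h → FiniteSupport (λ ν → g ν - h ν)
  minus-finite (L , g0) (M , h0) = L ++ M , λ ν ν∉ → cong₂ _-_ (g0 ν (ν∉ ∘ ∈-++⁺ˡ)) (h0 ν (ν∉ ∘ ∈-++⁺ʳ L))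

  ∘-finite : ∀ {g} (u u⁻ : P → P) → (∀ ν → u⁻ (u ν) ≡ ν) → FiniteSupport g → FiniteSupport (g ∘ u)
  ∘-finite u u⁻ inv (L , g0) = map u⁻ L , λ ν ν∉ → g0 (u ν) λ uν∈ → ν∉ (subst (_∈ map u⁻ L) (inv ν) (∈-map⁺ u⁻ uν∈))

  ⊕-⊝ : ∀ (x y : P) → (x ⊕ y) ⊝ y ≡ x
  ⊕-⊝ x y = vec-ext λ r → trans (⊝-at (x ⊕ y) y r) (trans (cong (_- lookup y r) (⊕-at x y r)) (arith (lookup x r) (lookup y r)))
    where
    arith : ∀ a b → a + b - b ≡ a
    arith = solve-∀

  Δ-finite : ∀ {g} β → FiniteSupport g → FiniteSupport (Δ β g)
  Δ-finite β fin = minus-finite fin (∘-finite (_⊕ β) (_⊝ β) (λ ν → ⊕-⊝ ν β) fin)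

  -- The difference of `g` and `h` is periodic under β and has finite support. Pairing with γ grows
  -- along the translates by β, so they leave the support.
  Δ-injective : ∀ γ {β} → 0ℤ < ⟨ γ , β ⟩ → ∀ {g h} → FiniteSupport g → FiniteSupport h →
                (∀ ν → Δ β g ν ≡ Δ β h ν) → ∀ ν → g ν ≡ h ν
  Δ-injective γ {β} pos {g} {h} g-fin h-fin eq ν = ℤ.i-j≡0⇒i≡j (g ν) (h ν) (vanish (minus-finite g-fin h-fin))
    where
    d : P → ℤ
    d ν = g ν - h ν

    periodic : ∀ ν → d ν ≡ d (ν ⊕ β)
    periodic ν = trans (lhs (g ν) (h ν) (g (ν ⊕ β))) (trans (cong (λ t → t + (g (ν ⊕ β) - h ν)) (eq ν)) (rhs (h ν) (h (ν ⊕ β)) (g (ν ⊕ β))))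
      where
      lhs : ∀ a b c → a - b ≡ (a - c) + (c - b)
      lhs = solve-∀
      rhs : ∀ b d c → (b - d) + (c - b) ≡ c - d
      rhs = solve-∀

    shift : ℕ → P → P
    shift zero    ν = ν
    shift (suc k) ν = shift k (ν ⊕ β)

    shifted : ∀ k ν → d ν ≡ d (shift k ν)
    shifted zero    ν = refl
    shifted (suc k) ν = trans (periodic ν) (shifted k (ν ⊕ β))

    shift-pairing : ∀ k ν → ⟨ γ , ν ⟩ + + k ≤ ⟨ γ , shift k ν ⟩
    shift-pairing zero    ν = ℤ.≤-reflexive (ℤ.+-identityʳ _)
    shift-pairing (suc k) ν = ℤ.≤-trans (ℤ.≤-trans (ℤ.≤-reflexive (arith ⟨ γ , ν ⟩ (+ k)))
        (ℤ.+-monoˡ-≤ (+ k) (ℤ.≤-trans (ℤ.+-monoʳ-≤ ⟨ γ , ν ⟩ (ℤ.i<j⇒suc[i]≤j pos)) (ℤ.≤-reflexive (sym (⟨,⊕⟩ γ ν β))))))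
      (shift-pairing k (ν ⊕ β))
      where
      arith : ∀ a k → a + (1ℤ + k) ≡ a + 1ℤ + k
      arith = solve-∀

    bound : ∀ (L : List P) → ∃ λ B → ∀ {μ} → μ ∈ L → ⟨ γ , μ ⟩ ≤ B
    bound []      = 0ℤ , λ ()
    bound (μ ∷ L) = let B , b = bound L in ⟨ γ , μ ⟩ ℤ.⊔ B , λ where
      (here refl) → ℤ.i≤i⊔j ⟨ γ , μ ⟩ B
      (there μ∈)  → ℤ.≤-trans (b μ∈) (ℤ.i≤j⊔i ⟨ γ , μ ⟩ B)

    vanish : FiniteSupport d → d ν ≡ 0ℤ
    vanish (L , d0) = trans (shifted k ν) (d0 (shift k ν) λ far∈ → ℤ.<⇒≱ far (proj₂ (bound L) far∈))
      where
      B = proj₁ (bound L)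
      k = suc ∣ B - ⟨ γ , ν ⟩ ∣
      i≤∣i∣ : ∀ i → i ≤ + ∣ i ∣
      i≤∣i∣ (+ n)    = ℤ.≤-refl
      i≤∣i∣ -[1+ n ] = ℤ.-≤+
      arith : ∀ m B → B ≡ m + (B - m)
      arith = solve-∀
      far : B < ⟨ γ , shift k ν ⟩
      far = ℤ.<-≤-trans (ℤ.≤-<-trans (ℤ.≤-reflexive (arith ⟨ γ , ν ⟩ B))
        (ℤ.+-monoʳ-< ⟨ γ , ν ⟩ (ℤ.≤-<-trans (i≤∣i∣ (B - ⟨ γ , ν ⟩)) (ℤ.+<+ (ℕ.n<1+n _)))))
        (shift-pairing k ν)

  Δ-comm : ∀ β γ g ν → Δ β (Δ γ g) ν ≡ Δ γ (Δ β g) ν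
  Δ-comm β γ g ν = trans (cong (λ x → g ν - g (ν ⊕ γ) - (g (ν ⊕ β) - g x)) (⊕-swap ν β γ)) (arith (g ν) (g (ν ⊕ γ)) (g (ν ⊕ β)) (g ((ν ⊕ γ) ⊕ β)))
    where
    arith : ∀ a b c d → a - b - (c - d) ≡ a - c - (b - d)
    arith = solve-∀

  private

    translate : ℤ → P → ℤ[P] → ℤ[P]
    translate k κ = map λ (b , μ) → k * b , κ ⊕ μ

    ⊝-iff : ∀ (κ μ ν : P) → κ ⊕ μ ≡ ν → μ ≡ ν ⊝ κ
    ⊝-iff κ μ .(κ ⊕ μ) refl = trans (sym (⊕-⊝ μ κ)) (cong (_⊝ κ) (⊕-comm μ κ))

    ⊝-⊕ : ∀ (x y : P) → y ⊕ (x ⊝ y) ≡ x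
    ⊝-⊕ x y = vec-ext λ r → trans (⊕-at y (x ⊝ y) r) (trans (cong (λ a → lookup y r + a) (⊝-at x y r)) (arith (lookup x r) (lookup y r)))
      where
      arith : ∀ a b → b + (a - b) ≡ a
      arith = solve-∀

    coeff-translate : ∀ k κ f ν → coeff (translate k κ f) ν ≡ k * coeff f (ν ⊝ κ)
    coeff-translate k κ []            ν = sym (ℤ.*-zeroʳ k)
    coeff-translate k κ ((b , μ) ∷ f) ν = trans (cong₂ _+_
      (trans ([]-iff ((κ ⊕ μ) ≟ᴾ ν) (μ ≟ᴾ (ν ⊝ κ)) (⊝-iff κ μ ν) (λ { refl → ⊝-⊕ ν κ })) (pull (μ ≟ᴾ (ν ⊝ κ))))
      (coeff-translate k κ f ν)) (sym (ℤ.*-distribˡ-+ k ([ μ ≟ᴾ (ν ⊝ κ) ] b) _))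
      where
      pull : ∀ {X : Set} (d : Dec X) → [ d ] (k * b) ≡ k * [ d ] b
      pull (yes _) = refl
      pull (no _)  = sym (ℤ.*-zeroʳ k)

    coeff-1−e^− : ∀ i f ν → coeff (1−e^− i ⊛ f) ν ≡ Δ (α i) (coeff f) ν
    coeff-1−e^− i f ν = begin
      coeff (translate 1ℤ 𝟎 f ++ (translate -1ℤ (⊖ α i) f ++ [])) ν
        ≡⟨ sumWhere-++ (_≟ᴾ ν) (translate 1ℤ 𝟎 f) _ ⟩
      coeff (translate 1ℤ 𝟎 f) ν + coeff (translate -1ℤ (⊖ α i) f ++ []) ν
        ≡⟨ cong₂ _+_ (coeff-translate 1ℤ 𝟎 f ν)
             (trans (sumWhere-++ (_≟ᴾ ν) (translate -1ℤ (⊖ α i) f) []) (cong (_+ 0ℤ) (coeff-translate -1ℤ (⊖ α i) f ν))) ⟩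
      1ℤ * coeff f (ν ⊝ 𝟎) + (-1ℤ * coeff f (ν ⊝ (⊖ α i)) + 0ℤ)
        ≡⟨ cong₂ (λ x y → 1ℤ * coeff f x + (-1ℤ * coeff f y + 0ℤ)) (vec-ext minus-zero) (vec-ext minus-minus) ⟩
      1ℤ * coeff f ν + (-1ℤ * coeff f (ν ⊕ α i) + 0ℤ)
        ≡⟨ arith (coeff f ν) (coeff f (ν ⊕ α i)) ⟩
      coeff f ν - coeff f (ν ⊕ α i) ∎
      where
      open ≡-Reasoning
      arith : ∀ a b → 1ℤ * a + (-1ℤ * b + 0ℤ) ≡ a - b
      arith = solve-∀
      minus-zero : ∀ r → lookup (ν ⊝ 𝟎) r ≡ lookup ν r
      minus-zero r = trans (⊝-at ν 𝟎 r) (trans (cong (λ a → lookup ν r - a) (Vec.lookup-replicate r 0ℤ)) (ℤ.+-identityʳ _))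
      minus-minus : ∀ r → lookup (ν ⊝ (⊖ α i)) r ≡ lookup (ν ⊕ α i) r
      minus-minus r = trans (⊝-at ν _ r) (trans (cong (λ a → lookup ν r - a) (⊖-at (α i) r))
        (trans (cong (λ a → lookup ν r + a) (ℤ.neg-involutive _)) (sym (⊕-at ν (α i) r))))

  coeff-∷ : ∀ a μ f ν → coeff ((a , μ) ∷ f) ν ≡ a * coeff (e^ μ) ν + coeff f ν
  coeff-∷ a μ f ν with does (μ ≟ᴾ ν)
  ... | true  = cong (_+ coeff f ν) (sym (ℤ.*-identityʳ a))
  ... | false = cong (_+ coeff f ν) (sym (ℤ.*-zeroʳ a))

  coeff-π-e^ : ∀ i μ ν → coeff (π i (e^ μ)) ν ≡ coeff (geometric (α i) μ (⟨ α∨ i , μ ⟩ + 1ℤ)) ν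
  coeff-π-e^ i μ ν = trans (sumWhere-++ (_≟ᴾ ν) (scale 1ℤ (geometric (α i) μ (⟨ α∨ i , μ ⟩ + 1ℤ))) []) (trans (ℤ.+-identityʳ _)
    (trans (sumWhere-scale (_≟ᴾ ν) 1ℤ (geometric (α i) μ (⟨ α∨ i , μ ⟩ + 1ℤ))) (ℤ.*-identityˡ _)))

  coeff-π-∷ : ∀ i a μ f ν → coeff (π i ((a , μ) ∷ f)) ν ≡ a * coeff (π i (e^ μ)) ν + coeff (π i f) ν
  coeff-π-∷ i a μ f ν = trans (sumWhere-++ (_≟ᴾ ν) (scale a (geometric (α i) μ (⟨ α∨ i , μ ⟩ + 1ℤ))) (π i f)) (cong (_+ coeff (π i f) ν)
    (trans (sumWhere-scale (_≟ᴾ ν) a (geometric (α i) μ (⟨ α∨ i , μ ⟩ + 1ℤ))) (cong (a *_) (sym (coeff-π-e^ i μ ν)))))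

  coeff-e^-t : ∀ i μ ν → coeff (e^ (s i μ ⊝ α i)) ν ≡ coeff (e^ μ) (t i ν)
  coeff-e^-t i μ ν = cong (_+ 0ℤ) ([]-iff ((s i μ ⊝ α i) ≟ᴾ ν) (μ ≟ᴾ t i ν)
    (λ eq → trans (sym (reflect-involutive 1ℤ i μ)) (cong (t i) (trans (sym same) eq)))
    (λ eq → trans same (trans (cong (t i) eq) (reflect-involutive 1ℤ i ν))))
    where
    arith : ∀ x p a → x - p * a - a ≡ x - (p + 1ℤ) * a
    arith = solve-∀
    same : s i μ ⊝ α i ≡ t i μ
    same = vec-ext λ r → trans (⊝-at (s i μ) (α i) r) (trans (cong (_- lookup (α i) r)
      (trans (⊝-at μ (⟨ α∨ i , μ ⟩ • α i) r) (cong (λ a → lookup μ r - a) (•-at ⟨ α∨ i , μ ⟩ (α i) r))))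
      (trans (arith (lookup μ r) ⟨ α∨ i , μ ⟩ (lookup (α i) r)) (sym (reflect-at 1ℤ i μ r))))

  -- The quotient formula extended by linearity: `coeff f (t i ν)` is the coefficient of e^(-α_i)
  -- s_i f at ν. Since `Δ` can be cancelled, this determines π_i f, and the relations between the
  -- operators are derived from it.
  π-equation : ∀ i f ν → Δ (α i) (coeff (π i f)) ν ≡ coeff f ν - coeff f (t i ν)
  π-equation i []            ν = refl
  π-equation i ((a , μ) ∷ f) ν = begin
    coeff (π i ((a , μ) ∷ f)) ν - coeff (π i ((a , μ) ∷ f)) (ν ⊕ α i)
      ≡⟨ cong₂ _-_ (coeff-π-∷ i a μ f ν) (coeff-π-∷ i a μ f (ν ⊕ α i)) ⟩
    a * k ν + coeff (π i f) ν - (a * k (ν ⊕ α i) + coeff (π i f) (ν ⊕ α i))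
      ≡⟨ arith a (k ν) _ (k (ν ⊕ α i)) _ ⟩
    a * Δ (α i) k ν + Δ (α i) (coeff (π i f)) ν
      ≡⟨ cong₂ (λ x y → a * x + y) single (π-equation i f ν) ⟩
    a * (coeff (e^ μ) ν - coeff (e^ μ) (t i ν)) + (coeff f ν - coeff f (t i ν))
      ≡⟨ arith a (coeff (e^ μ) ν) _ (coeff (e^ μ) (t i ν)) _ ⟨
    a * coeff (e^ μ) ν + coeff f ν - (a * coeff (e^ μ) (t i ν) + coeff f (t i ν))
      ≡⟨ cong₂ _-_ (coeff-∷ a μ f ν) (coeff-∷ a μ f (t i ν)) ⟨
    coeff ((a , μ) ∷ f) ν - coeff ((a , μ) ∷ f) (t i ν) ∎
    where
    open ≡-Reasoning
    k = coeff (π i (e^ μ))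
    arith : ∀ a x y z w → a * x + y - (a * z + w) ≡ a * (x - z) + (y - w)
    arith = solve-∀
    single : Δ (α i) k ν ≡ coeff (e^ μ) ν - coeff (e^ μ) (t i ν)
    single = trans (sym (coeff-1−e^− i (π i (e^ μ)) ν)) (trans (π-quotient i μ ν)
      (trans (sumWhere-++ (_≟ᴾ ν) (e^ μ) (scale -1ℤ (e^ (s i μ ⊝ α i))))
        (cong (λ n → coeff (e^ μ) ν + n) (trans (sumWhere-scale (_≟ᴾ ν) -1ℤ (e^ (s i μ ⊝ α i)))
          (trans (ℤ.-1*i≡-i _) (cong -_ (coeff-e^-t i μ ν)))))))

  positive-αα : ∀ i → 0ℤ < ⟨ α∨ i , α i ⟩
  positive-αα i = subst (0ℤ <_) (sym (αα i)) (ℤ.+<+ (s≤s z≤n))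

  π-determined : ∀ i f h → FiniteSupport h → (∀ ν → Δ (α i) h ν ≡ coeff f ν - coeff f (t i ν)) →
                 ∀ ν → coeff (π i f) ν ≡ h ν
  π-determined i f h fin eq = Δ-injective (α∨ i) (positive-αα i) (coeff-finite (π i f)) fin
    λ ν → trans (π-equation i f ν) (sym (eq ν))

  π-cong : ∀ i {f g} → f ≈ᴾ g → π i f ≈ᴾ π i g
  π-cong i {f} {g} eq = π-determined i f (coeff (π i g)) (coeff-finite (π i g))
    λ ν → trans (π-equation i g ν) (cong₂ _-_ (sym (eq ν)) (sym (eq (t i ν))))

  -- As `t i ν` equals s_i (ν + α_i), this is invariance of π_i f under s_i. It holds because the
  -- right-hand side of `π-equation` changes sign under `t i`.
  π-invariant : ∀ i f ν → coeff (π i f) (t i ν) ≡ coeff (π i f) (ν ⊕ α i)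
  π-invariant i f = Δ-injective (α∨ i) (positive-αα i)
      (∘-finite (t i) (t i) (reflect-involutive 1ℤ i) (coeff-finite (π i f)))
      (∘-finite (_⊕ α i) (_⊝ α i) (λ ν → ⊕-⊝ ν (α i)) (coeff-finite (π i f)))
    λ ν → begin
      k (t i ν) - k (t i (ν ⊕ α i))
        ≡⟨ cong (λ x → k x - k (t i (ν ⊕ α i))) (sym (t-lower i ν)) ⟩
      k (t i (ν ⊕ α i) ⊕ α i) - k (t i (ν ⊕ α i))
        ≡⟨ flipped (k (t i (ν ⊕ α i) ⊕ α i)) _ ⟩
      - Δ (α i) k (t i (ν ⊕ α i))
        ≡⟨ cong -_ (trans (π-equation i f (t i (ν ⊕ α i))) (cong (λ x → coeff f (t i (ν ⊕ α i)) - coeff f x) (reflect-involutive 1ℤ i (ν ⊕ α i)))) ⟩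
      - (coeff f (t i (ν ⊕ α i)) - coeff f (ν ⊕ α i))
        ≡⟨ flipped (coeff f (ν ⊕ α i)) _ ⟨
      coeff f (ν ⊕ α i) - coeff f (t i (ν ⊕ α i))
        ≡⟨ π-equation i f (ν ⊕ α i) ⟨
      k (ν ⊕ α i) - k ((ν ⊕ α i) ⊕ α i) ∎
    where
    open ≡-Reasoning
    k = coeff (π i f)
    flipped : ∀ a b → a - b ≡ - (b - a)
    flipped = solve-∀

  -- By invariance π_i f satisfies the equation that determines π_i of itself.
  π-idempotent : ∀ i f → π i (π i f) ≈ᴾ π i f
  π-idempotent i f = π-determined i (π i f) (coeff (π i f)) (coeff-finite (π i f))
    λ ν → cong (λ x → coeff (π i f) ν - x) (sym (π-invariant i f ν))

  -- Multiplied by (1 - e^(-α_i))(1 - e^(-α_j)), both sides become the alternating sum of the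
  -- shifted action of s_i and s_j on `f`, as they commute.
  π-comm : ∀ i j f → ⟨ α∨ i , α j ⟩ ≡ 0ℤ → π i (π j f) ≈ᴾ π j (π i f)
  π-comm i j f eq = Δ-injective (α∨ i) (positive-αα i) (coeff-finite (π i (π j f))) (coeff-finite (π j (π i f)))
    (Δ-injective (α∨ j) (positive-αα j) (Δ-finite (α i) (coeff-finite (π i (π j f)))) (Δ-finite (α i) (coeff-finite (π j (π i f))))
      λ ν → trans (alternating i j eq ν) (trans (symmetric ν) (sym (trans (Δ-comm (α j) (α i) (coeff (π j (π i f))) ν) (alternating j i eq′ ν)))))
    where
    eq′ = trans (cartan-symmetric j i) eq
    A : I → I → P → ℤ
    A i j ν = coeff f ν - coeff f (t j ν) - (coeff f (t i ν) - coeff f (t j (t i ν)))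
    symmetric : ∀ ν → A i j ν ≡ A j i ν
    symmetric ν = trans (cong (λ x → coeff f ν - coeff f (t j ν) - (coeff f (t i ν) - coeff f x)) (reflect-comm 1ℤ i j ν eq))
      (arith (coeff f ν) _ _ _)
      where
      arith : ∀ a b c d → a - b - (c - d) ≡ a - c - (b - d)
      arith = solve-∀
    alternating : ∀ i j → ⟨ α∨ i , α j ⟩ ≡ 0ℤ → ∀ ν → Δ (α j) (Δ (α i) (coeff (π i (π j f)))) ν ≡ A i j ν
    alternating i j eq ν = begin
      Δ (α i) (coeff (π i (π j f))) ν - Δ (α i) (coeff (π i (π j f))) (ν ⊕ α j)
        ≡⟨ cong₂ _-_ (π-equation i (π j f) ν) (π-equation i (π j f) (ν ⊕ α j)) ⟩
      k ν - k (t i ν) - (k (ν ⊕ α j) - k (t i (ν ⊕ α j)))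
        ≡⟨ cong (λ x → k ν - k (t i ν) - (k (ν ⊕ α j) - k x)) (t-⊕-orthogonal i j ν eq) ⟩
      k ν - k (t i ν) - (k (ν ⊕ α j) - k (t i ν ⊕ α j))
        ≡⟨ arith (k ν) _ _ _ ⟩
      Δ (α j) k ν - Δ (α j) k (t i ν)
        ≡⟨ cong₂ _-_ (π-equation j f ν) (π-equation j f (t i ν)) ⟩
      A i j ν ∎
      where
      open ≡-Reasoning
      k = coeff (π j f)
      arith : ∀ a b c d → a - b - (c - d) ≡ a - c - (b - d)
      arith = solve-∀

  -- Multiplied by (1 − e^(−α i))(1 − e^(−α j))(1 − e^(−α i − α j)), both sides
  -- become the alternating sum of the ρ-shifted action of ⟨s i, s j⟩ on f.
  π-braid : ∀ i j f → ⟨ α∨ i , α j ⟩ ≡ -1ℤ → π i (π j (π i f)) ≈ᴾ π j (π i (π j f))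
  π-braid i j f eq =
    Δ-injective (α∨ i) (positive-αα i) lhs-fin rhs-fin
    (Δ-injective (α∨ i) pos-sum (Δ-finite (α i) lhs-fin) (Δ-finite (α i) rhs-fin)
    (Δ-injective (α∨ j) (positive-αα j) (Δ-finite (α i ⊕ α j) (Δ-finite (α i) lhs-fin)) (Δ-finite (α i ⊕ α j) (Δ-finite (α i) rhs-fin))
      λ ν → trans (alternating i j eq ν) (trans (symmetric ν) (sym (trans (reorder (coeff (π j (π i (π j f)))) ν) (alternating j i eq′ ν))))))
    where
    open ≡-Reasoning
    eq′ = trans (cartan-symmetric j i) eq
    lhs-fin = coeff-finite (π i (π j (π i f)))
    rhs-fin = coeff-finite (π j (π i (π j f)))
    pos-sum : 0ℤ < ⟨ α∨ i , α i ⊕ α j ⟩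
    pos-sum = subst (0ℤ <_) (sym (trans (⟨,⊕⟩ (α∨ i) (α i) (α j)) (cong₂ _+_ (αα i) eq))) (ℤ.+<+ (s≤s z≤n))

    Δ-cong : ∀ β {g h : P → ℤ} → (∀ ν → g ν ≡ h ν) → ∀ ν → Δ β g ν ≡ Δ β h ν
    Δ-cong β eq ν = cong₂ _-_ (eq ν) (eq (ν ⊕ β))

    reorder : ∀ g ν → Δ (α j) (Δ (α i ⊕ α j) (Δ (α i) g)) ν ≡ Δ (α i) (Δ (α j ⊕ α i) (Δ (α j) g)) ν
    reorder g ν = trans (cong (λ β → Δ (α j) (Δ β (Δ (α i) g)) ν) (⊕-comm (α i) (α j)))
      (trans (Δ-cong (α j) (Δ-comm (α j ⊕ α i) (α i) g) ν)
        (trans (Δ-comm (α j) (α i) (Δ (α j ⊕ α i) g) ν)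
          (Δ-cong (α i) (Δ-comm (α j) (α j ⊕ α i) g) ν)))

    A : I → I → P → ℤ
    A i j ν = coeff f ν - coeff f (t i ν) - (coeff f (t j ν) - coeff f (t i (t j ν)))
                + (coeff f (t j (t i ν)) - coeff f (t i (t j (t i ν))))

    symmetric : ∀ ν → A i j ν ≡ A j i ν
    symmetric ν = trans (cong (λ x → coeff f ν - coeff f (t i ν) - (coeff f (t j ν) - coeff f (t i (t j ν)))
                + (coeff f (t j (t i ν)) - coeff f x)) (reflect-braid 1ℤ i j ν eq)) (arith (coeff f ν) _ _ _ _ _)
      where
      arith : ∀ a b c d e g → a - b - (c - d) + (e - g) ≡ a - c - (b - e) + (d - g)
      arith = solve-∀

    alternating : ∀ i j → ⟨ α∨ i , α j ⟩ ≡ -1ℤ → ∀ ν →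
      Δ (α j) (Δ (α i ⊕ α j) (Δ (α i) (coeff (π i (π j (π i f)))))) ν ≡ A i j ν
    alternating i j eq ν = begin
      Δ (α j) (Δ β (Δ (α i) (coeff (π i (π j (π i f)))))) ν
        ≡⟨ Δ-cong (α j) (Δ-cong β (π-equation i (π j (π i f)))) ν ⟩
      Δ (α j) (Δ β (λ ν → g ν - g (t i ν))) ν
        ≡⟨ cong₂ _-_ (cong (λ x → g ν - g (t i ν) - (g (ν ⊕ β) - g x)) (t-⊕-sum i j ν eq))
             (cong₂ (λ x y → g (ν ⊕ α j) - g x - (g (ν ⊕ α j ⊕ β) - g y)) (t-⊕-adjacent i j ν eq)
               (trans (t-⊕-sum i j (ν ⊕ α j) eq) (cong (_⊕ α j) (t-⊕-adjacent i j ν eq)))) ⟩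
      g ν - g (t i ν) - (g (ν ⊕ β) - g (t i ν ⊕ α j)) -
      (g (ν ⊕ α j) - g (t i ν ⊕ β) - (g (ν ⊕ α j ⊕ β) - g (t i ν ⊕ β ⊕ α j)))
        ≡⟨ cong (λ x → g ν - g (t i ν) - (g (ν ⊕ β) - g (t i ν ⊕ α j)) -
             (g (ν ⊕ α j) - g (t i ν ⊕ β) - (g x - g (t i ν ⊕ β ⊕ α j)))) (⊕-swap ν (α j) β) ⟩
      g ν - g (t i ν) - (g (ν ⊕ β) - g (t i ν ⊕ α j)) -
      (g (ν ⊕ α j) - g (t i ν ⊕ β) - (g (ν ⊕ β ⊕ α j) - g (t i ν ⊕ β ⊕ α j)))
        ≡⟨ arith₁ (g ν) (g (t i ν)) (g (ν ⊕ β)) (g (t i ν ⊕ α j)) (g (ν ⊕ α j)) (g (t i ν ⊕ β)) (g (ν ⊕ β ⊕ α j)) (g (t i ν ⊕ β ⊕ α j)) ⟩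
      Δ β (Δ (α j) g) ν - Δ β (Δ (α j) g) (t i ν)
        ≡⟨ cong₂ _-_ (Q ν) (Q (t i ν)) ⟩
      (k ν - k (ν ⊕ β) - (coeff f (t j ν) - coeff f (t i (t j ν)))) -
      (k (t i ν) - k (t i ν ⊕ β) - (coeff f (t j (t i ν)) - coeff f (t i (t j (t i ν)))))
        ≡⟨ cong₂ (λ x y → (k ν - k (ν ⊕ β) - (coeff f (t j ν) - coeff f (t i (t j ν)))) -
             (x - y - (coeff f (t j (t i ν)) - coeff f (t i (t j (t i ν)))))) (π-invariant i f ν) k-sum ⟩
      (k ν - k (ν ⊕ β) - (coeff f (t j ν) - coeff f (t i (t j ν)))) -
      (k (ν ⊕ α i) - k (ν ⊕ β) - (coeff f (t j (t i ν)) - coeff f (t i (t j (t i ν)))))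
        ≡⟨ arith₂ (k ν) (k (ν ⊕ β)) _ (k (ν ⊕ α i)) _ ⟩
      Δ (α i) k ν - (coeff f (t j ν) - coeff f (t i (t j ν))) + (coeff f (t j (t i ν)) - coeff f (t i (t j (t i ν))))
        ≡⟨ cong (λ x → x - (coeff f (t j ν) - coeff f (t i (t j ν))) + (coeff f (t j (t i ν)) - coeff f (t i (t j (t i ν))))) (π-equation i f ν) ⟩
      A i j ν ∎
      where
      β = α i ⊕ α j
      k = coeff (π i f)
      g = coeff (π j (π i f))
      arith₁ : ∀ a b c d e f g h → a - b - (c - d) - (e - f - (g - h)) ≡ (a - e - (c - g)) - (b - d - (f - h))
      arith₁ = solve-∀
      arith₂ : ∀ a b c d e → (a - b - c) - (d - b - e) ≡ a - d - c + e
      arith₂ = solve-∀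
      arith₃ : ∀ a b c d → a - b - (c - d) ≡ a - c - (b - d)
      arith₃ = solve-∀
      -- Invariance of `k` = π_i f under s_i makes two of the terms cancel and turns what is left of
      -- `k` into `Δ (α i) k`.
      k-sum : k (t i ν ⊕ β) ≡ k (ν ⊕ β)
      k-sum = trans (cong k (sym (t-⊕-adjacent i j ν eq))) (trans (π-invariant i f (ν ⊕ α j))
        (cong k (trans (⊕-assoc ν (α j) (α i)) (cong (ν ⊕_) (⊕-comm (α j) (α i))))))
      t-β : ∀ μ → t j (μ ⊕ β) ≡ t j μ ⊕ α i
      t-β μ = trans (cong (λ x → t j (μ ⊕ x)) (⊕-comm (α i) (α j))) (t-⊕-sum j i μ (trans (cartan-symmetric j i) eq))
      Q : ∀ μ → Δ β (Δ (α j) g) μ ≡ k μ - k (μ ⊕ β) - (coeff f (t j μ) - coeff f (t i (t j μ)))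
      Q μ = trans (Δ-cong β (π-equation j (π i f)) μ) (trans (cong (λ x → k μ - k (t j μ) - (k (μ ⊕ β) - k x)) (t-β μ))
        (trans (arith₃ (k μ) _ _ _) (cong (λ x → k μ - k (μ ⊕ β) - x) (π-equation i f (t j μ)))))

-- The exchange property

module Exchange (𝒮 : Setting) where

  open Setting 𝒮
  open Weights 𝒮
  open Monomials 𝒮 using (vec-ext)
  open DemazureOperators 𝒮

  ⊖-• : ∀ {m} k (x : Vec ℤ m) → (- k) • x ≡ ⊖ (k • x)
  ⊖-• k []      = refl
  ⊖-• k (a ∷ x) = cong₂ _∷_ (sym (ℤ.neg-distribˡ-* k a)) (⊖-• k x)

  ⊖-⊕ : ∀ {m} (x y : Vec ℤ m) → ⊖ (x ⊕ y) ≡ (⊖ x) ⊕ (⊖ y)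
  ⊖-⊕ []      []      = refl
  ⊖-⊕ (a ∷ x) (b ∷ y) = cong₂ _∷_ (ℤ.neg-distrib-+ a b) (⊖-⊕ x y)

  ⊖-involutive : ∀ {m} (x : Vec ℤ m) → ⊖ (⊖ x) ≡ x
  ⊖-involutive []      = refl
  ⊖-involutive (a ∷ x) = cong₂ _∷_ (ℤ.neg-involutive a) (⊖-involutive x)

  ⊖-inverse : ∀ {m} (x : Vec ℤ m) → x ⊕ (⊖ x) ≡ 𝟎
  ⊖-inverse []      = refl
  ⊖-inverse (a ∷ x) = cong₂ _∷_ (ℤ.+-inverseʳ a) (⊖-inverse x)

  𝟎-⊕ : ∀ {m} (x : Vec ℤ m) → 𝟎 ⊕ x ≡ x
  𝟎-⊕ []      = refl
  𝟎-⊕ (a ∷ x) = cong₂ _∷_ (ℤ.+-identityˡ a) (𝟎-⊕ x)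

  0• : ∀ {m} (x : Vec ℤ m) → 0ℤ • x ≡ 𝟎
  0• []      = refl
  0• (a ∷ x) = cong (0ℤ ∷_) (0• x)

  1• : ∀ {m} (x : Vec ℤ m) → 1ℤ • x ≡ x
  1• []      = refl
  1• (a ∷ x) = cong₂ _∷_ (ℤ.*-identityˡ a) (1• x)

  +-• : ∀ {m} k l (x : Vec ℤ m) → (k + l) • x ≡ k • x ⊕ l • x
  +-• k l []      = refl
  +-• k l (a ∷ x) = cong₂ _∷_ (ℤ.*-distribʳ-+ a k l) (+-• k l x)

  ⊕-interchange : ∀ {m} (a b c d : Vec ℤ m) → (a ⊕ b) ⊕ (c ⊕ d) ≡ (a ⊕ c) ⊕ (b ⊕ d)
  ⊕-interchange []      []      []      []      = refl
  ⊕-interchange (a ∷ x) (b ∷ y) (c ∷ u) (d ∷ v) = cong₂ _∷_ (interchangeℤ a b c d) (⊕-interchange x y u v)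

  combination-+ : ∀ {k m} (c d : Fin k → ℤ) (v : Fin k → Vec ℤ m) →
                  combination (λ i → c i + d i) v ≡ combination c v ⊕ combination d v
  combination-+ {zero}  c d v = sym (𝟎-⊕ 𝟎)
  combination-+ {suc k} c d v = trans (cong₂ _⊕_ (+-• (c zero) (d zero) (v zero)) (combination-+ (c ∘ suc) (d ∘ suc) (v ∘ suc)))
    (⊕-interchange (c zero • v zero) (d zero • v zero) (combination (c ∘ suc) (v ∘ suc)) (combination (d ∘ suc) (v ∘ suc)))

  combination-0 : ∀ {k m} (c : Fin k → ℤ) (v : Fin k → Vec ℤ m) → (∀ i → c i ≡ 0ℤ) → combination c v ≡ 𝟎
  combination-0 {zero}  c v h = refl
  combination-0 {suc k} c v h = trans (cong₂ _⊕_ (trans (cong (_• v zero) (h zero)) (0• (v zero))) (combination-0 (c ∘ suc) (v ∘ suc) (h ∘ suc))) (𝟎-⊕ 𝟎)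

  indicator : ∀ {k} → Fin k → Fin k → ℕ
  indicator i j = if does (i Fin.≟ j) then 1 else 0

  combination-indicator : ∀ {k m} (i : Fin k) (v : Fin k → Vec ℤ m) → combination (+_ ∘ indicator i) v ≡ v i
  combination-indicator {suc k} zero v = trans (cong₂ _⊕_ (1• (v zero)) (combination-0 (+_ ∘ indicator {suc k} zero ∘ suc) (v ∘ suc) (λ _ → refl)))
    (trans (⊕-comm′ (v zero) 𝟎) (𝟎-⊕ (v zero)))
    where
    ⊕-comm′ : ∀ {m} (x y : Vec ℤ m) → x ⊕ y ≡ y ⊕ x
    ⊕-comm′ = Vec.zipWith-comm ℤ.+-comm
  combination-indicator {suc k} (suc i) v = trans (cong₂ _⊕_ (0• (v zero))
    (trans (combination-cong (+_ ∘ indicator (suc i) ∘ suc) (+_ ∘ indicator i) (v ∘ suc) (λ j → cong +_ (same j))) (combination-indicator i (v ∘ suc))))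
    (𝟎-⊕ (v (suc i)))
    where
    combination-cong : ∀ {k m} (c d : Fin k → ℤ) (v : Fin k → Vec ℤ m) → (∀ j → c j ≡ d j) → combination c v ≡ combination d v
    combination-cong {zero}  c d v h = refl
    combination-cong {suc k} c d v h = cong₂ _⊕_ (cong (_• v zero) (h zero)) (combination-cong (c ∘ suc) (d ∘ suc) (v ∘ suc) (h ∘ suc))
    same : ∀ j → indicator (suc i) (suc j) ≡ indicator i j
    same j with i Fin.≟ j
    ... | yes _ = refl
    ... | no  _ = refl

  Positive Negative IsRoot : P → Set
  Positive x = ∃ λ (c : I → ℕ) → x ≡ combination (+_ ∘ c) α
  Negative x = ∃ λ (c : I → ℕ) → x ≡ ⊖ combination (+_ ∘ c) α
  IsRoot x = ∃ λ b → root b ≡ x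

  sign : ∀ {x} → IsRoot x → Positive x ⊎ Negative x
  sign (b , refl) = let c , s = base b in [ (λ eq → inj₁ (c , eq)) , (λ eq → inj₂ (c , eq)) ]′ s

  positive-⊕ : ∀ {x y} → Positive x → Positive y → Positive (x ⊕ y)
  positive-⊕ (c , refl) (d , refl) = (λ i → c i ℕ.+ d i) , sym (combination-+ (+_ ∘ c) (+_ ∘ d) α)

  root-≢𝟎 : ∀ {x} → IsRoot x → x ≢ 𝟎
  root-≢𝟎 (b , refl) eq = contradiction (trans (sym (pairing-two b)) (trans (cong ⟨ coroot b ,_⟩ eq) (pairing-𝟎 (coroot b)))) λ ()
    where
    pairing-𝟎 : ∀ {m} (x : Vec ℤ m) → ⟨ x , 𝟎 ⟩ ≡ 0ℤ
    pairing-𝟎 []      = refl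
    pairing-𝟎 (a ∷ x) = cong₂ _+_ (ℤ.*-zeroʳ a) (pairing-𝟎 x)

  sign-exclusive : ∀ {x} → IsRoot x → Positive x → ¬ Negative x
  sign-exclusive is-root (c , refl) (d , eq) = root-≢𝟎 is-root (combination-0 (+_ ∘ c) α λ i → cong +_ (ℕ.m+n≡0⇒m≡0 (c i) (ℤ.+-injective (zero-sum i))))
    where
    zero-sum : ∀ i → + (c i ℕ.+ d i) ≡ 0ℤ
    zero-sum = independent _ (trans (combination-+ (+_ ∘ c) (+_ ∘ d) α) (trans (cong (_⊕ combination (+_ ∘ d) α) eq)
      (trans (⊕-comm _ (combination (+_ ∘ d) α)) (⊖-inverse (combination (+_ ∘ d) α)))))

  positive-⊖ : ∀ {x} → Positive x → Negative (⊖ x)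
  positive-⊖ (c , refl) = c , refl

  α-root : ∀ i → IsRoot (α i)
  α-root i = simple i , refl

  α-positive : ∀ i → Positive (α i)
  α-positive i = indicator i , sym (combination-indicator i α)

  s-⊕ : ∀ i x y → s i (x ⊕ y) ≡ s i x ⊕ s i y
  s-⊕ i x y = trans (s-reflect i (x ⊕ y)) (trans (reflect-⊕ 0ℤ i x y refl) (cong (_⊕ s i y) (sym (s-reflect i x))))

  s-⊖ : ∀ i x → s i (⊖ x) ≡ ⊖ s i x
  s-⊖ i x = trans (cong (λ k → (⊖ x) ⊝ k • α i) (⟨,⊖⟩ (α∨ i) x))
    (trans (cong (λ y → (⊖ x) ⊕ (⊖ y)) (⊖-• ⟨ α∨ i , x ⟩ (α i))) (sym (⊖-⊕ x _)))

  s-involutive : ∀ i x → s i (s i x) ≡ x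
  s-involutive i x = trans (s-reflect i (s i x)) (trans (cong (reflect 0ℤ i) (s-reflect i x)) (reflect-involutive 0ℤ i x))

  s-comm : ∀ i j x → ⟨ α∨ i , α j ⟩ ≡ 0ℤ → s j (s i x) ≡ s i (s j x)
  s-comm i j x eq = trans (trans (s-reflect j (s i x)) (cong (reflect 0ℤ j) (s-reflect i x)))
    (trans (reflect-comm 0ℤ i j x eq) (sym (trans (s-reflect i (s j x)) (cong (reflect 0ℤ i) (s-reflect j x)))))

  s³-reflect : ∀ i j k x → s i (s j (s k x)) ≡ reflect 0ℤ i (reflect 0ℤ j (reflect 0ℤ k x))
  s³-reflect i j k x = trans (s-reflect i (s j (s k x))) (cong (reflect 0ℤ i)
    (trans (s-reflect j (s k x)) (cong (reflect 0ℤ j) (s-reflect k x))))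

  s-braid : ∀ i j x → ⟨ α∨ i , α j ⟩ ≡ -1ℤ → s i (s j (s i x)) ≡ s j (s i (s j x))
  s-braid i j x eq = trans (s³-reflect i j i x) (trans (reflect-braid 0ℤ i j x eq) (sym (s³-reflect j i j x)))

  s-α-self : ∀ i → s i (α i) ≡ ⊖ α i
  s-α-self i = trans (cong (λ k → α i ⊝ k • α i) (αα i)) (trans (cong (λ y → α i ⊕ (⊖ y)) (trans (+-• 1ℤ 1ℤ (α i)) (cong₂ _⊕_ (1• (α i)) (1• (α i)))))
    (trans (cong (α i ⊕_) (⊖-⊕ (α i) (α i))) (trans (sym (⊕-assoc (α i) (⊖ α i) (⊖ α i))) (trans (cong (_⊕ (⊖ α i)) (⊖-inverse (α i))) (𝟎-⊕ (⊖ α i))))))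

  s-α-orthogonal : ∀ i j → ⟨ α∨ j , α i ⟩ ≡ 0ℤ → s j (α i) ≡ α i
  s-α-orthogonal i j eq = trans (cong (λ k → α i ⊝ k • α j) eq) (⊝-0• (α i) (α j))

  s-α-adjacent : ∀ i j → ⟨ α∨ j , α i ⟩ ≡ -1ℤ → s j (α i) ≡ α i ⊕ α j
  s-α-adjacent i j eq = trans (cong (λ k → α i ⊝ k • α j) eq) (⊝--1• (α i) (α j))

  -- Reversed words, as the exchange happens at the right end of a word.
  actʳ : Word → P → P
  actʳ []      x = x
  actʳ (i ∷ r) x = actʳ r (s i x)

  πʳ : Word → ℤ[P] → ℤ[P]
  πʳ []      f = f
  πʳ (i ∷ r) f = πʳ r (π i f)

  act-++ : ∀ u v x → act (u ++ v) x ≡ act u (act v x)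
  act-++ []      v x = refl
  act-++ (i ∷ u) v x = cong (s i) (act-++ u v x)

  π-word-++ : ∀ u v f → π-word (u ++ v) f ≡ π-word u (π-word v f)
  π-word-++ []      v f = refl
  π-word-++ (i ∷ u) v f = cong (π i) (π-word-++ u v f)

  act-reverse : ∀ r x → act (reverse r) x ≡ actʳ r x
  act-reverse []      x = refl
  act-reverse (i ∷ r) x = trans (cong (λ w → act w x) (List.unfold-reverse i r))
    (trans (act-++ (reverse r) (i ∷ []) x) (act-reverse r (s i x)))

  π-word-reverse : ∀ r f → π-word (reverse r) f ≡ πʳ r f
  π-word-reverse []      f = refl
  π-word-reverse (i ∷ r) f = trans (cong (λ w → π-word w f) (List.unfold-reverse i r))
    (trans (π-word-++ (reverse r) (i ∷ []) f) (π-word-reverse r (π i f)))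

  actʳ-⊕ : ∀ r x y → actʳ r (x ⊕ y) ≡ actʳ r x ⊕ actʳ r y
  actʳ-⊕ []      x y = refl
  actʳ-⊕ (i ∷ r) x y = trans (cong (actʳ r) (s-⊕ i x y)) (actʳ-⊕ r (s i x) (s i y))

  actʳ-⊖ : ∀ r x → actʳ r (⊖ x) ≡ ⊖ actʳ r x
  actʳ-⊖ []      x = refl
  actʳ-⊖ (i ∷ r) x = trans (cong (actʳ r) (s-⊖ i x)) (actʳ-⊖ r (s i x))

  actʳ-root : ∀ r {x} → IsRoot x → IsRoot (actʳ r x)
  actʳ-root []      h          = h
  actʳ-root (i ∷ r) (b , refl) = actʳ-root r (reflect-root (simple i) b)

  πʳ-cong : ∀ r {f g} → f ≈ᴾ g → πʳ r f ≈ᴾ πʳ r g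
  πʳ-cong []      eq = eq
  πʳ-cong (i ∷ r) {f} {g} eq = πʳ-cong r {π i f} {π i g} (π-cong i {f} {g} eq)

  infix 4 _≈ʳ_
  _≈ʳ_ : Word → Word → Set
  u ≈ʳ v = ∀ x → actʳ u x ≡ actʳ v x

  Reducedʳ : Word → Set
  Reducedʳ r = ∀ v → v ≈ʳ r → length r ℕ.≤ length v

  reduced-tail : ∀ {j r} → Reducedʳ (j ∷ r) → Reducedʳ r
  reduced-tail {j} red v eq = ℕ.≤-pred (red (j ∷ v) λ x → eq (s j x))

  reduced-exchanged : ∀ {i r u} → Reducedʳ r → r ≈ʳ i ∷ u → length u ℕ.< length r → Reducedʳ u
  reduced-exchanged {i} red eq lt v eqv = ℕ.≤-pred (ℕ.≤-trans lt (red (i ∷ v) λ x → trans (eqv (s i x)) (sym (eq x))))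

  -- The first letter acts first, so `i ∷ rest` is rest after s_i. The statement on π is confined to
  -- reduced words: the π_i satisfy the braid relations, but are idempotent where the s_i are
  -- involutions.
  record Exchanged (i : I) (r : Word) : Set where
    field
      rest    : Word
      shorter : length rest ℕ.< length r
      same    : r ≈ʳ i ∷ rest
      same-π  : Reducedʳ r → ∀ f → πʳ r f ≈ᴾ πʳ rest (π i f)

  trans-≈ᴾ : ∀ {f g h} → f ≈ᴾ g → g ≈ᴾ h → f ≈ᴾ h
  trans-≈ᴾ p q λ′ = trans (p λ′) (q λ′)

  sum-negative : ∀ {x y} → IsRoot x → IsRoot (x ⊕ y) → Positive y → Negative (x ⊕ y) → Negative x
  sum-negative x-root sum-root y⁺ sum⁻ = [ (λ x⁺ → contradiction sum⁻ (sign-exclusive sum-root (positive-⊕ x⁺ y⁺))) , id ]′ (sign x-root)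

  -- Induction on the bound `n`. If the first letter j is orthogonal to i, the tail still makes α_i
  -- negative, and j commutes with i. If j is adjacent, the tail makes α_i + α_j negative. If it
  -- keeps α_j positive it makes α_i negative, and two exchanges within the tail produce j i j, to
  -- be replaced by i j i. If it makes α_j negative, exchanging j cancels two letters.
  exchange : ∀ n r i → length r ℕ.≤ n → Negative (actʳ r (α i)) → Exchanged i r
  exchange n [] i le neg = contradiction neg (sign-exclusive (α-root i) (α-positive i))
  exchange (suc n) (j ∷ r) i (s≤s le) neg with j Fin.≟ i
  ... | yes refl = record { rest = r ; shorter = ℕ.≤-refl ; same = λ _ → refl ; same-π = λ _ f _ → refl }
  ... | no j≢i with simply-laced j i j≢i
  ...   | inj₁ orthogonal = record
          { rest    = j ∷ u
          ; shorter = s≤s shorter₁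
          ; same    = λ x → trans (same₁ (s j x)) (cong (actʳ u) (sym (s-comm i j x eq)))
          ; same-π  = λ red f → trans-≈ᴾ {πʳ r (π j f)} {πʳ u (π i (π j f))} {πʳ u (π j (π i f))}
              (same-π₁ (reduced-tail {j} {r} red) (π j f)) (πʳ-cong u {π i (π j f)} {π j (π i f)} (π-comm i j f eq))
          }
          where
          eq = trans (cartan-symmetric i j) orthogonal
          open Exchanged (exchange n r i le (subst (Negative ∘ actʳ r) (s-α-orthogonal i j orthogonal) neg))
            renaming (rest to u; shorter to shorter₁; same to same₁; same-π to same-π₁)
  ...   | inj₂ adjacent = [ up-case , down-case ]′ (sign (actʳ-root r (α-root j)))
          where
          eq = trans (cartan-symmetric i j) adjacent

          neg-sum : Negative (actʳ r (α i) ⊕ actʳ r (α j))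
          neg-sum = subst Negative (trans (cong (actʳ r) (s-α-adjacent i j adjacent)) (actʳ-⊕ r (α i) (α j))) neg

          sum-root : IsRoot (actʳ r (α i) ⊕ actʳ r (α j))
          sum-root = subst IsRoot (trans (cong (actʳ r) (s-α-adjacent i j adjacent)) (actʳ-⊕ r (α i) (α j))) (actʳ-root (j ∷ r) (α-root i))

          up-case : Positive (actʳ r (α j)) → Exchanged i (j ∷ r)
          up-case pos = record
            { rest    = j ∷ i ∷ w
            ; shorter = s≤s (ℕ.≤-trans (s≤s shorter₂) shorter₁)
            ; same    = λ x → trans (same₁ (s j x)) (trans (same₂ (s i (s j x))) (cong (actʳ w) (s-braid j i x adjacent)))
            ; same-π  = λ red f → trans-≈ᴾ {πʳ r (π j f)} {πʳ u (π i (π j f))} {πʳ w (π i (π j (π i f)))}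
                (same-π₁ (reduced-tail {j} {r} red) (π j f))
                (trans-≈ᴾ {πʳ u (π i (π j f))} {πʳ w (π j (π i (π j f)))} {πʳ w (π i (π j (π i f)))}
                  (same-π₂ (reduced-exchanged {i} {r} {u} (reduced-tail {j} {r} red) same₁ shorter₁) (π i (π j f)))
                  (πʳ-cong w {π j (π i (π j f))} {π i (π j (π i f))} (π-braid j i f adjacent)))
            }
            where
            open Exchanged (exchange n r i le (sum-negative (actʳ-root r (α-root i)) sum-root pos neg-sum))
              renaming (rest to u; shorter to shorter₁; same to same₁; same-π to same-π₁)
            neg-u : Negative (actʳ u (α j))
            neg-u = subst Negative (trans (cong (_⊕ actʳ r (α j)) refl) (trans (sym (actʳ-⊕ r (α i) (α j)))
              (trans (cong (actʳ r) (trans (⊕-comm (α i) (α j)) (sym (s-α-adjacent j i eq))))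
                (trans (same₁ (s i (α j))) (cong (actʳ u) (s-involutive i (α j))))))) neg-sum
            open Exchanged (exchange n u j (ℕ.<⇒≤ (ℕ.<-≤-trans shorter₁ le)) neg-u)
              renaming (rest to w; shorter to shorter₂; same to same₂; same-π to same-π₂)

          down-case : Negative (actʳ r (α j)) → Exchanged i (j ∷ r)
          down-case neg-j = record
            { rest    = w
            ; shorter = ℕ.<-trans (ℕ.<-trans shorter₂ shorter₁) (ℕ.n<1+n _)
            ; same    = λ x → trans (same-u x) (same₂ x)
            -- The word equals the shorter `u` in W, so it is not reduced.
            ; same-π  = λ red → ⊥-elim (ℕ.<⇒≱ (ℕ.<-trans shorter₁ (ℕ.n<1+n _)) (red u (sym ∘ same-u)))
            }
            where
            open Exchanged (exchange n r j le neg-j)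
              renaming (rest to u; shorter to shorter₁; same to same₁; same-π to same-π₁)
            same-u : j ∷ r ≈ʳ u
            same-u x = trans (same₁ (s j x)) (cong (actʳ u) (s-involutive j x))
            open Exchanged (exchange n u i (ℕ.<⇒≤ (ℕ.<-≤-trans shorter₁ le)) (subst Negative (same-u (α i)) neg))
              renaming (rest to w; shorter to shorter₂; same to same₂; same-π to same-π₂)

  Longestʳ : Word → Set
  Longestʳ r = Reducedʳ r × (∀ v → Reducedʳ v → length v ℕ.≤ length r)

  -- Were the image of α_i positive, prefixing i would give a longer reduced word.
  longest-negative : ∀ r → Longestʳ r → ∀ i → Negative (actʳ r (α i))
  longest-negative r (red , longest) i = [ (λ pos → ⊥-elim (ℕ.<⇒≱ ℕ.≤-refl (longest (i ∷ r) (longer pos)))) , id ]′ (sign (actʳ-root r (α-root i)))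
    where
    -- A word `v` equal to `i ∷ r` in W makes α_i negative, so it exchanges into `i ∷ rest` with
    -- rest equal to `r`. As `r` is reduced, it is no longer than rest, which is shorter than `v`.
    longer : Positive (actʳ r (α i)) → Reducedʳ (i ∷ r)
    longer pos v eq = ℕ.≤-trans (s≤s (red rest λ x → trans (cong (actʳ rest) (sym (s-involutive i x)))
        (trans (sym (same (s i x))) (trans (eq (s i x)) (cong (actʳ r) (s-involutive i x)))))) shorter
      where
      neg : Negative (actʳ v (α i))
      neg = subst Negative (sym (trans (eq (α i)) (trans (cong (actʳ r) (s-α-self i)) (actʳ-⊖ r (α i))))) (positive-⊖ pos)
      open Exchanged (exchange (length v) v i ℕ.≤-refl neg)

  -- The exchange lets π along `r` begin with π_i, which absorbs a further π_i.
  longest-absorbs : ∀ r → Longestʳ r → ∀ i f → πʳ r (π i f) ≈ᴾ πʳ r f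
  longest-absorbs r L@(red , _) i f λ′ = trans (same-π red (π i f) λ′)
    (trans (πʳ-cong rest {π i (π i f)} {π i f} (π-idempotent i f) λ′) (sym (same-π red f λ′)))
    where open Exchanged (exchange (length r) r i ℕ.≤-refl (longest-negative r L i))

  longest-reverse : ∀ w → IsLongest w → Longestʳ (reverse w)
  longest-reverse w (red , longest) =
    (λ v eq → subst₂ ℕ._≤_ (sym (List.length-reverse w)) (List.length-reverse v)
      (red (reverse v) λ x → trans (act-reverse v x) (trans (eq x) (trans (sym (act-reverse (reverse w) x)) (cong (λ w → act w x) (List.reverse-involutive w)))))) ,
    λ v red-v → subst₂ ℕ._≤_ (List.length-reverse v) (sym (List.length-reverse w)) (longest (reverse v) λ u eq →
      subst₂ ℕ._≤_ (sym (List.length-reverse v)) (List.length-reverse u) (red-v (reverse u) λ x →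
        trans (sym (act-reverse (reverse u) x)) (trans (cong (λ w → act w x) (List.reverse-involutive u)) (trans (eq x) (act-reverse v x)))))

  π-word-reversed : ∀ w f → π-word w f ≡ πʳ (reverse w) f
  π-word-reversed w f = trans (cong (λ w → π-word w f) (sym (List.reverse-involutive w))) (π-word-reverse (reverse w) f)

  π-longest-cong : ∀ w {f g} → f ≈ᴾ g → π-word w f ≈ᴾ π-word w g
  π-longest-cong w {f} {g} eq = subst₂ _≈ᴾ_ (sym (π-word-reversed w f)) (sym (π-word-reversed w g)) (πʳ-cong (reverse w) {f} {g} eq)

  π-longest-absorbs : ∀ w → IsLongest w → ∀ i f → π-word w (π i f) ≈ᴾ π-word w f
  π-longest-absorbs w L i f = subst₂ _≈ᴾ_ (sym (π-word-reversed w (π i f))) (sym (π-word-reversed w f)) (longest-absorbs (reverse w) (longest-reverse w L) i f)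

  π-word-fixed : ∀ w f → (∀ i → π i f ≈ᴾ f) → π-word w f ≈ᴾ f
  π-word-fixed []      f fixed = λ _ → refl
  π-word-fixed (i ∷ w) f fixed = trans-≈ᴾ {π i (π-word w f)} {π i f} {f} (π-cong i {π-word w f} {f} (π-word-fixed w f fixed)) (fixed i)

-- Characters of strings

module Strings (𝒮 : Setting) where

  open Setting 𝒮
  open Crystal 𝒮
  open Monomials 𝒮
  open CrystalOperators 𝒮
  open DemazureOperators 𝒮 hiding (t)
  open DemazureOperators 𝒮 using () renaming (t to τ)

  character : List Monomial → ℤ[P]
  character = map λ p → 1ℤ , wt p

  at-weight : P → Monomial → ℤ
  at-weight ν p = [ wt p ≟ᴾ ν ] 1ℤ

  coeff-character : ∀ L ν → coeff (character L) ν ≡ Σℤ L (at-weight ν)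
  coeff-character []      ν = refl
  coeff-character (p ∷ L) ν = cong (λ n → at-weight ν p + n) (coeff-character L ν)

  Distinct : List Monomial → Set
  Distinct = AllPairs λ p q → ¬ p ≋ q

  infix 4 _∈~_
  _∈~_ : Monomial → List Monomial → Set
  p ∈~ L = ∃ λ q → q ∈ L × p ≋ q

  record Enumerates {ℓ} (X : Pred Monomial ℓ) (L : List Monomial) : Set ℓ where
    field
      sound    : ∀ {p} → p ∈ L → X p
      exhaust  : ∀ {p} → X p → p ∈~ L
      distinct : Distinct L

  Σℤ-pick : ∀ {A : Set} {f : A → ℤ} (pre : List A) c post → Σℤ (pre ++ c ∷ post) f ≡ f c + Σℤ (pre ++ post) f
  Σℤ-pick []        c post = refl
  Σℤ-pick {f = f} (a ∷ pre) c post = trans (cong (λ n → f a + n) (Σℤ-pick pre c post)) (swap (f a) (f c) _)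
    where
    swap : ∀ a b c → a + (b + c) ≡ b + (a + c)
    swap = solve-∀

  distinct-remove : ∀ pre {q post} → Distinct (pre ++ q ∷ post) →
                    Distinct (pre ++ post) × (∀ {x} → x ∈ pre ++ post → ¬ x ≋ q)
  distinct-remove []        (q∉ ∷ d) = d , λ x∈ eq → All.lookup q∉ x∈ (≋-sym eq)
  distinct-remove (a ∷ pre) {q} {post} (a∉ ∷ d) =
    let d′ , q∉ = distinct-remove pre d in
    All.tabulate (λ x∈ → All.lookup a∉ (weaken (∈-++⁻ pre x∈))) ∷ d′ , λ where
      (here refl) → All.lookup a∉ (∈-insert pre)
      (there x∈)  → q∉ x∈
    where
    weaken : ∀ {x} → x ∈ pre ⊎ x ∈ post → x ∈ pre ++ q ∷ post
    weaken (inj₁ x∈) = ∈-++⁺ˡ x∈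
    weaken (inj₂ x∈) = ∈-++⁺ʳ pre (there x∈)

  split-member : ∀ {A : Set} pre {q : A} {post x} → x ∈ pre ++ q ∷ post → x ≡ q ⊎ x ∈ pre ++ post
  split-member []        (here refl) = inj₁ refl
  split-member []        (there x∈)  = inj₂ x∈
  split-member (a ∷ pre) (here refl) = inj₂ (here refl)
  split-member (a ∷ pre) (there x∈)  = [ inj₁ , inj₂ ∘ there ]′ (split-member pre x∈)

  sum-same : ∀ {L M} → Distinct L → Distinct M → (∀ {p} → p ∈ L → p ∈~ M) → (∀ {p} → p ∈ M → p ∈~ L) →
             ∀ ν → Σℤ L (at-weight ν) ≡ Σℤ M (at-weight ν)
  sum-same {[]} {[]}    dL dM L⊆M M⊆L ν = refl
  sum-same {[]} {q ∷ M} dL dM L⊆M M⊆L ν = case M⊆L (here refl) of λ { (_ , () , _) }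
  sum-same {p ∷ L} {M} (p∉ ∷ dL) dM L⊆M M⊆L ν =
    let q , q∈ , p≋q = L⊆M (here refl)
        pre , post , M≡ = ∈-∃++ q∈
    in step q p≋q pre post M≡
    where
    step : ∀ q → p ≋ q → ∀ pre post → M ≡ pre ++ q ∷ post → Σℤ (p ∷ L) (at-weight ν) ≡ Σℤ M (at-weight ν)
    step q p≋q pre post refl = trans (cong₂ _+_ (cong (λ x → [ x ≟ᴾ ν ] 1ℤ) (proj₁ (unwrap p≋q)))
        (sum-same dL (proj₁ removed) L⊆ ⊆L ν)) (sym (Σℤ-pick pre q post))
      where
      removed = distinct-remove pre dM
      L⊆ : ∀ {x} → x ∈ L → x ∈~ pre ++ post
      L⊆ {x} x∈ = let y , y∈ , x≋y = L⊆M (there x∈) in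
        [ (λ y≡q → contradiction (≋-trans p≋q (≋-sym (subst (x ≋_) y≡q x≋y))) (All.lookup p∉ x∈)) , (λ y∈′ → y , y∈′ , x≋y) ]′ (split-member pre y∈)
      ⊆L : ∀ {x} → x ∈ pre ++ post → x ∈~ L
      ⊆L {x} x∈ with M⊆L ([ ∈-++⁺ˡ , (λ h → ∈-++⁺ʳ pre (there h)) ]′ (∈-++⁻ pre x∈))
      ... | _ , here refl , x≋p = contradiction (≋-trans x≋p p≋q) (proj₂ removed x∈)
      ... | y , there y∈ , x≋y = y , y∈ , x≋y

  character-same : ∀ {L M} → Distinct L → Distinct M → (∀ {p} → p ∈ L → p ∈~ M) → (∀ {p} → p ∈ M → p ∈~ L) →
                   character L ≈ᴾ character M
  character-same {L} {M} dL dM L⊆M M⊆L ν =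
    trans (coeff-character L ν) (trans (sum-same dL dM L⊆M M⊆L ν) (sym (coeff-character M ν)))

  Respects : ∀ {ℓ} → Pred Monomial ℓ → Set ℓ
  Respects D = ∀ {p q} → p ≋ q → D p → D q

  filter-enumerates : ∀ {ℓ ℓ′} {X : Pred Monomial ℓ} {D : Pred Monomial ℓ′} (D? : Decidable D) → Respects D →
                      ∀ {L} → Enumerates X L → Enumerates (λ p → X p × D p) (filter D? L)
  filter-enumerates D? resp {L} E = record
    { sound    = λ p∈ → let p∈L , d = ∈-filter⁻ D? {xs = L} p∈ in sound p∈L , d
    ; exhaust  = λ (x , d) → let q , q∈ , p≋q = exhaust x in q , ∈-filter⁺ D? q∈ (resp p≋q d) , p≋q
    ; distinct = AllPairs.filter⁺ D? distinct
    }
    where open Enumerates E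

  module _ (i : I) where

    f̂-from : ∀ p → Dec (φ̂ i p ≡ 0ℤ) → Monomial
    -- An arbitrary value: `f̂` matters only where φ̂ is nonzero.
    f̂-from p (yes _) = p
    f̂-from p (no ne) = proj₁ (f-defined i p ne)

    f̂ : Monomial → Monomial
    f̂ p = f̂-from p (φ̂ i p ℤ.≟ 0ℤ)

    f̂-step : ∀ p → φ̂ i p ≢ 0ℤ → f[ i ] p ↦ f̂ p
    f̂-step p ne = step (φ̂ i p ℤ.≟ 0ℤ)
      where
      step : (d : Dec (φ̂ i p ≡ 0ℤ)) → f[ i ] p ↦ f̂-from p d
      step (yes eq) = contradiction eq ne
      step (no ne)  = proj₂ (f-defined i p ne)

    f-φ̂-≢0 : ∀ {p q} → f[ i ] p ↦ q → φ̂ i p ≢ 0ℤ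
    f-φ̂-≢0 {p} (_ , _ , max , m≢0 , _) eq = m≢0 (trans (IsMaximum-unique max (φ̂-max i p)) eq)

    e-ε̂-≢0 : ∀ {p q} → e[ i ] p ↦ q → ε̂ i p ≢ 0ℤ
    e-ε̂-≢0 {p} (_ , _ , max , m≢0 , _) eq = m≢0 (trans (IsMaximum-unique max (ε̂-max i p)) eq)

    f-wt : ∀ {p q} → f[ i ] p ↦ q → wt q ≡ wt p ⊝ α i
    f-wt (_ , _ , _ , _ , _ , _ , wt≡ , _) = wt≡

    string : ℕ → Monomial → List Monomial
    string zero    u = u ∷ []
    string (suc n) u = u ∷ string n (f̂ u)

    +suc-≢0 : ∀ {a n} → a ≡ + suc n → a ≢ 0ℤ
    +suc-≢0 refl ()

    f̂-φ̂ : ∀ u {n} → φ̂ i u ≡ + suc n → φ̂ i (f̂ u) ≡ + n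
    f̂-φ̂ u {n} eq = trans (proj₁ (f-lowers {i} {u} {f̂ u} (f̂-step u (+suc-≢0 eq)))) (cong (_- 1ℤ) eq)

    string-character : ∀ n u → φ̂ i u ≡ + n → character (string n u) ≡ geometric (α i) (wt u) (+ suc n)
    string-character zero    u eq = refl
    string-character (suc n) u eq = cong ((1ℤ , wt u) ∷_) (trans (string-character n (f̂ u) (f̂-φ̂ u eq))
      (cong (λ x → geometric (α i) x (+ suc n)) (f-wt {u} {f̂ u} (f̂-step u (+suc-≢0 eq)))))

    -- The relation e_i^a x = u. As e_i is a partial function that lowers ε̂ by 1, `x` and `a`
    -- determine `u`, and `a` is the difference of the values of ε̂ at `x` and `u`.
    Climb : ℕ → Monomial → Monomial → Set
    Climb zero    x u = x ≋ u
    Climb (suc a) x u = ∃ λ y → e[ i ] x ↦ y × Climb a y u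

    e-resp : ∀ {x y u} → x ≋ y → e[ i ] y ↦ u → ∃ λ v → e[ i ] x ↦ v × v ≋ u
    e-resp {x} {y} {u} x≋y step =
      let v , step′ = e-defined i x (e-ε̂-≢0 {y} {u} step ∘ trans (ε̂-cong i (≋-sym x≋y)))
      in v , step′ , e-unique {i} {x} {y} {v} {u} x≋y step′ step

    climb-append : ∀ a {x y u} → Climb a x y → e[ i ] y ↦ u → Climb (suc a) x u
    climb-append zero    {x} {y} {u} x≋y           step = e-resp {x} {y} {u} x≋y step
    climb-append (suc a) {x} {y} {u} (w , up , climb) step = w , up , climb-append a {w} {y} {u} climb step

    climb-ε̂ : ∀ a {x u} → Climb a x u → ε̂ i x ≡ + a + ε̂ i u
    climb-ε̂ zero    x≋u = trans (ε̂-cong i x≋u) (sym (ℤ.+-identityˡ _))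
    climb-ε̂ (suc a) {x} {u} (y , up , climb) = trans (f-ε̂ {i} {y} {x} (e-raises {i} {x} {y} up))
      (trans (cong (_+ 1ℤ) (climb-ε̂ a climb)) (arith (+ a) (ε̂ i u)))
      where
      arith : ∀ a b → a + b + 1ℤ ≡ 1ℤ + a + b
      arith = solve-∀

    climb-unique : ∀ a {x x′ u u′} → x ≋ x′ → Climb a x u → Climb a x′ u′ → u ≋ u′
    climb-unique zero    x≋x′ x≋u x′≋u′ = ≋-trans (≋-sym x≋u) (≋-trans x≋x′ x′≋u′)
    climb-unique (suc a) {x} {x′} x≋x′ (y , up , climb) (y′ , up′ , climb′) =
      climb-unique a (e-unique {i} {x} {x′} {y} {y′} x≋x′ up up′) climb climb′

    string-climb : ∀ n u → φ̂ i u ≡ + n → ∀ {x} → x ∈ string n u → ∃ λ a → Climb a x u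
    string-climb zero    u eq (here refl) = 0 , ≋-refl
    string-climb (suc n) u eq (here refl) = 0 , ≋-refl
    string-climb (suc n) u eq {x} (there x∈) =
      let a , climb = string-climb n (f̂ u) (f̂-φ̂ u eq) x∈
      in suc a , climb-append a {x} {f̂ u} {u} climb (proj₂ (f-lowers {i} {u} {f̂ u} (f̂-step u (+suc-≢0 eq))))

    string-distinct : ∀ n u → φ̂ i u ≡ + n → Distinct (string n u)
    string-distinct zero    u eq = [] ∷ []
    string-distinct (suc n) u eq = All.tabulate (λ x∈ → differ (string-climb n (f̂ u) (f̂-φ̂ u eq) x∈)) ∷ string-distinct n (f̂ u) (f̂-φ̂ u eq)
      where
      arith : ∀ a b → a + (b + 1ℤ) ≡ b + (1ℤ + a)
      arith = solve-∀
      differ : ∀ {x} → ∃ (λ a → Climb a x (f̂ u)) → ¬ u ≋ x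
      differ {x} (a , climb) u≋x = ℤ.<-irrefl
        (trans (ε̂-cong i u≋x) (trans (climb-ε̂ a climb) (trans (cong (λ n → + a + n) (f-ε̂ {i} {u} {f̂ u} (f̂-step u (+suc-≢0 eq)))) (arith (+ a) (ε̂ i u)))))
        (ℤ.≤-<-trans (ℤ.≤-reflexive (sym (ℤ.+-identityʳ (ε̂ i u)))) (ℤ.+-monoʳ-< (ε̂ i u) (ℤ.+<+ {0} {suc a} (s≤s z≤n))))

    head-∈ : ∀ n u → u ∈ string n u
    head-∈ zero    u = here refl
    head-∈ (suc n) u = here refl

    string-f̂ : ∀ n u → φ̂ i u ≡ + n → ∀ {x} → x ∈ string n u → φ̂ i x ≢ 0ℤ → f̂ x ∈ string n u
    string-f̂ zero    u eq (here refl) ne = contradiction eq ne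
    string-f̂ (suc n) u eq (here refl) ne = there (head-∈ n (f̂ u))
    string-f̂ (suc n) u eq (there x∈)  ne = there (string-f̂ n (f̂ u) (f̂-φ̂ u eq) x∈ ne)

    φ̂ℕ : Monomial → ℕ
    φ̂ℕ u = ∣ φ̂ i u ∣

    φ̂ℕ-≡ : ∀ u → φ̂ i u ≡ + φ̂ℕ u
    φ̂ℕ-≡ u = sym (ℤ.0≤i⇒+∣i∣≡i (φ̂≥0 i u))

    fullString : Monomial → List Monomial
    fullString u = string (φ̂ℕ u) u

    Top : Monomial → Set
    Top p = ε̂ i p ≡ 0ℤ

    Top? : Decidable Top
    Top? p = ε̂ i p ℤ.≟ 0ℤ

    -- From an element common to two strings the climbs to both tops have the same length, the value
    -- of ε̂ there, and so end at the same top.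
    strings-distinct : ∀ H → (∀ {u} → u ∈ H → Top u) → Distinct H → Distinct (concatMap fullString H)
    strings-distinct []      tops d        = []
    strings-distinct (u ∷ H) tops (u∉ ∷ d) = AllPairs.++⁺ (string-distinct (φ̂ℕ u) u (φ̂ℕ-≡ u)) (strings-distinct H (tops ∘ there) d)
      (All.tabulate λ {x} x∈ → All.tabulate λ {y} y∈ x≋y →
        let h , h∈ , y∈h = find (∈-concatMap⁻ fullString {xs = H} y∈)
            a , climb = string-climb (φ̂ℕ u) u (φ̂ℕ-≡ u) x∈
            b , climb′ = string-climb (φ̂ℕ h) h (φ̂ℕ-≡ h) y∈h
            a≡b = ℤ.+-injective (trans (sym (level a climb (tops (here refl)))) (trans (ε̂-cong i x≋y) (level b climb′ (tops (there h∈)))))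
        in All.lookup u∉ h∈ (climb-unique a x≋y climb (subst (λ a → Climb a y h) (sym a≡b) climb′)))
      where
      level : ∀ a {x u} → Climb a x u → Top u → ε̂ i x ≡ + a
      level a climb top = trans (climb-ε̂ a climb) (trans (cong (λ n → + a + n) top) (ℤ.+-identityʳ (+ a)))

    -- At a top ε̂ is 0, so φ̂ is the pairing of the weight with the coroot, and the weights of the
    -- string form exactly the geometric sum defining π_i.
    strings-character : ∀ H → (∀ {u} → u ∈ H → Top u) → character (concatMap fullString H) ≈ᴾ π i (character H)
    strings-character []      tops ν = refl
    strings-character (u ∷ H) tops ν = begin
      coeff (character (fullString u ++ concatMap fullString H)) ν
        ≡⟨ cong (λ f → coeff f ν) (List.map-++ _ (fullString u) (concatMap fullString H)) ⟩
      coeff (character (fullString u) ++ character (concatMap fullString H)) ν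
        ≡⟨ sumWhere-++ (_≟ᴾ ν) (character (fullString u)) _ ⟩
      coeff (character (fullString u)) ν + coeff (character (concatMap fullString H)) ν
        ≡⟨ cong₂ _+_ (cong (λ f → coeff f ν) (trans (string-character (φ̂ℕ u) u (φ̂ℕ-≡ u)) (cong (geometric (α i) (wt u)) top-length)))
             (strings-character H (tops ∘ there) ν) ⟩
      coeff (geometric (α i) (wt u) (⟨ α∨ i , wt u ⟩ + 1ℤ)) ν + coeff (π i (character H)) ν
        ≡⟨ cong (_+ coeff (π i (character H)) ν) (trans (sym (coeff-π-e^ i (wt u) ν)) (sym (ℤ.*-identityˡ _))) ⟩
      1ℤ * coeff (π i (e^ wt u)) ν + coeff (π i (character H)) ν
        ≡⟨ coeff-π-∷ i 1ℤ (wt u) (character H) ν ⟨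
      coeff (π i (character (u ∷ H))) ν ∎
      where
      open ≡-Reasoning
      arith : ∀ a t → a ≡ a - t + t
      arith = solve-∀
      top-length : + suc (φ̂ℕ u) ≡ ⟨ α∨ i , wt u ⟩ + 1ℤ
      top-length = trans (ℤ.+-comm 1ℤ (+ φ̂ℕ u)) (cong (_+ 1ℤ) (trans (sym (φ̂ℕ-≡ u)) (trans (arith (φ̂ i u) (total i u))
        (trans (cong (_+ total i u) (trans (sym (ε̂-φ̂ i u)) (tops (here refl)))) (ℤ.+-identityˡ (total i u))))))

    record Stable {ℓ} (X : Pred Monomial ℓ) : Set ℓ where
      field
        resp     : Respects X
        closed-f : ∀ {p q} → X p → f[ i ] p ↦ q → X q
        closed-e : ∀ {p q} → X p → e[ i ] p ↦ q → X q

    module _ {ℓ} {X : Pred Monomial ℓ} (S : Stable X) {L : List Monomial} (E : Enumerates X L) where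

      open Stable S
      open Enumerates E

      tops : List Monomial
      tops = filter Top? L

      string-sound : ∀ n u → φ̂ i u ≡ + n → X u → ∀ {x} → x ∈ string n u → X x
      string-sound zero    u eq xu (here refl) = xu
      string-sound (suc n) u eq xu (here refl) = xu
      string-sound (suc n) u eq xu (there x∈)  = string-sound n (f̂ u) (f̂-φ̂ u eq) (closed-f {u} {f̂ u} xu (f̂-step u (+suc-≢0 eq))) x∈

      -- Induction on ε̂: e leads to an element already known to lie on a string, and `f̂` stays on
      -- that string on the way back.
      strings-exhaust : ∀ n {x} → ε̂ i x ≡ + n → X x → x ∈~ concatMap fullString tops
      strings-exhaust zero {x} eq xx =
        let h , h∈ , x≋h = exhaust xx
        in h , ∈-concatMap⁺ fullString (lose (∈-filter⁺ Top? h∈ (trans (ε̂-cong i (≋-sym x≋h)) eq)) (head-∈ (φ̂ℕ h) h)) , x≋h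
      strings-exhaust (suc n) {x} eq xx =
        let y , up = e-defined i x (+suc-≢0 eq)
            down = e-raises {i} {x} {y} up
            y′ , y′∈ , y≋y′ = strings-exhaust n {y} (lower (trans (sym (f-ε̂ {i} {y} {x} down)) eq)) (closed-e {x} {y} xx up)
            h , h∈ , y′∈h = find (∈-concatMap⁻ fullString {xs = tops} y′∈)
            ne = f-φ̂-≢0 {y} {x} down ∘ trans (φ̂-cong i y≋y′)
        in f̂ y′ , ∈-concatMap⁺ fullString (lose h∈ (string-f̂ (φ̂ℕ h) h (φ̂ℕ-≡ h) y′∈h ne)) ,
           f-unique {i} {y} {y′} {x} {f̂ y′} y≋y′ down (f̂-step y′ ne)
        where
        lower : ∀ {a} → a + 1ℤ ≡ + suc n → a ≡ + n
        lower {a} eq = trans (arith a) (cong (_- 1ℤ) eq)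
          where
          arith : ∀ a → a ≡ a + 1ℤ - 1ℤ
          arith = solve-∀

      is-top : ∀ {u} → u ∈ tops → Top u
      is-top u∈ = proj₂ (∈-filter⁻ Top? {xs = L} u∈)

      character-tops : character L ≈ᴾ π i (character tops)
      character-tops ν = trans (character-same {L} {concatMap fullString tops} distinct
          (strings-distinct tops is-top (AllPairs.filter⁺ Top? distinct))
          (λ {p} p∈ → strings-exhaust ∣ ε̂ i p ∣ (sym (ℤ.0≤i⇒+∣i∣≡i (ε̂≥0 i p))) (sound p∈))
          (λ {p} p∈ → let h , h∈ , p∈h = find (∈-concatMap⁻ fullString {xs = tops} p∈) in
            exhaust (string-sound (φ̂ℕ h) h (φ̂ℕ-≡ h) (sound (proj₁ (∈-filter⁻ Top? {xs = L} h∈))) p∈h)) ν)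
        (strings-character tops is-top ν)

      character-fixed : π i (character L) ≈ᴾ character L
      character-fixed ν = trans (π-cong i {character L} {π i (character tops)} character-tops ν)
        (trans (π-idempotent i (character tops) ν) (sym (character-tops ν)))

      coeff-filter : ∀ {ℓ} {Q : Pred Monomial ℓ} (Q? : Decidable Q) (L : List Monomial) ν →
                     coeff (character (filter Q? L)) ν ≡ Σℤ L (λ p → [ Q? p ] (at-weight ν p))
      coeff-filter Q? L ν = trans (coeff-character (filter Q? L) ν) (Σℤ-filter Q? L)

      -- D meets each string in its top alone or in all of it.
      module _ {ℓ′} {D : Pred Monomial ℓ′} (D? : Decidable D) (D-resp : Respects D)
        (D-top : ∀ {p} → X p → Top p → D p)
        (D-f : ∀ {p q} → X p → D p → ¬ Top p → f[ i ] p ↦ q → D q)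
        (D-e : ∀ {p q} → X p → D p → e[ i ] p ↦ q → D q) where

        -- Tests at `p`, or one step below it if `p` is a top, whether `D` meets the string of `p`
        -- beyond its top. Within `X`, closure of `D` under e, and under f off the tops, makes the
        -- answer the same along the string.
        OnFull : Pred Monomial ℓ′
        OnFull p = (¬ Top p × D p) ⊎ (Top p × φ̂ i p ≢ 0ℤ × D (f̂ p))

        OnFull? : Decidable OnFull
        OnFull? p = (¬? (Top? p) ×-dec D? p) ⊎-dec (Top? p ×-dec (¬? (φ̂ i p ℤ.≟ 0ℤ) ×-dec D? (f̂ p)))

        OnFull-resp : Respects OnFull
        OnFull-resp eq (inj₁ (ntop , d)) = inj₁ (ntop ∘ trans (ε̂-cong i eq) , D-resp eq d)
        OnFull-resp {p} {q} eq (inj₂ (top , ne , d)) = let ne′ = ne ∘ trans (φ̂-cong i eq) in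
          inj₂ (trans (ε̂-cong i (≋-sym eq)) top , ne′ , D-resp (f-unique {i} {p} {q} {f̂ p} {f̂ q} eq (f̂-step p ne) (f̂-step q ne′)) d)

        f-not-top : ∀ {p q} → f[ i ] p ↦ q → ¬ Top q
        f-not-top {p} {q} step = e-ε̂-≢0 {q} {p} (proj₂ (f-lowers {i} {p} {q} step))

        full-stable : Stable (λ p → X p × OnFull p)
        full-stable = record
          { resp     = λ eq (x , o) → resp eq x , OnFull-resp eq o
          ; closed-f = λ {p} {q} (x , o) step → closed-f {p} {q} x step , inj₁ (f-not-top {p} {q} step , lowered {p} {q} x o step)
          ; closed-e = λ {p} {q} (x , o) step → closed-e {p} {q} x step , raised {p} {q} x o step (Top? q)
          }
          where
          lowered : ∀ {p q} → X p → OnFull p → f[ i ] p ↦ q → D q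
          lowered {p} {q} x (inj₁ (ntop , d))    step = D-f {p} {q} x d ntop step
          lowered {p} {q} x (inj₂ (top , ne , d)) step = D-resp (f-unique {i} {p} {p} {f̂ p} {q} ≋-refl (f̂-step p ne) step) d
          raised : ∀ {p q} → X p → OnFull p → e[ i ] p ↦ q → Dec (Top q) → OnFull q
          raised {p} {q} x (inj₂ (top , _))  step _         = contradiction top (e-ε̂-≢0 {p} {q} step)
          raised {p} {q} x (inj₁ (ntop , d)) step (no ntop′) = inj₁ (ntop′ , D-e {p} {q} x d step)
          raised {p} {q} x (inj₁ (ntop , d)) step (yes top)  =
            let ne = f-φ̂-≢0 {q} {p} (e-raises {i} {p} {q} step) in
            inj₂ (top , ne , D-resp (f-unique {i} {q} {q} {p} {f̂ q} ≋-refl (e-raises {i} {p} {q} step) (f̂-step q ne)) d)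

      -- Holds element by element: at a top `D` is true, and elsewhere `D` and `OnFull` agree.
      full-balance : ∀ {ℓ′} {D : Pred Monomial ℓ′} (D? : Decidable D)
        (D-top : ∀ {p} → X p → Top p → D p) {OnFull : Pred Monomial ℓ′} (OnFull? : Decidable OnFull) →
        (∀ {p} → ¬ Top p → D p → OnFull p) → (∀ {p} → ¬ Top p → OnFull p → D p) → ∀ ν →
        coeff (character (filter D? L)) ν + coeff (character (filter Top? (filter OnFull? L))) ν ≡
        coeff (character tops) ν + coeff (character (filter OnFull? L)) ν
      full-balance D? D-top OnFull? to from ν = begin
        coeff (character (filter D? L)) ν + coeff (character (filter Top? (filter OnFull? L))) ν
          ≡⟨ cong₂ _+_ (coeff-filter D? L ν) (trans (coeff-filter Top? (filter OnFull? L) ν) (Σℤ-filter OnFull? L)) ⟩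
        Σℤ L (λ p → [ D? p ] (at-weight ν p)) + Σℤ L (λ p → [ OnFull? p ] [ Top? p ] (at-weight ν p))
          ≡⟨ Σℤ-+ L ⟨
        Σℤ L (λ p → [ D? p ] (at-weight ν p) + [ OnFull? p ] [ Top? p ] (at-weight ν p))
          ≡⟨ Σℤ-cong L (λ {p} p∈ → pointwise p (sound p∈) (D? p) (OnFull? p) (Top? p) (at-weight ν p)) ⟩
        Σℤ L (λ p → [ Top? p ] (at-weight ν p) + [ OnFull? p ] (at-weight ν p))
          ≡⟨ Σℤ-+ L ⟩
        Σℤ L (λ p → [ Top? p ] (at-weight ν p)) + Σℤ L (λ p → [ OnFull? p ] (at-weight ν p))
          ≡⟨ cong₂ _+_ (coeff-filter Top? L ν) (coeff-filter OnFull? L ν) ⟨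
        coeff (character tops) ν + coeff (character (filter OnFull? L)) ν ∎
        where
        open ≡-Reasoning
        pointwise : ∀ p → X p → (d : Dec _) (o : Dec _) (t : Dec (Top p)) → ∀ a → [ d ] a + [ o ] [ t ] a ≡ [ t ] a + [ o ] a
        pointwise p x (yes _) (yes _) (yes _) a = refl
        pointwise p x (yes _) (no _)  (yes _) a = refl
        pointwise p x (no nd) _       (yes t) a = contradiction (D-top x t) nd
        pointwise p x (yes _) (yes _) (no _)  a = ℤ.+-comm a 0ℤ
        pointwise p x (no _)  (no _)  (no _)  a = refl
        pointwise p x (yes d) (no no′) (no nt) a = contradiction (to nt d) no′
        pointwise p x (no nd) (yes o) (no nt) a = contradiction (from nt o) nd

    -- With Y = {D}, F = the full strings meeting Y beyond their tops, the counts
    -- satisfy Y + tops F = tops X + F, and π i fixes the character of F.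
    step-character : ∀ {ℓ} {X : Pred Monomial ℓ} → Stable X → ∀ {L} → Enumerates X L →
      ∀ {ℓ′} {D : Pred Monomial ℓ′} (D? : Decidable D) → Respects D →
      (∀ {p} → X p → Top p → D p) →
      (∀ {p q} → X p → D p → ¬ Top p → f[ i ] p ↦ q → D q) →
      (∀ {p q} → X p → D p → e[ i ] p ↦ q → D q) →
      character L ≈ᴾ π i (character (filter D? L))
    step-character {X = X} S {L} E {D = D} D? D-resp D-top D-f D-e ν = sym (π-determined i Y (coeff (character L)) (coeff-finite (character L))
      (λ ν → begin
        Δ (α i) (coeff (character L)) ν
          ≡⟨ cong₂ _-_ (character-tops S E ν) (character-tops S E (ν ⊕ α i)) ⟩
        Δ (α i) (coeff (π i H)) ν
          ≡⟨ π-equation i H ν ⟩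
        coeff H ν - coeff H (τ i ν)
          ≡⟨ combine (coeff Y ν) (coeff H₁ ν) (coeff H ν) (coeff F ν) (coeff Y (τ i ν)) (coeff H₁ (τ i ν)) (coeff H (τ i ν)) (coeff F (τ i ν))
               (balance ν) (balance (τ i ν)) (F-equation ν) ⟩
        coeff Y ν - coeff Y (τ i ν) ∎) ν)
      where
      open ≡-Reasoning
      Y H F H₁ : ℤ[P]
      Y = character (filter D? L)
      H = character (filter Top? L)
      F? = OnFull? S E D? D-resp D-top (λ {p} {q} → D-f {p} {q}) (λ {p} {q} → D-e {p} {q})
      F = character (filter F? L)
      H₁ = character (filter Top? (filter F? L))

      balance : ∀ ν → coeff Y ν + coeff H₁ ν ≡ coeff H ν + coeff F ν
      balance = full-balance S E D? D-top F? (λ nt d → inj₁ (nt , d))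
        λ { nt (inj₁ (_ , d)) → d ; nt (inj₂ (t , _)) → contradiction t nt }

      F-tops : F ≈ᴾ π i H₁
      F-tops = character-tops (full-stable S E D? D-resp D-top (λ {p} {q} → D-f {p} {q}) (λ {p} {q} → D-e {p} {q}))
        (filter-enumerates F? (OnFull-resp S E D? D-resp D-top (λ {p} {q} → D-f {p} {q}) (λ {p} {q} → D-e {p} {q})) E)

      -- As F = π_i H₁ is invariant, F and H₁ have the same difference with their shifted
      -- reflections, and both drop out when `balance` is antisymmetrised.
      F-equation : ∀ ν → coeff F ν - coeff F (τ i ν) ≡ coeff H₁ ν - coeff H₁ (τ i ν)
      F-equation ν = trans (cong₂ _-_ (F-tops ν) (trans (F-tops (τ i ν)) (π-invariant i H₁ ν))) (π-equation i H₁ ν)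

      combine : ∀ y h₁ h f y′ h₁′ h′ f′ → y + h₁ ≡ h + f → y′ + h₁′ ≡ h′ + f′ → f - f′ ≡ h₁ - h₁′ → h - h′ ≡ y - y′
      combine y h₁ h f y′ h₁′ h′ f′ eq eq′ eqF = trans (lhs h h′ f f′)
        (trans (cong₂ (λ a b → a - b - (f - f′)) (sym eq) (sym eq′)) (trans (cong (λ c → y + h₁ - (y′ + h₁′) - c) eqF) (rhs y y′ h₁ h₁′)))
        where
        lhs : ∀ h h′ f f′ → h - h′ ≡ h + f - (h′ + f′) - (f - f′)
        lhs = solve-∀
        rhs : ∀ y y′ h h′ → y + h - (y′ + h′) - (h - h′) ≡ y - y′
        rhs = solve-∀

-- Truncations

module Truncations (𝒮 : Setting) where

  open Setting 𝒮
  open Crystal 𝒮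
  open Monomials 𝒮
  open CrystalOperators 𝒮
  open ProductCrystals 𝒮
  open Strings 𝒮
  open Exchange 𝒮

  neg-≤0 : ∀ n → - + n ≤ 0ℤ
  neg-≤0 zero    = ℤ.≤-refl
  neg-≤0 (suc n) = ℤ.-≤+

  +-cancelˡ : ∀ a {b c} → a + b ≡ a + c → b ≡ c
  +-cancelˡ a {b} {c} eq = trans (arith a b) (trans (cong (λ n → n - a) eq) (sym (arith a c)))
    where
    arith : ∀ a b → b ≡ a + b - a
    arith = solve-∀

  column-≼ : ∀ {i} n (k l : Height i) → height l ≤ height k + + n → k ≤ᴴ l → (i , k) ≼ (i , l)
  column-≼ {i} n k l near k≤l with height k ℤ.≟ height l
  ... | yes eq = subst (λ l → (i , k) ≼ (i , l)) (Height-≡ {k = k} {l} eq) Star.ε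
  column-≼ zero k l near k≤l | no neq = contradiction (ℤ.≤-antisym k≤l (ℤ.≤-trans near (ℤ.≤-reflexive (ℤ.+-identityʳ _)))) neq
  column-≼ (suc n) k l near k≤l | no neq = vertical ◅ column-≼ n (k ↑²) l
    (ℤ.≤-trans near (ℤ.≤-trans (ℤ.≤-reflexive (arith₁ (height k) (+ n)))
      (ℤ.≤-trans (ℤ.+-monoʳ-≤ (height k + + n) (ℤ.+≤+ {1} {2} (s≤s z≤n))) (ℤ.≤-reflexive (arith₂ (height k) (+ n))))))
    (gap k l (ℤ.≤∧≢⇒< k≤l neq))
    where
    arith₁ : ∀ a n → a + (1ℤ + n) ≡ a + n + 1ℤ
    arith₁ = solve-∀
    arith₂ : ∀ a n → a + n + + 2 ≡ a + + 2 + n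
    arith₂ = solve-∀

  column : ∀ {i} (k l : Height i) → k ≤ᴴ l → (i , k) ≼ (i , l)
  column k l k≤l = column-≼ ∣ height l - height k ∣ k l
    (ℤ.≤-reflexive (trans (arith (height k) (height l)) (cong (λ n → height k + n) (sym (ℤ.0≤i⇒+∣i∣≡i (ℤ.i≤j⇒0≤j-i k≤l)))))) k≤l
    where
    arith : ∀ a b → b ≡ a + (b - a)
    arith = solve-∀

  no-filter : ∀ {A : Set} {ℓ} {Q : Pred A ℓ} (Q? : Decidable Q) L → (∀ {x} → x ∈ L → ¬ Q x) → length (filter Q? L) ≡ 0
  no-filter Q? L none = cong length (List.filter-none Q? {L} (All.tabulate none))

  some-filter : ∀ {A : Set} {ℓ} {Q : Pred A ℓ} (Q? : Decidable Q) L → length (filter Q? L) ≢ 0 → ∃ λ x → x ∈ L × Q x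
  some-filter Q? [] ne = contradiction refl ne
  some-filter Q? (x ∷ L) ne with Q? x
  ... | yes q = x , here refl , q
  ... | no  _ = let y , y∈ , q = some-filter Q? L ne in y , there y∈ , q

  -- At a vertex of least height among L and M, only its own multiplicity
  -- contributes to the exponent, so it occurs in both lists and can be removed.
  ∏z-injective : ∀ n L M → length L ℕ.≤ n → (∀ w → ∏z L ⟦ w ⟧ ≡ ∏z M ⟦ w ⟧) → ∀ {x} → x ∈ M → x ∈ L
  ∏z-injective n L [] le eq ()
  ∏z-injective n L (y ∷ M₀) le eq {x} x∈ = remove n le (∈-∃++ (member L (y ∷ M₀) eq least w∈)) (∈-∃++ (member (y ∷ M₀) L (sym ∘ eq) (least ∘ swap) (swap-both w∈)))
    where
    M = y ∷ M₀
    low = lowest ht y (M₀ ++ L)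
    w = proj₁ low

    swap : ∀ {b} → b ∈ M ++ L → b ∈ L ++ M
    swap b∈ = [ ∈-++⁺ʳ L , ∈-++⁺ˡ ]′ (∈-++⁻ M b∈)

    swap-both : w ∈ L ++ M → w ∈ M ++ L
    swap-both b∈ = [ ∈-++⁺ʳ M , ∈-++⁺ˡ ]′ (∈-++⁻ L b∈)

    w∈ : w ∈ L ++ M
    w∈ = swap (proj₁ (proj₂ low))

    least : ∀ {b} → b ∈ L ++ M → ht w ≤ ht b
    least b∈ = proj₂ (proj₂ low) ([ ∈-++⁺ʳ M , ∈-++⁺ˡ ]′ (∈-++⁻ L b∈))

    value : ∀ K → (∀ {b} → b ∈ K → ht w ≤ ht b) → ∏z K ⟦ w ⟧ ≡ + #≡ w K
    value K least = trans (∏z-value K w) (trans (cong₂ (λ a b → + #≡ w K + (+ a - + b))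
      (no-filter (λ v → up v ≟ⱽ w) K λ {v} v∈ up≡ → ℤ.<⇒≱ (subst (λ u → ht v < ht u) up≡ (↑²-> (proj₂ v))) (least v∈))
      (no-filter (λ v → Diagonal? v w) K λ {v} v∈ (_ , ht≡) → ℤ.<⇒≱ (+1≤⇒< (ℤ.≤-reflexive (sym ht≡))) (least v∈)))
      (ℤ.+-identityʳ _))

    member : ∀ K N → (∀ u → ∏z K ⟦ u ⟧ ≡ ∏z N ⟦ u ⟧) → (∀ {b} → b ∈ K ++ N → ht w ≤ ht b) → w ∈ K ++ N → w ∈ K
    member K N eq least w∈ = [ id , from-other ]′ (∈-++⁻ K w∈)
      where
      from-other : w ∈ N → w ∈ K
      from-other w∈N = let v , v∈ , v≡w = some-filter (_≟ⱽ w) K λ none → absent w∈N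
                             (ℤ.+-injective (trans (sym (value N (least ∘ ∈-++⁺ʳ K))) (trans (sym (eq w)) (trans (value K (least ∘ ∈-++⁺ˡ)) (cong +_ none)))))
                       in subst (_∈ K) v≡w v∈
        where
        nonempty : ∀ {x : I×̇ℤ} {K} → x ∈ K → length K ≢ 0
        nonempty (here _)  ()
        nonempty (there _) ()
        absent : w ∈ N → ¬ #≡ w N ≡ 0
        absent w∈N = nonempty (∈-filter⁺ (_≟ⱽ w) w∈N refl)

    remove : ∀ n → length L ℕ.≤ n → (∃ λ pre → ∃ λ post → L ≡ pre ++ w ∷ post) → (∃ λ pre → ∃ λ post → M ≡ pre ++ w ∷ post) → x ∈ L
    remove n le (pre , post , L≡) (pre′ , post′ , M≡) = shorter n (subst (λ K → length K ℕ.≤ n) L≡ le)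
      where
      rest : ∀ u → ∏z (pre ++ post) ⟦ u ⟧ ≡ ∏z (pre′ ++ post′) ⟦ u ⟧
      rest u = +-cancelˡ (z w ⟦ u ⟧) (trans (sym (pick pre post)) (trans (cong (λ K → ∏z K ⟦ u ⟧) (sym L≡)) (trans (eq u) (trans (cong (λ K → ∏z K ⟦ u ⟧) M≡) (pick pre′ post′)))))
        where
        pick : ∀ pre post → ∏z (pre ++ w ∷ post) ⟦ u ⟧ ≡ z w ⟦ u ⟧ + ∏z (pre ++ post) ⟦ u ⟧
        pick pre post = trans (∏-⟪⟫ (pre ++ w ∷ post) z (inj₂ u)) (trans (Σℤ-pick pre w post)
          (cong (λ n → z w ⟦ u ⟧ + n) (sym (∏-⟪⟫ (pre ++ post) z (inj₂ u)))))
      back : x ∈ pre ++ post → x ∈ L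
      back x∈ = subst (x ∈_) (sym L≡) ([ ∈-++⁺ˡ , (λ h → ∈-++⁺ʳ pre (there h)) ]′ (∈-++⁻ pre x∈))
      shorter : ∀ n → length (pre ++ w ∷ post) ℕ.≤ n → x ∈ L
      shorter zero    le = contradiction (trans (sym (ℕ.+-suc (length pre) (length post))) (trans (sym (List.length-++ pre)) (ℕ.n≤0⇒n≡0 le))) λ ()
      shorter (suc n) le = [ (λ x≡w → subst (x ∈_) (sym L≡) (subst (_∈ pre ++ w ∷ post) (sym x≡w) (∈-insert pre))) ,
          (λ x∈′ → back (∏z-injective n (pre ++ post) (pre′ ++ post′)
            (ℕ.≤-pred (ℕ.≤-trans (ℕ.≤-reflexive (trans (cong suc (List.length-++ pre)) (trans (sym (ℕ.+-suc (length pre) (length post))) (sym (List.length-++ pre))))) le))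
            rest x∈′)) ]′ (split-member pre′ (subst (x ∈_) M≡ x∈))

  count-sum : ∀ (g : I×̇ℤ → ℤ) U → Unique U → ∀ L → (∀ {x} → x ∈ L → x ∈ U) →
              Σℤ U (λ v → + #≡ v L * g v) ≡ Σℤ L g
  count-sum g U u []      L⊆U = Σℤ-zero U λ {v} _ → ℤ.*-zeroˡ (g v)
  count-sum g U u (x ∷ L) L⊆U = trans (Σℤ-cong U λ {v} _ → expand v) (trans (Σℤ-+ U)
    (cong₂ _+_ (Σℤ-point _≟ⱽ_ x U u (L⊆U (here refl))) (count-sum g U u L (L⊆U ∘ there))))
    where
    expand : ∀ v → + #≡ v (x ∷ L) * g v ≡ [ x ≟ⱽ v ] g v + + #≡ v L * g v
    expand v with does (x ≟ⱽ v)
    ... | true  = trans (ℤ.*-distribʳ-+ (g v) 1ℤ (+ #≡ v L)) (cong (_+ + #≡ v L * g v) (ℤ.*-identityˡ (g v)))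
    ... | false = sym (ℤ.+-identityˡ _)

  ^-⟪⟫ : ∀ p n κ → (p ^ n) ⟪ κ ⟫ ≡ + n * p ⟪ κ ⟫
  ^-⟪⟫ p zero    κ = 𝟙-⟪⟫ κ
  ^-⟪⟫ p (suc n) κ = trans (·-⟪⟫ p (p ^ n) κ) (trans (cong (λ a → p ⟪ κ ⟫ + a) (^-⟪⟫ p n κ)) (arith (p ⟪ κ ⟫) (+ n)))
    where
    arith : ∀ a n → a + n * a ≡ (1ℤ + n) * a
    arith = solve-∀

  toMultiset : List I×̇ℤ → Multiset
  toMultiset L = record
    { mult     = λ v → #≡ v L
    ; support  = deduplicate _≟ⱽ_ L
    ; unique   = DecUnique.deduplicate-! _≟ⱽ_ L
    ; complete = λ {v} ne → let u , u∈ , u≡v = some-filter (_≟ⱽ v) L ne in ∈-deduplicate⁺ _≟ⱽ_ (subst (_∈ L) u≡v u∈)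
    }

  z^toMultiset : ∀ L → z^ (toMultiset L) ≋ ∏z L
  z^toMultiset L = ≋-ext λ κ → trans (∏-⟪⟫ (deduplicate _≟ⱽ_ L) (λ v → z v ^ #≡ v L) κ)
    (trans (Σℤ-cong (deduplicate _≟ⱽ_ L) λ {v} _ → ^-⟪⟫ (z v) (#≡ v L) κ)
      (trans (count-sum (λ v → z v ⟪ κ ⟫) (deduplicate _≟ⱽ_ L) (DecUnique.deduplicate-! _≟ⱽ_ L) L (∈-deduplicate⁺ _≟ⱽ_))
        (sym (∏-⟪⟫ L z κ))))

  fromMultiset : Multiset → List I×̇ℤ
  fromMultiset S = concatMap (λ v → replicate (mult S v) v) (support S)

  ∏z-fromMultiset : ∀ S → ∏z (fromMultiset S) ≋ z^ S
  ∏z-fromMultiset S = ≋-ext λ κ → trans (∏-⟪⟫ (fromMultiset S) z κ) (trans (go κ (support S))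
    (trans (Σℤ-cong (support S) λ {v} _ → sym (^-⟪⟫ (z v) (mult S v) κ)) (sym (∏-⟪⟫ (support S) (λ v → z v ^ mult S v) κ))))
    where
    repeated : ∀ κ n v → Σℤ (replicate n v) (λ v → z v ⟪ κ ⟫) ≡ + n * z v ⟪ κ ⟫
    repeated κ zero    v = refl
    repeated κ (suc n) v = trans (cong (λ a → z v ⟪ κ ⟫ + a) (repeated κ n v)) (arith (z v ⟪ κ ⟫) (+ n))
      where
      arith : ∀ a n → a + n * a ≡ (1ℤ + n) * a
      arith = solve-∀
    go : ∀ κ vs → Σℤ (concatMap (λ v → replicate (mult S v) v) vs) (λ v → z v ⟪ κ ⟫) ≡ Σℤ vs (λ v → + mult S v * z v ⟪ κ ⟫)
    go κ []       = refl
    go κ (v ∷ vs) = trans (Σℤ-++ (replicate (mult S v) v) _) (cong₂ _+_ (repeated κ (mult S v) v) (go κ vs))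

  ∈-fromMultiset : ∀ S {x} → x ∈ fromMultiset S → mult S x ≢ 0
  ∈-fromMultiset S x∈ = let v , _ , x∈v = find (∈-concatMap⁻ (λ v → replicate (mult S v) v) {xs = support S} x∈) in occurs v x∈v
    where
    replicated : ∀ {x v : I×̇ℤ} n → x ∈ replicate n v → x ≡ v × n ≢ 0
    replicated (suc n) (here refl) = refl , λ ()
    replicated (suc n) (there x∈)  = proj₁ (replicated n x∈) , λ ()
    occurs : ∀ v {x} → x ∈ replicate (mult S v) v → mult S x ≢ 0
    occurs v x∈ = let x≡v , ne = replicated (mult S v) x∈ in subst (λ u → mult S u ≢ 0) (sym x≡v) ne

  sumWhere-vanish : ∀ {ℓ} {Q : Pred I×̇ℤ ℓ} (Q? : Decidable Q) p → (∀ v → Q v → p ⟦ v ⟧ ≡ 0ℤ) → sumWhere Q? (factors p) ≡ 0ℤ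
  sumWhere-vanish Q? p vanish = trans (sumWhere-by-values _≟ⱽ_ Q? U (DecUnique.deduplicate-! _≟ⱽ_ _) (factors p) λ x∈ → ∈-deduplicate⁺ _≟ⱽ_ (∈-map⁺ proj₂ x∈))
    (Σℤ-zero U λ {v} _ → entry v (Q? v))
    where
    U = deduplicate _≟ⱽ_ (map proj₂ (factors p))
    entry : ∀ v (d : Dec _) → [ d ] (p ⟦ v ⟧) ≡ 0ℤ
    entry v (yes q) = vanish v q
    entry v (no _)  = refl

  module _ (R : Multiset) (Rϖ : Integral R) {ℓ} (J : Pred I×̇ℤ ℓ) (J-up : UpwardClosed J) (R⊆J : Supp R ⊆ J) where

    Y : Monomial
    Y = yᴿ R Rϖ

    M : Pred Monomial 0ℓ
    M = ℳ R Rϖ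

    open StronglyClosed (ℳ-closed R Rϖ) renaming (resp to M-resp; closed-f to M-f; closed-e to M-e) using ()

    Y-support : ∀ w → Y ⟦ w ⟧ ≢ 0ℤ → J w
    Y-support w ne = R⊆J λ mult≡0 → ne (trans (∏-⟪⟫ (support R) (y-of R Rϖ) (inj₂ w))
      (Σℤ-zero (support R) λ {v} _ → trans (ℤ.+-identityʳ _) (entry v mult≡0 (v ≟ⱽ w))))
      where
      entry : ∀ v → mult R w ≡ 0 → (d : Dec (v ≡ w)) → [ d ] (+ mult R v) ≡ 0ℤ
      entry v mult≡0 (yes eq) = cong +_ (trans (cong (mult R) eq) mult≡0)
      entry v mult≡0 (no _)   = refl

    Form : Monomial → List I×̇ℤ → Set
    Form p L = p ≋ Y · ∏z L ⁻¹

    form-unique : ∀ {p L K} → Form p L → Form p K → ∀ {x} → x ∈ K → x ∈ L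
    form-unique {p} {L} {K} pL pK = ∏z-injective (length L) L K ℕ.≤-refl λ w → cancel (Y ⟦ w ⟧)
      (trans (sym (quotient-⟪⟫ Y (∏z L) (inj₂ w))) (trans (trans (sym (≋-⟪⟫ pL (inj₂ w))) (≋-⟪⟫ pK (inj₂ w))) (quotient-⟪⟫ Y (∏z K) (inj₂ w))))
      where
      cancel : ∀ a {b c} → a - b ≡ a - c → b ≡ c
      cancel a {b} {c} eq = ℤ.neg-injective (+-cancelˡ a eq)

    form-value : ∀ {p} L → Form p L → ∀ w → p ⟦ w ⟧ ≡ Y ⟦ w ⟧ - (+ #≡ w L + (+ #↑ w L - + #∠ w L))
    form-value {p} L pL w = trans (≋-⟪⟫ pL (inj₂ w)) (trans (quotient-⟪⟫ Y (∏z L) (inj₂ w)) (cong (λ a → Y ⟦ w ⟧ - a) (∏z-value L w)))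

    form-quotient : ∀ {p q w} L → Form p L → q ≋ p · z w ⁻¹ → Form q (w ∷ L)
    form-quotient {p} {q} {w} L pL q≋ = ≋-trans q≋ (≋-trans (·-cong pL ≋-refl) (≋-ext λ κ →
      trans (quotient-⟪⟫ (Y · ∏z L ⁻¹) (z w) κ) (trans (cong (_- z w ⟪ κ ⟫) (quotient-⟪⟫ Y (∏z L) κ))
        (trans (arith (Y ⟪ κ ⟫) (∏z L ⟪ κ ⟫) (z w ⟪ κ ⟫))
          (sym (trans (quotient-⟪⟫ Y (z w · ∏z L) κ) (cong (λ a → Y ⟪ κ ⟫ - a) (·-⟪⟫ (z w) (∏z L) κ))))))))
      where
      arith : ∀ a b c → a - b - c ≡ a - (c + b)
      arith = solve-∀

    form-product : ∀ {p q w} K → Form q K → q ≋ p · z w → Form p (w ∷ K)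
    form-product {p} {q} {w} K qK q≋ = form-quotient K qK (≋-trans (≋-sym (··⁻¹-cancel p (z w))) (·-cong (≋-sym q≋) ≋-refl))

    Within : ∀ {ℓ′} → Pred I×̇ℤ ℓ′ → Pred Monomial ℓ′
    Within A p = M p × ∃ λ L → Form p L × (∀ {x} → x ∈ L → A x)

    within-mono : ∀ {ℓ₁ ℓ₂} {A : Pred I×̇ℤ ℓ₁} {B : Pred I×̇ℤ ℓ₂} → (∀ {x} → A x → B x) → ∀ {p} → Within A p → Within B p
    within-mono A⊆B (m , L , pL , L⊆A) = m , L , pL , A⊆B ∘ L⊆A

    enumerates-cong : ∀ {ℓ₁ ℓ₂} {X₁ : Pred Monomial ℓ₁} {X₂ : Pred Monomial ℓ₂} →
      (∀ {p} → X₁ p → X₂ p) → (∀ {p} → X₂ p → X₁ p) → ∀ {L} → Enumerates X₁ L → Enumerates X₂ L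
    enumerates-cong to from E = record { sound = to ∘ sound ; exhaust = exhaust ∘ from ; distinct = distinct }
      where open Enumerates E

    -- One vertex (i , c) outside `J` is removed from `A`, the lowest vertex of `A` in column i.
    -- Because `J` is upward closed without containing it, the vertices of column i in `J`, or
    -- diagonally above `J`, are higher than c.
    module Step {ℓ′} (A A⁻ : Pred I×̇ℤ ℓ′) (i : I) (c : Height i) (v∉J : ¬ J (i , c))
      (A⁻⊆A : ∀ {x} → A⁻ x → A x) (A⊆A⁻ : ∀ {x} → A x → x ≢ (i , c) → A⁻ x) (v∉A⁻ : ¬ A⁻ (i , c))
      (A⊆ : ∀ {x} → A x → J x ⊎ height c ≤ ht x) (⊆A : ∀ {l} → height c ≤ height l → A (i , l)) where

      v : I×̇ℤ
      v = i , c

      J-column : ∀ {l} → J (i , l) → height c < height l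
      J-column {l} j = ℤ.≰⇒> λ le → v∉J (J-up (column l c le) j)

      J-diagonal : ∀ {x l} → J x → Diagonal x (i , l) → height c < height l
      J-diagonal {x} {l} j d = J-column {l} (J-up (diagonal-≼ {x} {i , l} d) j)

      in-A-diagonal : ∀ {x l} → A x → Diagonal x (i , l) → height c < height l
      in-A-diagonal {x} {l} a d@(_ , eq) = [ (λ j → J-diagonal {x} {l} j d) , (λ le → ℤ.≤-<-trans le (+1≤⇒< (ℤ.≤-reflexive (sym eq)))) ]′ (A⊆ a)

      in-A-column : ∀ {l} → A (i , l) → height c ≤ height l
      in-A-column a = [ (λ j → ℤ.<⇒≤ (J-column j)) , id ]′ (A⊆ a)

      module _ {p : Monomial} (L : List I×̇ℤ) (pL : Form p L) (L⊆A : ∀ {x} → x ∈ L → A x) where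

        -- A positive contribution comes from `Y`, supported in `J`, or from a vertex of `L` one
        -- diagonal step below. Either forces a height above c, so f_i, which adds the vertex at F -
        -- 2 to S, does not leave `A`.
        positive-above : ∀ F → 0ℤ < p ⟦ i , F ⟧ → height c < height F
        positive-above F pos with Y ⟦ i , F ⟧ ℤ.≟ 0ℤ | #∠ (i , F) L ℕ.≟ 0
        ... | no ne  | _      = J-column (Y-support (i , F) ne)
        ... | yes _  | no ne  = let x , x∈ , d = some-filter (λ u → Diagonal? u (i , F)) L ne in in-A-diagonal {x} {F} (L⊆A x∈) d
        ... | yes y0 | yes d0 = ⊥-elim (ℤ.<⇒≱ pos (ℤ.≤-trans (ℤ.≤-reflexive (trans (form-value {p} L pL (i , F))
                (trans (cong₂ (λ y d → y - (+ #≡ (i , F) L + (+ #↑ (i , F) L - + d))) y0 d0)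
                  (arith (+ #≡ (i , F) L) (+ #↑ (i , F) L))))) (neg-≤0 (#≡ (i , F) L ℕ.+ #↑ (i , F) L))))
          where
          arith : ∀ a b → 0ℤ - (a + (b - 0ℤ)) ≡ - (a + b)
          arith = solve-∀

        -- So low in the column neither `Y` nor a vertex below or diagonally below contributes,
        -- which leaves the multiplicity of the vertex itself.
        value-below : ∀ l → height l ≤ height c → p ⟦ i , l ⟧ ≡ - + #≡ (i , l) L
        value-below l le = trans (form-value {p} L pL (i , l)) (trans (cong₂ (λ y n → y - (+ #≡ (i , l) L + n)) Y≡0
          (cong₂ (λ a b → + a - + b) up0 diag0)) (arith (+ #≡ (i , l) L)))
          where
          arith : ∀ a → 0ℤ - (a + 0ℤ) ≡ - a
          arith = solve-∀
          Y≡0 : Y ⟦ i , l ⟧ ≡ 0ℤ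
          Y≡0 = decidable-stable (Y ⟦ i , l ⟧ ℤ.≟ 0ℤ) λ ne → ℤ.<⇒≱ (J-column (Y-support (i , l) ne)) le
          up0 : #↑ (i , l) L ≡ 0
          up0 = no-filter (λ u → up u ≟ⱽ (i , l)) L λ { {x} x∈ refl →
            ℤ.<⇒≱ (ℤ.<-≤-trans (↑²-> (proj₂ x)) le) (in-A-column (L⊆A x∈)) }
          diag0 : #∠ (i , l) L ≡ 0
          diag0 = no-filter (λ u → Diagonal? u (i , l)) L λ {x} x∈ d → ℤ.<⇒≱ (in-A-diagonal {x} {l} (L⊆A x∈) d) le

        value-at : p ⟦ v ⟧ ≡ - + #≡ v L
        value-at = value-below c ℤ.≤-refl

        zero-iff : (p ⟦ v ⟧ ≡ 0ℤ → ∀ {x} → x ∈ L → x ≢ v) × ((∀ {x} → x ∈ L → x ≢ v) → p ⟦ v ⟧ ≡ 0ℤ)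
        zero-iff = (λ eq x∈ x≡v → occurs x∈ x≡v (ℤ.+-injective (ℤ.neg-injective (trans (sym value-at) eq)))) ,
                   (λ none → trans value-at (cong (λ n → - + n) (no-filter (_≟ⱽ v) L none)))
          where
          nonempty : ∀ {x : I×̇ℤ} {K} → x ∈ K → length K ≢ 0
          nonempty (here _)  ()
          nonempty (there _) ()
          occurs : ∀ {x} → x ∈ L → x ≡ v → #≡ v L ≢ 0
          occurs x∈ x≡v = nonempty (∈-filter⁺ (_≟ⱽ v) x∈ x≡v)

        -- All exponents of column i below c vanish, as `A` has no vertex there.
        φ-total : φ i p c ≡ total i p
        φ-total = trans (arith (φ i p c) (total i p)) (trans (cong (_+ total i p) zero-ε) (ℤ.+-identityˡ _))
          where
          arith : ∀ a t → a ≡ a - t + t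
          arith = solve-∀
          zero-ε : φ i p c - total i p ≡ 0ℤ
          zero-ε = trans (cong (λ k → φ i p k - total i p) (sym (↑²↓² c))) (trans (sym (ε-φ i p (c ↓²)))
            (cong -_ (sumWhere-vanish (λ u → (proj₁ u Fin.≟ i) ×-dec (ht u ℤ.≤? height (c ↓²))) p λ { (_ , l) (refl , le) →
              let l<c = ℤ.≤-<-trans le (↓²-< c) in
              trans (value-below l (ℤ.<⇒≤ l<c)) (cong (λ n → - + n) (no-filter (_≟ⱽ (i , l)) L λ { x∈ refl →
                ℤ.<⇒≱ l<c (in-A-column (L⊆A x∈)) })) })))

      -- A decidable form of the condition that S does not contain `v`, by `zero-iff`.
      D : Pred Monomial 0ℓ
      D p = p ⟦ v ⟧ ≡ 0ℤ

      D? : Decidable D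
      D? p = p ⟦ v ⟧ ℤ.≟ 0ℤ

      D-resp : Respects D
      D-resp eq d = trans (sym (≋-⟪⟫ eq (inj₂ v))) d

      X : Pred Monomial ℓ′
      X = Within A

      X-f : ∀ {p q} → X p → f[ i ] p ↦ q → X q
      X-f {p} {q} (m , L , pL , L⊆A) step@(_ , F , _ , _ , _ , _ , q≈) =
        M-f {i} {p} {q} m step , (i , F ↓²) ∷ L , form-quotient L pL (wrap q≈) , λ where
          (here refl) → ⊆A {F ↓²} (ℤ.≤-trans (ℤ.≤-reflexive (cong height (sym (↓²↑² c)))) (≤-↓² {k = c ↑²} {F} (gap c F (positive-above L pL L⊆A F (f-positive {i} {p} {q} step)))))
          (there x∈) → L⊆A x∈

      -- As an element of ℳ(R), `q` has a form `K` of its own, and then `p` has the form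
      -- `(i , E) ∷ K`. Uniqueness puts `K` inside `L`: e_i only takes vertices away from S.
      e-form : ∀ {p q L} → M p → Form p L → e[ i ] p ↦ q → ∃ λ K → Form q K × (∀ {x} → x ∈ K → x ∈ L)
      e-form {p} {q} m pL step@(_ , E , _ , _ , _ , _ , q≈) =
        let K , qK , _ = products-form R Rϖ (M-e {i} {p} {q} m step)
        in K , qK , λ x∈ → form-unique pL (form-product K qK (wrap q≈)) (there x∈)

      X-e : ∀ {p q} → X p → e[ i ] p ↦ q → X q
      X-e {p} {q} (m , L , pL , L⊆A) step = let K , qK , K⊆L = e-form {p} {q} m pL step in M-e {i} {p} {q} m step , K , qK , L⊆A ∘ K⊆L

      X-stable : Stable i X
      X-stable = record
        { resp     = λ { eq (m , L , pL , L⊆A) → M-resp eq m , L , ≋-trans (≋-sym eq) pL , L⊆A }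
        ; closed-f = λ {p} {q} → X-f {p} {q}
        ; closed-e = λ {p} {q} → X-e {p} {q}
        }

      -- The partial sum ε at c is minus the exponent at `v`, which is the multiplicity of `v` in S.
      -- At a top no partial sum ε is positive.
      D-top : ∀ {p} → X p → Top i p → D p
      D-top {p} (m , L , pL , L⊆A) top = ℤ.≤-antisym
        (ℤ.≤-trans (ℤ.≤-reflexive (value-at L pL L⊆A)) (neg-≤0 (#≡ v L)))
        (subst (0ℤ ≤_) (ℤ.neg-involutive _) (ℤ.neg-mono-≤ (ℤ.≤-trans (ℤ.≤-reflexive (sym ε-value)) (ℤ.≤-trans (proj₂ (ε̂-max i p) c) (ℤ.≤-reflexive top)))))
        where
        arith : ∀ a b t → a ≡ t → b - t ≡ - (a - b)
        arith a b .a refl = flipped b a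
          where
          flipped : ∀ b a → b - a ≡ - (a - b)
          flipped = solve-∀
        cancel : ∀ a b → a ≡ a + b - b
        cancel = solve-∀
        ε-value : ε i p c ≡ - p ⟦ v ⟧
        ε-value = trans (ε-φ i p c) (trans (arith (φ i p c) (φ i p (c ↑²)) (total i p) (φ-total L pL L⊆A))
          (cong -_ (trans (cong (_- φ i p (c ↑²)) (φ-step i p c)) (sym (cancel (p ⟦ v ⟧) (φ i p (c ↑²)))))))

      -- f_i could add `v` only with F = c + 2. As the exponent at `v` is 0, the maximum φ there
      -- would equal φ at c, which is the column total, so ε̂ would be 0 and `p` a top.
      D-f : ∀ {p q} → X p → D p → ¬ Top i p → f[ i ] p ↦ q → D q
      D-f {p} {q} x@(m , L , pL , L⊆A) d ntop step@(mx , F , max , _ , φF , _ , q≈) =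
        let _ , L′ , qL′ , L′⊆A = X-f {p} {q} x step in
        proj₂ (zero-iff L′ qL′ (λ {x} → L′⊆A {x})) λ x∈ → absent (form-unique (form-quotient L pL (wrap q≈)) qL′ x∈)
        where
        absent : ∀ {x} → x ∈ (i , F ↓²) ∷ L → x ≢ v
        absent (there x∈) = proj₁ (zero-iff L pL L⊆A) d x∈
        absent (here refl) eq = ntop (trans (ε̂-φ̂ i p) (trans (cong (_- total i p) (trans (IsMaximum-unique (φ̂-max i p) max) max≡total)) (ℤ.+-inverseʳ (total i p))))
          where
          F≡ : F ≡ c ↑²
          F≡ = Height-≡ (trans (cong height (sym (↑²↓² F))) (cong (_+ + 2) (cong ht eq)))
          max≡total : mx ≡ total i p
          max≡total = trans (sym φF) (trans (cong (φ i p) F≡) (trans (sym (trans (φ-step i p c) (trans (cong (_+ φ i p (c ↑²)) d) (ℤ.+-identityˡ _)))) (φ-total L pL L⊆A)))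

      D-e : ∀ {p q} → X p → D p → e[ i ] p ↦ q → D q
      D-e {p} {q} (m , L , pL , L⊆A) d step =
        let K , qK , K⊆L = e-form {p} {q} m pL step in
        proj₂ (zero-iff K qK (L⊆A ∘ K⊆L)) λ x∈ → proj₁ (zero-iff L pL L⊆A) d (K⊆L x∈)

      within-A⁻ : ∀ {L} → Enumerates (Within A) L → Enumerates (Within A⁻) (filter D? L)
      within-A⁻ E = enumerates-cong to from (filter-enumerates D? D-resp E)
        where
        to : ∀ {p} → Within A p × D p → Within A⁻ p
        to ((m , L , pL , L⊆A) , d) = m , L , pL , λ x∈ → A⊆A⁻ (L⊆A x∈) (proj₁ (zero-iff L pL L⊆A) d x∈)
        from : ∀ {p} → Within A⁻ p → Within A p × D p
        from (m , L , pL , L⊆A⁻) = (m , L , pL , A⁻⊆A ∘ L⊆A⁻) ,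
          proj₂ (zero-iff L pL (A⁻⊆A ∘ L⊆A⁻)) λ { x∈ refl → v∉A⁻ (L⊆A⁻ x∈) }

      step : ∀ {L} → Enumerates (Within A) L → character L ≈ᴾ π i (character (filter D? L))
      step E = step-character i X-stable E D? D-resp (λ {p} → D-top {p}) (λ {p} {q} → D-f {p} {q}) (λ {p} {q} → D-e {p} {q})

    -- A stage of the removal of the vertices outside `J`, by increasing height and, at one height,
    -- by increasing index of the node. At height `c` the nodes of index below `t` have been dealt
    -- with.
    Above : ℤ → ℕ → Pred I×̇ℤ ℓ
    Above c t x = J x ⊎ c < ht x ⊎ (ht x ≡ c × t ℕ.≤ toℕ (proj₁ x))

    -- Whether J contains a given vertex is not decidable, hence the double negation.
    Descends : Pred I×̇ℤ ℓ → Set ℓ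
    Descends A = ∀ {L} → Enumerates (Within A) L →
      ¬ ¬ (∃ λ u → ∃ λ L₀ → Enumerates (Within J) L₀ × character L ≈ᴾ π-word u (character L₀))

    descends-cong : ∀ {A B : Pred I×̇ℤ ℓ} → (∀ {x} → A x → B x) → (∀ {x} → B x → A x) → Descends B → Descends A
    descends-cong A⊆B B⊆A desc E = desc (enumerates-cong (within-mono A⊆B) (within-mono B⊆A) E)

    -- Passing from index t to t + 1 changes nothing if the parity of c rules out a vertex at this
    -- node or if the vertex lies in `J`. Otherwise `Step` contributes one letter to the word.
    descends-level : ∀ c t (t< : t ℕ.< #simple) → Descends (Above c (suc t)) → Descends (Above c t)
    descends-level c t t< desc {L} E k = by-parity (parityℤ c Parity.≟ colour node)
      where
      node : I
      node = Fin.fromℕ< t<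

      toℕ-node : toℕ node ≡ t
      toℕ-node = Fin.toℕ-fromℕ< t<

      weaken : ∀ {x} → Above c (suc t) x → Above c t x
      weaken (inj₁ j)                = inj₁ j
      weaken (inj₂ (inj₁ lt))        = inj₂ (inj₁ lt)
      weaken (inj₂ (inj₂ (eq , le))) = inj₂ (inj₂ (eq , ℕ.≤-trans (ℕ.n≤1+n t) le))

      strengthen : ∀ {x} → (ht x ≡ c → proj₁ x ≡ node → J x) → Above c t x → Above c (suc t) x
      strengthen h (inj₁ j)                = inj₁ j
      strengthen h (inj₂ (inj₁ lt))        = inj₂ (inj₁ lt)
      strengthen {x} h (inj₂ (inj₂ (eq , le))) with t ℕ.≟ toℕ (proj₁ x)
      ... | yes t≡ = inj₁ (h eq (Fin.toℕ-injective (sym (trans toℕ-node t≡))))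
      ... | no t≢  = inj₂ (inj₂ (eq , ℕ.≤∧≢⇒< le t≢))

      same : (∀ {x} → ht x ≡ c → proj₁ x ≡ node → J x) → ⊥
      same h = descends-cong {A = Above c t} {Above c (suc t)} (λ {x} → strengthen {x} h) (λ {x} → weaken {x}) desc E k

      by-parity : Dec (parityℤ c ≡ colour node) → ⊥
      by-parity (no ne) = same no-vertex
        where
        no-vertex : ∀ {x} → ht x ≡ c → proj₁ x ≡ node → J x
        no-vertex {_ , mkHeight _ p} refl refl = ⊥-elim-irr (ne p)
      -- The goal is absurdity, so it may be argued as if membership of `v` in `J` were decided.
      by-parity (yes p) = remove λ j → same λ {x} h≡ n≡ → subst J (sym (vertex-≡ {x} {v} n≡ h≡)) j
        where
        v : I×̇ℤ
        v = node , mkHeight c p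
        remove : ¬ ¬ J v
        remove v∉J = desc (Step-v.within-A⁻ E) λ (u , L₀ , E₀ , eq) →
          k (node ∷ u , L₀ , E₀ , trans-≈ᴾ {character L} {π node (character (filter Step-v.D? L))} {π node (π-word u (character L₀))}
            (Step-v.step E) (π-cong node {character (filter Step-v.D? L)} {π-word u (character L₀)} eq))
          where
          open DemazureOperators 𝒮 using (π-cong)
          bound : ∀ {x} → Above c t x → J x ⊎ c ≤ ht x
          bound (inj₁ j)               = inj₁ j
          bound (inj₂ (inj₁ lt))       = inj₂ (ℤ.<⇒≤ lt)
          bound (inj₂ (inj₂ (eq , _))) = inj₂ (ℤ.≤-reflexive (sym eq))
          excluded : ¬ Above c (suc t) v
          excluded (inj₁ j)               = v∉J j
          excluded (inj₂ (inj₁ lt))       = ℤ.<-irrefl refl lt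
          excluded (inj₂ (inj₂ (_ , le))) = ℕ.<-irrefl refl (ℕ.≤-trans le (ℕ.≤-reflexive toℕ-node))
          above : ∀ l → c ≤ height l → Above c t (node , l)
          above l le with c ℤ.≟ height l
          ... | yes eq = inj₂ (inj₂ (sym eq , ℕ.≤-reflexive (sym toℕ-node)))
          ... | no ne  = inj₂ (inj₁ (ℤ.≤∧≢⇒< le ne))
          module Step-v = Step (Above c t) (Above c (suc t)) node (mkHeight c p) v∉J
            (λ {x} → weaken {x}) (λ {x} a x≢v → strengthen {x} (λ h≡ n≡ → contradiction (vertex-≡ {x} {v} n≡ h≡) x≢v) a)
            excluded (λ {x} → bound {x}) (λ {l} → above l)

    -- `m` counts the nodes left at height c. When none is left, the stage coincides with the first
    -- one of height c + 1.
    descends-row : ∀ c m t → t ℕ.+ m ≡ #simple → Descends (Above (c + 1ℤ) 0) → Descends (Above c t)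
    descends-row c zero t eq desc = descends-cong {A = Above c t} {Above (c + 1ℤ) 0} up-level down-level desc
      where
      full : ∀ (x : I×̇ℤ) → ¬ t ℕ.≤ toℕ (proj₁ x)
      full x le = ℕ.<⇒≱ (Fin.toℕ<n (proj₁ x)) (ℕ.≤-trans (ℕ.≤-reflexive (trans (sym eq) (ℕ.+-identityʳ t))) le)
      up-level : ∀ {x} → Above c t x → Above (c + 1ℤ) 0 x
      up-level (inj₁ j)               = inj₁ j
      up-level {x} (inj₂ (inj₁ lt)) with c + 1ℤ ℤ.≟ ht x
      ... | yes eq = inj₂ (inj₂ (sym eq , z≤n))
      ... | no ne  = inj₂ (inj₁ (ℤ.≤∧≢⇒< (<⇒+1≤ lt) ne))
      up-level {x} (inj₂ (inj₂ (_ , le))) = contradiction le (full x)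
      down-level : ∀ {x} → Above (c + 1ℤ) 0 x → Above c t x
      down-level (inj₁ j)                = inj₁ j
      down-level (inj₂ (inj₁ lt))        = inj₂ (inj₁ (+1≤⇒< (ℤ.<⇒≤ lt)))
      down-level (inj₂ (inj₂ (eq , _)))  = inj₂ (inj₁ (+1≤⇒< (ℤ.≤-reflexive (sym eq))))
    descends-row c (suc m) t eq desc = descends-level c t (subst (t ℕ.<_) eq (ℕ.m<m+n t (s≤s z≤n)))
      (descends-row c m (suc t) (trans (sym (ℕ.+-suc t m)) eq) desc)

    bound-heights : ∀ (vs : List I×̇ℤ) → ∃ λ B → ∀ {v} → v ∈ vs → ht v ≤ B
    bound-heights []       = 0ℤ , λ ()
    bound-heights (v ∷ vs) = let B , b = bound-heights vs in ht v ℤ.⊔ B , λ where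
      (here refl) → ℤ.i≤i⊔j (ht v) B
      (there v∈)  → ℤ.≤-trans (b v∈) (ℤ.i≤j⊔i (ht v) B)

    below-heights : ∀ (vs : List I×̇ℤ) → ∃ λ B → ∀ {v} → v ∈ vs → B ≤ ht v
    below-heights []       = 0ℤ , λ ()
    below-heights (v ∷ vs) = let B , b = below-heights vs in ht v ℤ.⊓ B , λ where
      (here refl) → ℤ.i⊓j≤i (ht v) B
      (there v∈)  → ℤ.≤-trans (ℤ.i⊓j≤j (ht v) B) (b v∈)

    top-height : ℤ
    top-height = proj₁ (bound-heights (support R))

    -- Every vertex of S lies below some vertex of the support list of `R`. From this height on, the
    -- stage adds nothing to `J` that could occur in S, and the empty word suffices.
    descends-top : ∀ c → top-height ≤ c → Descends (Above c 0)
    descends-top c le {L} E k = k ([] , L , enumerates-cong to (within-mono inj₁) E , λ _ → refl)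
      where
      to : ∀ {p} → Within (Above c 0) p → Within J p
      to (m , L , pL , L⊆) = let K , pK , K-low = products-form R Rϖ m in
        m , L , pL , λ x∈ → low (L⊆ x∈) (K-low (form-unique pK pL x∈))
        where
        low : ∀ {x} → Above c 0 x → ∃ (λ v → v ∈ support R × ht x < ht v) → J x
        low (inj₁ j) _ = j
        low (inj₂ (inj₁ lt)) (v , v∈ , lt′) = contradiction (ℤ.<-trans lt lt′) (ℤ.≤⇒≯ (ℤ.≤-trans (proj₂ (bound-heights (support R)) v∈) le))
        low (inj₂ (inj₂ (refl , _))) (v , v∈ , lt′) = contradiction lt′ (ℤ.≤⇒≯ (ℤ.≤-trans (proj₂ (bound-heights (support R)) v∈) le))

    descends : ∀ n c → top-height ≤ c + + n → Descends (Above c 0)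
    descends zero    c le = descends-top c (ℤ.≤-trans le (ℤ.≤-reflexive (ℤ.+-identityʳ c)))
    descends (suc n) c le = descends-row c #simple 0 refl (descends n (c + 1ℤ) (ℤ.≤-trans le (ℤ.≤-reflexive (sym (ℤ.+-assoc c 1ℤ (+ n))))))

    all-vertices : ∀ (L : List Monomial) → (∀ {p} → p ∈ L → M p) → ∃ λ (vs : List I×̇ℤ) → ∀ {p} → p ∈ L → ∃ λ K → Form p K × (∀ {x} → x ∈ K → x ∈ vs)
    all-vertices []      sound = [] , λ ()
    all-vertices (p ∷ L) sound =
      let K , pK , _ = products-form R Rϖ (sound (here refl))
          vs , forms = all-vertices L (sound ∘ there)
      in K ++ vs , λ where
        (here refl) → K , pK , ∈-++⁺ˡ
        (there q∈)  → let K′ , qK′ , ⊆vs = forms q∈ in K′ , qK′ , ∈-++⁺ʳ K ∘ ⊆vs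

    -- Finitely many monomials involve finitely many vertices. Starting at a lower bound for their
    -- heights, the first stage contains them all, so its truncation is the whole of ℳ(R).
    descends-ℳ : ∀ {L} → Enumerates M L →
      ¬ ¬ (∃ λ u → ∃ λ L₀ → Enumerates (Within J) L₀ × character L ≈ᴾ π-word u (character L₀))
    descends-ℳ {L} E = descends ∣ top-height - c ∣ c near record
      { sound    = λ p∈ → let K , pK , K⊆ = proj₂ occurring p∈ in sound p∈ , K , pK , λ x∈ → inside (proj₂ lowest-height (K⊆ x∈))
      ; exhaust  = exhaust ∘ proj₁
      ; distinct = distinct
      }
      where
      open Enumerates E
      occurring = all-vertices L sound
      lowest-height = below-heights (proj₁ occurring)
      c = proj₁ lowest-height
      arith : ∀ c t → t ≡ c + (t - c)
      arith = solve-∀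
      i≤∣i∣ : ∀ i → i ≤ + ∣ i ∣
      i≤∣i∣ (+ n)    = ℤ.≤-refl
      i≤∣i∣ -[1+ n ] = ℤ.-≤+
      near : top-height ≤ c + + ∣ top-height - c ∣
      near = ℤ.≤-trans (ℤ.≤-reflexive (arith c top-height)) (ℤ.+-monoʳ-≤ c (i≤∣i∣ (top-height - c)))
      inside : ∀ {x} → c ≤ ht x → Above c 0 x
      inside {x} le with c ℤ.≟ ht x
      ... | yes eq = inj₂ (inj₂ (sym eq , z≤n))
      ... | no ne  = inj₂ (inj₁ (ℤ.≤∧≢⇒< le ne))

    finite-enumerates : ∀ {ℓ′} {X : Pred Monomial ℓ′} (F : FiniteSubset X) → Enumerates X (FiniteSubset.elements F)
    finite-enumerates F = record
      { sound    = λ p∈ → All.lookup (FiniteSubset.sound F) p∈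
      ; exhaust  = λ x → let q , q∈ , p≈q = find (FiniteSubset.exhaust F x) in q , q∈ , wrap p≈q
      ; distinct = AllPairs.map (λ ne eq → ne (unwrap eq)) (FiniteSubset.distinct F)
      }

    truncated⇒within : ∀ {p} → ℳ-truncated R Rϖ J p → Within J p
    truncated⇒within {p} (m , S , p≈ , ⊆J) = m , fromMultiset S ,
      ≋-trans (wrap {p} {Y · (z^ S) ⁻¹} p≈) (·-cong ≋-refl (⁻¹-cong (≋-sym (∏z-fromMultiset S)))) ,
      λ x∈ → ⊆J (inj₂ (∈-fromMultiset S x∈))

    within⇒truncated : ∀ {p} → Within J p → ℳ-truncated R Rϖ J p
    within⇒truncated {p} (m , L , pL , L⊆J) = m , toMultiset L ,
      unwrap (≋-trans pL (·-cong ≋-refl (⁻¹-cong (≋-sym (z^toMultiset L))))) ,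
      λ { (inj₁ r) → R⊆J r ; {x} (inj₂ ne) → let y , y∈ , y≡x = some-filter (_≟ⱽ x) L ne in subst J y≡x (L⊆J y∈) }

    ℳ-stable : ∀ i → Stable i M
    ℳ-stable i = record { resp = M-resp ; closed-f = λ {p} {q} → M-f {i} {p} {q} ; closed-e = λ {p} {q} → M-e {i} {p} {q} }

    absorb-word : ∀ w → IsLongest w → ∀ u f → π-word w (π-word u f) ≈ᴾ π-word w f
    absorb-word w longest []      f = λ _ → refl
    absorb-word w longest (i ∷ u) f = trans-≈ᴾ {π-word w (π i (π-word u f))} {π-word w (π-word u f)} {π-word w f}
      (π-longest-absorbs w longest i (π-word u f)) (absorb-word w longest u f)

    character-formula : ∀ w → IsLongest w → (X : FiniteSubset M) (T : FiniteSubset (ℳ-truncated R Rϖ J)) →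
                        ch X ≈ᴾ π-word w (ch T)
    -- Equality of two integers is stable under double negation, so the word may be used at each
    -- weight as if it were given.
    character-formula w longest X T ν = decidable-stable (coeff (ch X) ν ℤ.≟ coeff (π-word w (ch T)) ν) λ different →
      descends-ℳ (finite-enumerates X) λ (u , L₀ , E₀ , eq) → different (begin
        coeff (ch X) ν
          ≡⟨ π-word-fixed w (ch X) (λ i → character-fixed i (ℳ-stable i) (finite-enumerates X)) ν ⟨
        coeff (π-word w (ch X)) ν
          ≡⟨ π-longest-cong w {ch X} {π-word u (character L₀)} eq ν ⟩
        coeff (π-word w (π-word u (character L₀))) ν
          ≡⟨ absorb-word w longest u (character L₀) ν ⟩
        coeff (π-word w (character L₀)) ν
          ≡⟨ π-longest-cong w {character L₀} {ch T} (same E₀) ν ⟩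
        coeff (π-word w (ch T)) ν ∎)
      where
      open ≡-Reasoning
      T-enumerates : Enumerates (Within J) (FiniteSubset.elements T)
      T-enumerates = enumerates-cong truncated⇒within within⇒truncated (finite-enumerates T)
      same : ∀ {L₀} → Enumerates (Within J) L₀ → character L₀ ≈ᴾ ch T
      same E₀ = character-same (Enumerates.distinct E₀) (Enumerates.distinct T-enumerates)
        (λ p∈ → Enumerates.exhaust T-enumerates (Enumerates.sound E₀ p∈))
        (λ p∈ → Enumerates.exhaust E₀ (Enumerates.sound T-enumerates p∈))

corollary5p14 : (𝒮 : Setting) → let open Crystal 𝒮 in
    (R : Multiset) (Rϖ : Integral R)
    {ℓ : Level} (J : Pred I×̇ℤ ℓ) → UpwardClosed J → Supp R ⊆ J →
    (w∘ : Word) → IsLongest w∘ →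
    (X : FiniteSubset (ℳ R Rϖ)) (Y : FiniteSubset (ℳ-truncated R Rϖ J)) →
    ch X ≈ᴾ π-word w∘ (ch Y)
corollary5p14 𝒮 R Rϖ J J-up R⊆J w∘ longest X Y =
  Truncations.character-formula 𝒮 R Rϖ J J-up R⊆J w∘ longest X Y
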